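{- If $n\geq 9$, then $R(S_n(5),W_8)=2n-1$.
   Context: All graphs are finite and simple. For graphs $G,H$, $R(G,H)$ is the smallest $N$ such that every graph $F$ of order $N$ either contains $G$ as a subgraph or has complement $\overline{F}$ containing $H$. $W_8$ is the wheel of order 9 (a hub joined to every vertex of a cycle $C_8$). $S_k$ is the star of order $k$. $S_n(5)$ is the tree of order $n$ obtained by adding an edge joining the centers of the stars $S_5$ and $S_{n-5}$. -}

module Defs where

open import Data.Nat using (ℕ; zero; suc; _≡ᵇ_; _<ᵇ_; _<_; _∸_; _+_)
open import Data.Nat.Properties using ()
open import Data.Bool using (Bool; true; false; _∧_; _∨_; not)
open import Data.Bool.Properties using (∨-comm)
open import Data.Fin using (Fin; toℕ)
open import Data.Product using (Σ; _×_; _,_)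
open import Data.Sum using (_⊎_)
open import Function.Definitions using (Injective)
open import Relation.Binary.PropositionalEquality using (_≡_; refl; cong; cong₂)
open import Relation.Nullary using (¬_)

record Graph (n : ℕ) : Set where
  field
    adj    : Fin n → Fin n → Bool
    sym    : ∀ i j → adj i j ≡ adj j i
    irrefl : ∀ i → adj i i ≡ false
open Graph public

≡ᵇ-sym : ∀ m n → (m ≡ᵇ n) ≡ (n ≡ᵇ m)
≡ᵇ-sym zero zero = refl
≡ᵇ-sym zero (suc n) = refl
≡ᵇ-sym (suc m) zero = refl
≡ᵇ-sym (suc m) (suc n) = ≡ᵇ-sym m n

≡ᵇ-refl : ∀ m → (m ≡ᵇ m) ≡ true
≡ᵇ-refl zero = refl
≡ᵇ-refl (suc m) = ≡ᵇ-refl m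

complement : ∀ {n} → Graph n → Graph n
complement {n} F = record
  { adj    = λ i j → not (toℕ i ≡ᵇ toℕ j) ∧ not (adj F i j)
  ; sym    = λ i j → cong₂ (λ a b → not a ∧ not b) (≡ᵇ-sym (toℕ i) (toℕ j)) (sym F i j)
  ; irrefl = λ i → cong (λ a → not a ∧ not (adj F i i)) (≡ᵇ-refl (toℕ i))
  }

_⊆_ : ∀ {m n} → Graph m → Graph n → Set
_⊆_ {m} {n} G F =
  Σ (Fin m → Fin n) λ f →
    Injective _≡_ _≡_ f × (∀ u v → adj G u v ≡ true → adj F (f u) (f v) ≡ true)

Arrows : ∀ {a b} → ℕ → Graph a → Graph b → Set
Arrows N G H = (F : Graph N) → (G ⊆ F) ⊎ (H ⊆ complement F)

IsRamseyNumber : ∀ {a b} → Graph a → Graph b → ℕ → Set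
IsRamseyNumber G H N = Arrows N G H × (∀ M → M < N → ¬ Arrows M G H)

fromRel : ∀ n → (ℕ → ℕ → Bool) → Graph n
fromRel n E = record
  { adj    = λ i j → not (toℕ i ≡ᵇ toℕ j) ∧ (E (toℕ i) (toℕ j) ∨ E (toℕ j) (toℕ i))
  ; sym    = λ i j → cong₂ (λ a b → not a ∧ b) (≡ᵇ-sym (toℕ i) (toℕ j)) (∨-comm (E (toℕ i) (toℕ j)) (E (toℕ j) (toℕ i)))
  ; irrefl = λ i → cong (λ a → not a ∧ (E (toℕ i) (toℕ i) ∨ E (toℕ i) (toℕ i))) (≡ᵇ-refl (toℕ i))
  }

_≤ᵇ_ : ℕ → ℕ → Bool
a ≤ᵇ b = a <ᵇ suc b

-- The wheel W_8 (order 9): hub 0 joined to 1..8; rim cycle 1-2-...-8-1.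
wheelEdge : ℕ → ℕ → Bool
wheelEdge a b =
     ((a ≡ᵇ 0) ∧ (1 ≤ᵇ b) ∧ (b ≤ᵇ 8))
  ∨ ((1 ≤ᵇ a) ∧ (a ≤ᵇ 7) ∧ (b ≡ᵇ suc a))
  ∨ ((a ≡ᵇ 1) ∧ (b ≡ᵇ 8))

W₈ : Graph 9
W₈ = fromRel 9 wheelEdge

-- S_n(5): the tree of order n obtained from stars S_5 (center 0, leaves 1..4)
-- and S_{n-5} (center 5, leaves 6..n-1) by joining the centers 0 and 5.
doubleStarEdge : ℕ → ℕ → Bool
doubleStarEdge a b =
     ((a ≡ᵇ 0) ∧ (1 ≤ᵇ b) ∧ (b ≤ᵇ 5))
  ∨ ((a ≡ᵇ 5) ∧ (6 ≤ᵇ b))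

Sn5 : (n : ℕ) → Graph n
Sn5 n = fromRel n doubleStarEdge

module Submission where

-- Lower bound: two disjoint cliques on at most n - 1 vertices each contain no
-- connected graph of order n, and their complement is bipartite.
--
-- Upper bound: let b have maximum degree d in F and let M be the set of its
-- non-neighbours. If d ≤ n - 6, the complement is dense enough for a greedy wheel,
-- found either around a vertex of minimum degree in the complement neighbourhood of
-- any vertex, or around that vertex itself by a four-cycle of pairs with many common
-- neighbours. If d ≥ n - 5 and F has no S_n(5) centred on an edge at b, then every
-- neighbour a of b has degree at most 4 or at most n - 2 - d neighbours in M. Hence
-- the complement is almost complete between N(b) and M, and an eight-cycle can be
-- threaded alternately through the two sides. This fails only if some n vertices of
-- M induce maximum degree at most 3 in the complement; then two of them far apart in
-- the complement are the centres of S_n(5), or the complement there is the Petersen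
-- graph, which contains an eight-cycle.

open import Data.Bool using (Bool; true; false; _∧_; _∨_; not; if_then_else_; T; _xor_)
open import Data.Bool.Properties using (∨-zeroʳ; ∨-identityʳ; not-involutive; not-¬; ∧-zeroʳ) renaming (_≟_ to _≟ᵇ_)
open import Data.Empty using (⊥; ⊥-elim)
open import Data.Fin using (Fin; zero; suc; toℕ; fromℕ<)
open import Data.Fin.Patterns using (0F; 1F; 2F; 3F; 4F; 5F; 6F; 7F; 8F)
open import Data.Fin.Properties using (toℕ-injective; all?; toℕ<n; any?; pigeonhole; fromℕ<-injective) renaming (_≟_ to _≟ᶠ_; suc-injective to sucᶠ-injective)
open import Data.List using (List; []; _∷_; map; length)
open import Data.Nat using (ℕ; zero; suc; _+_; _*_; _≤_; _<_; z≤n; s≤s; _≤ᵇ_; _<ᵇ_; _≡ᵇ_; _∸_)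
open import Data.Nat.DivMod using (_%_; m*n%n≡0)
open import Data.Nat.Properties
open import Data.Nat.Solver using (module +-*-Solver)
open import Data.Product using (_×_; _,_; proj₁; proj₂; Σ-syntax; ∃-syntax)
open import Data.Sum using (_⊎_; inj₁; inj₂; reduce; map₂) renaming (map to map-⊎)
open import Data.Unit using (⊤; tt)
open import Data.Vec using (Vec; []; _∷_; lookup)
open import Data.Vec.Relation.Unary.All using ([]; _∷_)
open import Data.Vec.Relation.Unary.AllPairs using ([]; _∷_)
open import Data.Vec.Relation.Unary.Unique.Propositional using (Unique)
open import Data.Vec.Relation.Unary.Unique.Propositional.Properties using (lookup-injective)
open import Defs using (≡ᵇ-refl; Graph; adj; irrefl; complement; W₈; Sn5; _⊆_; ≡ᵇ-sym; doubleStarEdge; Arrows; IsRamseyNumber)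
open import Function using (_∘_)
open import Function.Definitions using (Injective)
open import Relation.Binary.PropositionalEquality using (_≡_; _≢_; refl; sym; trans; cong; cong₂; subst; module ≡-Reasoning)
open import Relation.Nullary using (¬_; Dec; yes; no)
open import Relation.Nullary.Decidable using (from-yes; _→-dec_; _⊎-dec_; _×-dec_; ¬?)

-- All wheels except the one found in the Petersen graph come from one scheme. Four rim vertices,
-- the spokes, are fixed; the other four form a system of distinct representatives for the sets of
-- common complement neighbours of cyclically consecutive spokes. Sizes 1, 2, 3, 3 and a union of at
-- least four elements suffice, so the work lies in choosing the spokes and their cyclic order.
--
-- Write q = n - 2 - d. For n - 5 ≤ d ≤ n - 2 it lies between 0 and 3, M has n + q vertices, and by
-- maximality of d every vertex of M has at least 1 + 2q complement neighbours in M. For q = 3 these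
-- seven are just enough for the scheme. For q ≤ 2 there may be too few; then q vertices of M can be
-- deleted such that some neighbour of b is complement-adjacent to all n that remain and can serve
-- as their hub. This is the origin of the exceptional sets of exactly n vertices.

bit : Bool → ℕ
bit true  = 1
bit false = 0

sumF : ∀ {N} → (Fin N → ℕ) → ℕ
sumF {zero}  w = 0
sumF {suc N} w = w zero + sumF (w ∘ suc)

count : ∀ {N} → (Fin N → Bool) → ℕ
count P = sumF (λ x → bit (P x))

sumF-+ : ∀ {N} (v w : Fin N → ℕ) → sumF (λ x → v x + w x) ≡ sumF v + sumF w
sumF-+ {zero}  v w = refl
sumF-+ {suc N} v w rewrite sumF-+ (v ∘ suc) (w ∘ suc) =
  solve 4 (λ a b c d → (a :+ b) :+ (c :+ d) := (a :+ c) :+ (b :+ d)) refl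
    (v zero) (w zero) (sumF (v ∘ suc)) (sumF (w ∘ suc))
  where open +-*-Solver using (solve; _:+_; _:*_; _:=_)

sumF-* : ∀ {N} k (w : Fin N → ℕ) → sumF (λ x → k * w x) ≡ k * sumF w
sumF-* {zero}  k w = sym (*-zeroʳ k)
sumF-* {suc N} k w rewrite sumF-* k (w ∘ suc) = sym (*-distribˡ-+ k (w zero) _)

sumF-0 : ∀ N → sumF {N} (λ _ → 0) ≡ 0
sumF-0 zero    = refl
sumF-0 (suc N) = sumF-0 N

sumF-≤ : ∀ {N} {v w : Fin N → ℕ} → (∀ x → v x ≤ w x) → sumF v ≤ sumF w
sumF-≤ {zero}  le = z≤n
sumF-≤ {suc N} le = +-mono-≤ (le zero) (sumF-≤ (le ∘ suc))

-- Linear inequalities between cardinalities of Boolean combinations of sets,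
-- proved by Farkas certificates: after summing the hypotheses with the given
-- multipliers it suffices to compare coefficients on every region of the Venn
-- diagram of the sets.

infix  11 ∁_
infixr 10 _⋏_
infixr 9 _⋎_
data Form : Set where
  var     : ℕ → Form
  ∁_      : Form → Form
  _⋏_ _⋎_ : Form → Form → Form

nth : List Bool → ℕ → Bool
nth []       i       = false
nth (b ∷ bs) zero    = b
nth (b ∷ bs) (suc i) = nth bs i

eval : Form → List Bool → Bool
eval (var i) ρ = nth ρ i
eval (∁ φ)   ρ = not (eval φ ρ)
eval (φ ⋏ ψ) ρ = eval φ ρ ∧ eval ψ ρ
eval (φ ⋎ ψ) ρ = eval φ ρ ∨ eval ψ ρ

infixl 7 _⊕_
infix  8 _⊗_
data Term : Set where
  ♯    : ℕ → Term
  atom : ℕ → Term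
  ∣_∣  : Form → Term
  _⊕_  : Term → Term → Term
  _⊗_  : ℕ → Term → Term

infix 6 _≼_
data Fact : Set where
  _≼_    : Term → Term → Fact
  always : Form → Fact

nthℕ : List ℕ → ℕ → ℕ
nthℕ []       i       = 0
nthℕ (n ∷ ns) zero    = n
nthℕ (n ∷ ns) (suc i) = nthℕ ns i

at : ∀ {N} → List (Fin N → Bool) → Fin N → List Bool
at ps x = map (λ P → P x) ps

⟦_⟧ : Term → ∀ {N} → List (Fin N → Bool) → List ℕ → ℕ
⟦ ♯ n ⟧    ps ns = n
⟦ atom i ⟧ ps ns = nthℕ ns i
⟦ ∣ φ ∣ ⟧  ps ns = count (λ x → eval φ (at ps x))
⟦ s ⊕ t ⟧  ps ns = ⟦ s ⟧ ps ns + ⟦ t ⟧ ps ns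
⟦ k ⊗ t ⟧  ps ns = k * ⟦ t ⟧ ps ns

Holds : Fact → ∀ {N} → List (Fin N → Bool) → List ℕ → Set
Holds (s ≼ t)    ps ns = ⟦ s ⟧ ps ns ≤ ⟦ t ⟧ ps ns
Holds (always φ) ps ns = ∀ x → eval φ (at ps x) ≡ true

AllHold : List Fact → ∀ {N} → List (Fin N → Bool) → List ℕ → Set
AllHold []       ps ns = ⊤
AllHold (h ∷ hs) ps ns = Holds h ps ns × AllHold hs ps ns

-- Atoms are eliminated one at a time: the contribution of the first is recorded by `coeff₀`, and
-- the others are renumbered.
shift : Term → Term
shift (♯ n)          = ♯ n
shift (atom zero)    = ♯ 0
shift (atom (suc i)) = atom i
shift ∣ φ ∣          = ∣ φ ∣
shift (s ⊕ t)        = shift s ⊕ shift t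
shift (k ⊗ t)        = k ⊗ shift t

coeff₀ : Term → ℕ
coeff₀ (atom zero) = 1
coeff₀ (s ⊕ t)     = coeff₀ s + coeff₀ t
coeff₀ (k ⊗ t)     = k * coeff₀ t
coeff₀ _           = 0

const₀ : Term → ℕ
const₀ (♯ n)   = n
const₀ (s ⊕ t) = const₀ s + const₀ t
const₀ (k ⊗ t) = k * const₀ t
const₀ _       = 0

weight : Term → List Bool → ℕ
weight ∣ φ ∣   ρ = bit (eval φ ρ)
weight (s ⊕ t) ρ = weight s ρ + weight t ρ
weight (k ⊗ t) ρ = k * weight t ρ
weight _       ρ = 0

⟦⟧-shift : ∀ t {N} (ps : List (Fin N → Bool)) n ns →
           ⟦ t ⟧ ps (n ∷ ns) ≡ coeff₀ t * n + ⟦ shift t ⟧ ps ns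
⟦⟧-shift (♯ m)          ps n ns = refl
⟦⟧-shift (atom zero)    ps n ns = sym (trans (+-identityʳ _) (*-identityˡ n))
⟦⟧-shift (atom (suc i)) ps n ns = refl
⟦⟧-shift ∣ φ ∣          ps n ns = refl
⟦⟧-shift (s ⊕ t)        ps n ns rewrite ⟦⟧-shift s ps n ns | ⟦⟧-shift t ps n ns =
  solve 5 (λ a b c d e → (a :* e :+ c) :+ (b :* e :+ d) := (a :+ b) :* e :+ (c :+ d)) refl
    (coeff₀ s) (coeff₀ t) (⟦ shift s ⟧ ps ns) (⟦ shift t ⟧ ps ns) n
  where open +-*-Solver using (solve; _:+_; _:*_; _:=_)
⟦⟧-shift (k ⊗ t) ps n ns rewrite ⟦⟧-shift t ps n ns =
  solve 4 (λ a c e m → m :* (a :* e :+ c) := (m :* a) :* e :+ m :* c) refl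
    (coeff₀ t) (⟦ shift t ⟧ ps ns) n k
  where open +-*-Solver using (solve; _:+_; _:*_; _:=_)

⟦⟧-regions : ∀ t {N} (ps : List (Fin N → Bool)) →
             ⟦ t ⟧ ps [] ≡ const₀ t + sumF (λ x → weight t (at ps x))
⟦⟧-regions (♯ n)    {N} ps = sym (trans (cong (n +_) (sumF-0 N)) (+-identityʳ n))
⟦⟧-regions (atom i) {N} ps = sym (sumF-0 N)
⟦⟧-regions ∣ φ ∣    ps = refl
⟦⟧-regions (s ⊕ t)  ps
  rewrite ⟦⟧-regions s ps | ⟦⟧-regions t ps
        | sumF-+ (λ x → weight s (at ps x)) (λ x → weight t (at ps x)) =
  solve 4 (λ a b c d → (a :+ b) :+ (c :+ d) := (a :+ c) :+ (b :+ d)) refl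
    (const₀ s) _ (const₀ t) _
  where open +-*-Solver using (solve; _:+_; _:*_; _:=_)
⟦⟧-regions (k ⊗ t)  ps
  rewrite ⟦⟧-regions t ps | sumF-* k (λ x → weight t (at ps x)) = *-distribˡ-+ k (const₀ t) _

-- Facts of the form `always φ` act only by emptying regions of the Venn diagram; coefficients on an
-- empty region are not compared.
possible : List Fact → List Bool → Bool
possible []              ρ = true
possible (always φ ∷ hs) ρ = eval φ ρ ∧ possible hs ρ
possible (_ ∷ hs)        ρ = possible hs ρ

everywhere : ℕ → (List Bool → Bool) → Bool
everywhere zero    q = q []
everywhere (suc k) q = everywhere k (q ∘ (true ∷_)) ∧ everywhere k (q ∘ (false ∷_))

-- The arguments `k` and `e` count the sets and the atoms. Atoms and regions have arbitrary
-- nonnegative values, so weak comparison of each coefficient suffices; strictness comes from the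
-- constants alone.
below : ℕ → ℕ → List Fact → Term → Term → Bool
below k zero    hs s t =
  (const₀ s <ᵇ const₀ t) ∧
  everywhere k (λ ρ → if possible hs ρ then weight s ρ ≤ᵇ weight t ρ else true)
below k (suc e) hs s t = (coeff₀ s ≤ᵇ coeff₀ t) ∧ below k e hs (shift s) (shift t)

∧-true : ∀ {a b} → a ∧ b ≡ true → a ≡ true × b ≡ true
∧-true {true} {true} _ = refl , refl

≤ᵇ-true : ∀ m n → (m ≤ᵇ n) ≡ true → m ≤ n
≤ᵇ-true m n eq = ≤ᵇ⇒≤ m n (subst T (sym eq) tt)

everywhere-elim : ∀ {N} (ps : List (Fin N → Bool)) q →
                  everywhere (length ps) q ≡ true → ∀ x → q (at ps x) ≡ true
everywhere-elim []       q eq x = eq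
everywhere-elim (P ∷ ps) q eq x with P x
... | true  = everywhere-elim ps (q ∘ (true ∷_)) (proj₁ (∧-true eq)) x
... | false = everywhere-elim ps (q ∘ (false ∷_)) (proj₂ (∧-true {everywhere (length ps) (q ∘ (true ∷_))} eq)) x

possible-all : ∀ hs {N} (ps : List (Fin N → Bool)) ns → AllHold hs ps ns →
               ∀ x → possible hs (at ps x) ≡ true
possible-all []              ps ns _        x = refl
possible-all (always φ ∷ hs) ps ns (h , hh) x rewrite h x = possible-all hs ps ns hh x
possible-all (_ ≼ _ ∷ hs)    ps ns (_ , hh) x = possible-all hs ps ns hh x

below-sound : ∀ {N} (ps : List (Fin N → Bool)) ns hs s t →
              (∀ x → possible hs (at ps x) ≡ true) →
              below (length ps) (length ns) hs s t ≡ true → ⟦ s ⟧ ps ns < ⟦ t ⟧ ps ns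
below-sound ps [] hs s t poss eq
  rewrite ⟦⟧-regions s ps | ⟦⟧-regions t ps =
  +-mono-<-≤ (≤ᵇ-true _ _ (proj₁ (∧-true eq)))
    (sumF-≤ λ x → ≤ᵇ-true _ _ (region x (poss x)
      (everywhere-elim ps _ (proj₂ (∧-true {const₀ s <ᵇ const₀ t} eq)) x)))
  where
  region : ∀ x {b} → possible hs (at ps x) ≡ true →
           (if possible hs (at ps x) then b else true) ≡ true → b ≡ true
  region x p r rewrite p = r
below-sound ps (n ∷ ns) hs s t poss eq
  rewrite ⟦⟧-shift s ps n ns | ⟦⟧-shift t ps n ns =
  +-mono-≤-< (*-monoˡ-≤ n (≤ᵇ-true (coeff₀ s) (coeff₀ t) (proj₁ (∧-true {coeff₀ s ≤ᵇ coeff₀ t} eq))))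
    (below-sound ps ns hs (shift s) (shift t) poss
      (proj₂ (∧-true {coeff₀ s ≤ᵇ coeff₀ t} eq)))

lefts rights : List Fact → List ℕ → Term
lefts (s ≼ t ∷ hs)    (m ∷ ms) = (m ⊗ s) ⊕ lefts hs ms
lefts (always _ ∷ hs) ms       = lefts hs ms
lefts _               _        = ♯ 0
rights (s ≼ t ∷ hs)    (m ∷ ms) = (m ⊗ t) ⊕ rights hs ms
rights (always _ ∷ hs) ms       = rights hs ms
rights _               _        = ♯ 0

lefts≤rights : ∀ hs ms {N} (ps : List (Fin N → Bool)) ns → AllHold hs ps ns →
               ⟦ lefts hs ms ⟧ ps ns ≤ ⟦ rights hs ms ⟧ ps ns
lefts≤rights []              _        ps ns _        = z≤n
lefts≤rights (_ ≼ _ ∷ hs)    []       ps ns _        = z≤n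
lefts≤rights (s ≼ t ∷ hs)    (m ∷ ms) ps ns (h , hh) =
  +-mono-≤ (*-monoʳ-≤ m h) (lefts≤rights hs ms ps ns hh)
lefts≤rights (always _ ∷ hs) ms       ps ns (_ , hh) = lefts≤rights hs ms ps ns hh

-- The goal enters negated, as one more hypothesis of a refutation. Multiplier 0 for it means that
-- the other hypotheses are already inconsistent; this is how the goals 1 ≤ 0 are proved.
Goal : Term → Term → List Fact → List Fact
Goal s t hs = (♯ 1 ⊕ t ≼ s) ∷ hs

-- The first multiplier is that of the negated goal.
prove : ∀ {N} (ps : List (Fin N → Bool)) ns hs s t ms →
        below (length ps) (length ns) hs (rights (Goal s t hs) ms) (lefts (Goal s t hs) ms) ≡ true →
        AllHold hs ps ns → ⟦ s ⟧ ps ns ≤ ⟦ t ⟧ ps ns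
prove ps ns hs s t ms eq hh = ≮⇒≥ λ lt →
  <⇒≱ (below-sound ps ns hs (rights (Goal s t hs) ms) (lefts (Goal s t hs) ms)
         (possible-all hs ps ns hh) eq)
      (lefts≤rights (Goal s t hs) ms ps ns (lt , hh))

pattern A = var 0
pattern B = var 1
pattern C = var 2
pattern D = var 3
pattern E = var 4
pattern G = var 5

-- Finite sets as Boolean functions: membership, selection, extremal elements, double counting.

infix 4 _∈_ _∉_
_∈_ _∉_ : ∀ {N} → Fin N → (Fin N → Bool) → Set
x ∈ P = P x ≡ true
x ∉ P = P x ≡ false

true≢false : ∀ {b} → b ≡ true → b ≡ false → ⊥
true≢false refl ()

∈-or-∉ : ∀ {N} (P : Fin N → Bool) x → x ∈ P ⊎ x ∉ P
∈-or-∉ P x with P x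
... | true  = inj₁ refl
... | false = inj₂ refl

not-∈ : ∀ {b} → b ≡ false → not b ≡ true
not-∈ refl = refl

not-∉ : ∀ {b} → not b ≡ true → b ≡ false
not-∉ {false} _ = refl

∧-∈ : ∀ {a b} → a ≡ true → b ≡ true → a ∧ b ≡ true
∧-∈ refl refl = refl

is : ∀ {N} → Fin N → Fin N → Bool
is u x = toℕ u ≡ᵇ toℕ x

is-refl : ∀ {N} (u : Fin N) → u ∈ is u
is-refl u = ≡ᵇ-refl (toℕ u)

is⇒≡ : ∀ {N} {u x : Fin N} → x ∈ is u → u ≡ x
is⇒≡ {u = u} {x} eq = toℕ-injective (≡ᵇ⇒≡ (toℕ u) (toℕ x) (subst T (sym eq) tt))

≢⇒∉is : ∀ {N} {u x : Fin N} → u ≢ x → x ∉ is u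
≢⇒∉is {u = u} {x} ne with is u x in eq
... | true  = ⊥-elim (ne (is⇒≡ eq))
... | false = refl

count-is : ∀ {N} (u : Fin N) → count (is u) ≡ 1
count-is {suc N} zero    = cong suc (sumF-0 N)
count-is {suc N} (suc u) = count-is u

∈-is : ∀ {N} {P : Fin N → Bool} {u} → u ∈ P → ∀ x → not (is u x) ∨ P x ≡ true
∈-is {P = P} {u} h x with is u x in eq
... | false = refl
... | true  = subst (_∈ P) (is⇒≡ eq) h

∉-is : ∀ {N} {P : Fin N → Bool} {u} → u ∉ P → ∀ x → not (is u x) ∨ not (P x) ≡ true
∉-is {P = P} h = ∈-is {P = not ∘ P} (not-∈ h)

1≤is : ∀ {N} (u : Fin N) → 1 ≤ count (is u)
1≤is u = ≤-reflexive (sym (count-is u))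

is≤1 : ∀ {N} (u : Fin N) → count (is u) ≤ 1
is≤1 u = ≤-reflexive (count-is u)

count-mono : ∀ {N} {P Q : Fin N → Bool} → (∀ x → x ∈ P → x ∈ Q) → count P ≤ count Q
count-mono {P = P} {Q} sub = sumF-≤ step
  where
  step : ∀ x → bit (P x) ≤ bit (Q x)
  step x with P x in eq
  ... | false = z≤n
  ... | true rewrite sub x eq = ≤-refl

⊆⇒always : ∀ {N} {P Q : Fin N → Bool} → (∀ x → x ∈ P → x ∈ Q) → ∀ x → not (P x) ∨ Q x ≡ true
⊆⇒always {P = P} sub x with P x in eq
... | false = refl
... | true  = sub x eq

∈⇒1≤ : ∀ {N} {P : Fin N → Bool} {x} → x ∈ P → 1 ≤ count P
∈⇒1≤ {P = P} {x} h = subst (_≤ count P) (count-is x) (count-mono {P = is x} {P} λ y e → subst (_∈ P) (is⇒≡ e) h)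

count-all : ∀ N → count {N} (λ _ → true) ≡ N
count-all zero    = refl
count-all (suc N) = cong suc (count-all N)

opaque
  pick : ∀ {N} {P : Fin N → Bool} → 1 ≤ count P → ∃[ x ] x ∈ P
  pick {suc N} {P} le with P zero in eq
  ... | true  = zero , eq
  ... | false = let x , h = pick {N} {P ∘ suc} le in suc x , h

  find : ∀ {N} (P : Fin N → Bool) → (∃[ x ] x ∈ P) ⊎ (∀ x → x ∉ P)
  find {zero}  P = inj₂ λ ()
  find {suc N} P with P zero in eq | find (P ∘ suc)
  ... | true  | _            = inj₁ (zero , eq)
  ... | false | inj₁ (x , h) = inj₁ (suc x , h)
  ... | false | inj₂ none    = inj₂ λ { zero → eq ; (suc x) → none x }

  choose : ∀ {N} k {P : Fin N → Bool} → k ≤ count P →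
           Σ[ c ∈ (Fin k → Fin N) ] Injective _≡_ _≡_ c × (∀ i → c i ∈ P)
  choose zero    le = (λ ()) , (λ {i} → ⊥-elim (noFin0 i)) , λ ()
    where
    noFin0 : Fin 0 → ⊥
    noFin0 ()
  choose {N} (suc k) {P} le = c , inj , mem
    where
    P∋ : ∃[ x ] x ∈ P
    P∋ = pick {P = P} (≤-trans (s≤s z≤n) le)
    x : Fin N
    x = proj₁ P∋
    rest : k ≤ count (λ y → P y ∧ not (is x y))
    rest = prove (P ∷ is x ∷ []) (k ∷ []) ((♯ 1 ⊕ atom 0 ≼ ∣ A ∣) ∷ (∣ B ∣ ≼ ♯ 1) ∷ []) (atom 0) (∣ A ⋏ ∁ B ∣) (1 ∷ 1 ∷ 1 ∷ []) refl
             (le , is≤1 x , tt)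
    ih : Σ[ c ∈ (Fin k → Fin N) ] Injective _≡_ _≡_ c × (∀ i → c i ∈ (λ y → P y ∧ not (is x y)))
    ih = choose k rest
    c : Fin (suc k) → Fin N
    c zero    = x
    c (suc i) = proj₁ ih i
    fresh : ∀ i → x ≢ proj₁ ih i
    fresh i eq = true≢false (subst (_∈ is x) eq (is-refl x)) (not-∉ (proj₂ (∧-true {P (proj₁ ih i)} (proj₂ (proj₂ ih) i))))
    inj : Injective _≡_ _≡_ c
    inj {zero}  {zero}  eq = refl
    inj {zero}  {suc j} eq = ⊥-elim (fresh j eq)
    inj {suc i} {zero}  eq = ⊥-elim (fresh i (sym eq))
    inj {suc i} {suc j} eq = cong suc (proj₁ (proj₂ ih) eq)
    mem : ∀ i → c i ∈ P
    mem zero    = proj₂ P∋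
    mem (suc i) = proj₁ (∧-true (proj₂ (proj₂ ih) i))

  -- An abstract total preorder lets one search serve for minima and maxima.
  extremal : ∀ {N} {P : Fin N → Bool} (_≲_ : Fin N → Fin N → Set) →
             (∀ x y → x ≲ y ⊎ y ≲ x) → (∀ {x y z} → x ≲ y → y ≲ z → x ≲ z) →
             1 ≤ count P → ∃[ x ] x ∈ P × (∀ y → y ∈ P → x ≲ y)
  extremal {suc N} {P} _≲_ total tr le = go (find (P ∘ suc)) (P zero) refl
    where
    ≲-refl : ∀ {x} → x ≲ x
    ≲-refl {x} = reduce (total x x)
    Best : Set
    Best = ∃[ x ] x ∈ P × (∀ y → y ∈ P → x ≲ y)
    go : (∃[ x ] x ∈ (P ∘ suc)) ⊎ (∀ x → x ∉ (P ∘ suc)) → ∀ b → P zero ≡ b → Best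
    go (inj₂ none) false eq = ⊥-elim (none′ (pick {P = P} le))
      where
      none′ : ∃[ x ] x ∈ P → ⊥
      none′ (zero  , h) = true≢false h eq
      none′ (suc x , h) = true≢false h (none x)
    go (inj₂ none) true eq = zero , eq , λ { zero _ → ≲-refl ; (suc y) h → ⊥-elim (true≢false h (none y)) }
    go (inj₁ (x , h)) b eq = compare b eq (extremal {P = P ∘ suc} (λ x y → suc x ≲ suc y)
                                     (λ x y → total (suc x) (suc y)) tr (∈⇒1≤ {P = P ∘ suc} h))
      where
      compare : ∀ b → P zero ≡ b → ∃[ x ] suc x ∈ P × (∀ y → suc y ∈ P → suc x ≲ suc y) → Best
      compare false eq (x , h , best) = suc x , h , λ { zero z → ⊥-elim (true≢false z eq) ; (suc y) → best y }
      compare true  eq (x , h , best) with total zero (suc x)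
      ... | inj₁ le = zero , eq , λ { zero _ → ≲-refl ; (suc y) k → tr le (best y k) }
      ... | inj₂ ge = suc x , h , λ { zero _ → ge ; (suc y) → best y }

minimal : ∀ {N} {P : Fin N → Bool} (w : Fin N → ℕ) → 1 ≤ count P →
          ∃[ x ] x ∈ P × (∀ y → y ∈ P → w x ≤ w y)
minimal w = extremal (λ x y → w x ≤ w y) (λ x y → ≤-total (w x) (w y)) ≤-trans

maximal : ∀ {N} {P : Fin N → Bool} (w : Fin N → ℕ) → 1 ≤ count P →
          ∃[ x ] x ∈ P × (∀ y → y ∈ P → w y ≤ w x)
maximal w = extremal (λ x y → w y ≤ w x) (λ x y → ≤-total (w y) (w x)) (λ p q → ≤-trans q p)

sumF-cong : ∀ {N} {v w : Fin N → ℕ} → (∀ x → v x ≡ w x) → sumF v ≡ sumF w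
sumF-cong {zero}  h = refl
sumF-cong {suc N} h = cong₂ _+_ (h zero) (sumF-cong (h ∘ suc))

sumF-swap : ∀ {M N} (w : Fin M → Fin N → ℕ) →
            sumF (λ x → sumF (w x)) ≡ sumF (λ y → sumF (λ x → w x y))
sumF-swap {zero}  {N} w = sym (sumF-0 N)
sumF-swap {suc M} w = trans (cong (sumF (w zero) +_) (sumF-swap (w ∘ suc))) (sym (sumF-+ (w zero) _))

sumOver : ∀ {N} → (Fin N → Bool) → (Fin N → ℕ) → ℕ
sumOver P w = sumF (λ x → bit (P x) * w x)

sumOver-≤ : ∀ {N} {P : Fin N → Bool} {w k} → (∀ x → x ∈ P → w x ≤ k) → sumOver P w ≤ k * count P
sumOver-≤ {P = P} {w} {k} h = ≤-trans (sumF-≤ step) (≤-reflexive (sumF-* k (bit ∘ P)))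
  where
  step : ∀ x → bit (P x) * w x ≤ k * bit (P x)
  step x with P x in eq
  ... | false = z≤n
  ... | true  = ≤-trans (≤-reflexive (+-identityʳ (w x))) (≤-trans (h x eq) (≤-reflexive (sym (*-identityʳ k))))

≤-sumOver : ∀ {N} {P : Fin N → Bool} {w k} → (∀ x → x ∈ P → k ≤ w x) → k * count P ≤ sumOver P w
≤-sumOver {P = P} {w} {k} h = ≤-trans (≤-reflexive (sym (sumF-* k (bit ∘ P)))) (sumF-≤ step)
  where
  step : ∀ x → k * bit (P x) ≤ bit (P x) * w x
  step x with P x in eq
  ... | false = ≤-reflexive (*-zeroʳ k)
  ... | true  = ≤-trans (≤-reflexive (*-identityʳ k)) (≤-trans (h x eq) (≤-reflexive (sym (+-identityʳ (w x)))))

double-count : ∀ {M N} (P : Fin M → Bool) (Q : Fin N → Bool) (r : Fin M → Fin N → Bool) (s : Fin N → Fin M → Bool) →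
               (∀ x y → r x y ≡ s y x) →
               sumOver P (λ x → count (λ y → Q y ∧ r x y)) ≡ sumOver Q (λ y → count (λ x → P x ∧ s y x))
double-count P Q r s rs =
  trans (sumF-cong λ x → trans (sym (sumF-* (bit (P x)) (λ y → bit (Q y ∧ r x y)))) (sumF-cong {v = λ y → bit (P x) * bit (Q y ∧ r x y)} λ y → swap (P x) (Q y) (rs x y)))
  (trans (sumF-swap λ x y → bit (Q y) * bit (P x ∧ s y x))
         (sumF-cong λ y → sumF-* (bit (Q y)) (λ x → bit (P x ∧ s y x))))
  where
  swap : ∀ p q {a b} → a ≡ b → bit p * bit (q ∧ a) ≡ bit q * bit (p ∧ b)
  swap true  true  refl = refl
  swap true  false refl = refl
  swap false true  refl = refl
  swap false false refl = refl

-- Systems of distinct representatives of four sets.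

Distinct₄ : ∀ {A : Set} → A → A → A → A → Set
Distinct₄ a b c d = a ≢ b × a ≢ c × a ≢ d × b ≢ c × b ≢ d × c ≢ d

distinct₄ : ∀ {N} → Fin N → Fin N → Fin N → Fin N → Bool
distinct₄ i j k l = not (is i j) ∧ not (is i k) ∧ not (is i l) ∧ not (is j k) ∧ not (is j l) ∧ not (is k l)

∉is⇒≢ : ∀ {N} {u x : Fin N} → not (is u x) ≡ true → u ≢ x
∉is⇒≢ {u = u} h refl = true≢false (is-refl u) (not-∉ h)

distinct₄-sound : ∀ {N} (i j k l : Fin N) → distinct₄ i j k l ≡ true → Distinct₄ i j k l
distinct₄-sound i j k l h =
  let a , h₁ = ∧-true {not (is i j)} h
      b , h₂ = ∧-true {not (is i k)} h₁
      c , h₃ = ∧-true {not (is i l)} h₂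
      d , h₄ = ∧-true {not (is j k)} h₃
      e , f  = ∧-true {not (is j l)} h₄
  in ∉is⇒≢ a , ∉is⇒≢ b , ∉is⇒≢ c , ∉is⇒≢ d , ∉is⇒≢ e , ∉is⇒≢ f

SDR : ∀ {N} → (P Q R S : Fin N → Bool) → Set
SDR P Q R S = ∃[ a ] ∃[ b ] ∃[ c ] ∃[ d ] (a ∈ P × b ∈ Q × c ∈ R × d ∈ S × Distinct₄ a b c d)

-- The sizes 1, 2, 3 allow `a`, `b`, `c` to be chosen greedily. The bound on the union, which is
-- Hall's condition for the whole family, matters only if `S` is then exhausted.
sdr : ∀ {N} {P Q R S : Fin N → Bool} →
      1 ≤ count P → 2 ≤ count Q → 3 ≤ count R → 3 ≤ count S →
      4 ≤ count (λ x → P x ∨ Q x ∨ R x ∨ S x) → SDR P Q R S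
sdr {N} {P} {Q} {R} {S} p q r s u = from-a (pick {P = P} p)
  where
  Outside : (a b c x : Fin N) → Bool
  Outside a b c x = not (is a x) ∧ not (is b x) ∧ not (is c x)

  outside : ∀ {a b c} x → x ∈ Outside a b c → a ≢ x × b ≢ x × c ≢ x
  outside {a} {b} {c} x h =
    let h₁ , h′ = ∧-true {not (is a x)} h
        h₂ , h₃ = ∧-true {not (is b x)} h′
    in ∉is⇒≢ h₁ , ∉is⇒≢ h₂ , ∉is⇒≢ h₃

  module _ {a b c} (ap : a ∈ P) (bq : b ∈ Q) (cr : c ∈ R) (ab : a ≢ b) (ac : a ≢ c) (bc : b ≢ c) where
    fresh-S : ∃[ d ] d ∈ (λ x → S x ∧ Outside a b c x) → SDR P Q R S
    fresh-S (d , h) =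
      let ds , o = ∧-true {S d} h
          ad , bd , cd = outside d o
      in a , b , c , d , ap , bq , cr , ds , ab , ac , ad , bc , bd , cd

    S⊆abc : (∀ x → x ∉ (λ x → S x ∧ Outside a b c x)) → a ∈ S × b ∈ S × c ∈ S
    S⊆abc none = member a a∉ , member b b∉ , member c c∉
      where
      member : ∀ y → (y ∉ S → ⊥) → y ∈ S
      member y k with ∈-or-∉ S y
      ... | inj₁ h = h
      ... | inj₂ h = ⊥-elim (k h)
      none′ : ∀ x → not (S x ∧ Outside a b c x) ≡ true
      none′ x = not-∈ (none x)
      a∉ : a ∉ S → ⊥
      a∉ h = <-irrefl refl (prove (S ∷ is a ∷ is b ∷ is c ∷ []) []
        (always (∁ (A ⋏ ∁ B ⋏ ∁ C ⋏ ∁ D)) ∷ always (∁ B ⋎ ∁ A) ∷ (♯ 3 ≼ ∣ A ∣) ∷ (∣ C ∣ ≼ ♯ 1) ∷ (∣ D ∣ ≼ ♯ 1) ∷ [])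
        (♯ 1) (♯ 0) (0 ∷ 1 ∷ 1 ∷ 1 ∷ []) refl (none′ , ∉-is {P = S} h , s , is≤1 b , is≤1 c , tt))
      b∉ : b ∉ S → ⊥
      b∉ h = <-irrefl refl (prove (S ∷ is a ∷ is b ∷ is c ∷ []) []
        (always (∁ (A ⋏ ∁ B ⋏ ∁ C ⋏ ∁ D)) ∷ always (∁ C ⋎ ∁ A) ∷ (♯ 3 ≼ ∣ A ∣) ∷ (∣ B ∣ ≼ ♯ 1) ∷ (∣ D ∣ ≼ ♯ 1) ∷ [])
        (♯ 1) (♯ 0) (0 ∷ 1 ∷ 1 ∷ 1 ∷ []) refl (none′ , ∉-is {P = S} h , s , is≤1 a , is≤1 c , tt))
      c∉ : c ∉ S → ⊥
      c∉ h = <-irrefl refl (prove (S ∷ is a ∷ is b ∷ is c ∷ []) []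
        (always (∁ (A ⋏ ∁ B ⋏ ∁ C ⋏ ∁ D)) ∷ always (∁ D ⋎ ∁ A) ∷ (♯ 3 ≼ ∣ A ∣) ∷ (∣ B ∣ ≼ ♯ 1) ∷ (∣ C ∣ ≼ ♯ 1) ∷ [])
        (♯ 1) (♯ 0) (0 ∷ 1 ∷ 1 ∷ 1 ∷ []) refl (none′ , ∉-is {P = S} h , s , is≤1 a , is≤1 b , tt))

    -- If S ⊆ {a, b, c} then S = {a, b, c}, and a fourth element e of the union
    -- replaces the representative of its set, which goes to S.
    exchange : a ∈ S × b ∈ S × c ∈ S →
               ∃[ e ] e ∈ (λ x → (P x ∨ Q x ∨ R x ∨ S x) ∧ Outside a b c x) → SDR P Q R S
    exchange (as , bs , cs) (e , h) = by-set (outside e (proj₂ (∧-true {P e ∨ Q e ∨ R e ∨ S e} h)))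
                                             (∈-or-∉ P e) (∈-or-∉ Q e) (∈-or-∉ R e)
      where
      by-set : a ≢ e × b ≢ e × c ≢ e → e ∈ P ⊎ e ∉ P → e ∈ Q ⊎ e ∉ Q → e ∈ R ⊎ e ∉ R → SDR P Q R S
      by-set (ae , be , ce) (inj₁ k) _ _ =
        e , b , c , a , k , bq , cr , as , be ∘ sym , ce ∘ sym , ae ∘ sym , bc , ab ∘ sym , ac ∘ sym
      by-set (ae , be , ce) (inj₂ _) (inj₁ k) _ =
        a , e , c , b , ap , k , cr , bs , ae , ac , ab , ce ∘ sym , be ∘ sym , bc ∘ sym
      by-set (ae , be , ce) (inj₂ _) (inj₂ _) (inj₁ k) =
        a , b , e , c , ap , bq , k , cs , ab , ae , ac , be , bc , ce ∘ sym
      by-set (ae , be , ce) (inj₂ kp) (inj₂ kq) (inj₂ kr) =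
        a , b , c , e , ap , bq , cr , es (proj₁ (∧-true h)) , ab , ac , ae , bc , be , ce
        where
        es : P e ∨ Q e ∨ R e ∨ S e ≡ true → S e ≡ true
        es eq rewrite kp | kq | kr = eq

    finish : (∃[ d ] d ∈ (λ x → S x ∧ Outside a b c x)) ⊎ (∀ x → x ∉ (λ x → S x ∧ Outside a b c x)) → SDR P Q R S
    finish (inj₁ d) = fresh-S d
    finish (inj₂ none) = exchange (S⊆abc none)
      (pick (prove ((λ x → P x ∨ Q x ∨ R x ∨ S x) ∷ is a ∷ is b ∷ is c ∷ []) []
        ((♯ 4 ≼ ∣ A ∣) ∷ (∣ B ∣ ≼ ♯ 1) ∷ (∣ C ∣ ≼ ♯ 1) ∷ (∣ D ∣ ≼ ♯ 1) ∷ [])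
        (♯ 1) (∣ A ⋏ ∁ B ⋏ ∁ C ⋏ ∁ D ∣) (1 ∷ 1 ∷ 1 ∷ 1 ∷ 1 ∷ []) refl (u , is≤1 a , is≤1 b , is≤1 c , tt)))

  from-c : ∀ {a b} → a ∈ P → b ∈ Q → a ≢ b → ∃[ c ] c ∈ (λ x → R x ∧ not (is a x) ∧ not (is b x)) → SDR P Q R S
  from-c {a} {b} ap bq ab (c , h) =
    let cr , o   = ∧-true {R c} h
        ac , bc  = ∧-true {not (is a c)} o
    in finish ap bq cr ab (∉is⇒≢ ac) (∉is⇒≢ bc) (find _)

  from-b : ∀ {a} → a ∈ P → ∃[ b ] b ∈ (λ x → Q x ∧ not (is a x)) → SDR P Q R S
  from-b {a} ap (b , h) = let bq , ab = ∧-true {Q b} h in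
    from-c ap bq (∉is⇒≢ ab)
      (pick (prove (R ∷ is a ∷ is b ∷ []) [] ((♯ 3 ≼ ∣ A ∣) ∷ (∣ B ∣ ≼ ♯ 1) ∷ (∣ C ∣ ≼ ♯ 1) ∷ [])
        (♯ 1) (∣ A ⋏ ∁ B ⋏ ∁ C ∣) (1 ∷ 1 ∷ 1 ∷ 1 ∷ []) refl (r , is≤1 a , is≤1 b , tt)))

  from-a : ∃[ a ] a ∈ P → SDR P Q R S
  from-a (a , ap) = from-b ap
    (pick (prove (Q ∷ is a ∷ []) [] ((♯ 2 ≼ ∣ A ∣) ∷ (∣ B ∣ ≼ ♯ 1) ∷ [])
      (♯ 1) (∣ A ⋏ ∁ B ∣) (1 ∷ 1 ∷ 1 ∷ []) refl (q , is≤1 a , tt)))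

-- Wheels in the complement from four spokes.

Kind : Fin 9 → Fin 9 → Set
Kind u v = toℕ v ≡ suc (toℕ u) ⊎ toℕ u ≡ suc (toℕ v) ⊎ (1F ≡ u × 8F ≡ v) ⊎ (8F ≡ u × 1F ≡ v) ⊎ 0F ≡ u ⊎ 0F ≡ v

-- Decided by evaluation on all 81 pairs of vertices.
kinds : ∀ u v → adj W₈ u v ≡ true → Kind u v
kinds = from-yes (all? λ u → all? λ v → (adj W₈ u v ≟ᵇ true) →-dec
  ((toℕ v ≟ suc (toℕ u)) ⊎-dec (toℕ u ≟ suc (toℕ v)) ⊎-dec
   ((1F ≟ᶠ u) ×-dec (8F ≟ᶠ v)) ⊎-dec ((8F ≟ᶠ u) ×-dec (1F ≟ᶠ v)) ⊎-dec (0F ≟ᶠ u) ⊎-dec (0F ≟ᶠ v)))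

module Wheels {N} (F : Graph N) where
  -- `g` is by definition the adjacency of the complement, written out so that certificates can
  -- split it into `is` and `f`.
  f g : Fin N → Fin N → Bool
  f u x = adj F u x
  g u x = not (is u x) ∧ not (f u x)

  f-sym : ∀ u x → f u x ≡ f x u
  f-sym = Graph.sym F

  g-sym : ∀ u x → g u x ≡ g x u
  g-sym = Graph.sym (complement F)

  f-irr : ∀ u → ∀ x → not (is u x) ∨ not (f u x) ≡ true
  f-irr u = ∉-is {P = f u} (irrefl F u)

  g-irr : ∀ u → u ∉ g u
  g-irr = irrefl (complement F)

  g⇒≢ : ∀ {u x} → x ∈ g u → u ≢ x
  g⇒≢ {u} h refl = true≢false h (g-irr u)

  f⇒≢ : ∀ {u x} → x ∈ f u → u ≢ x
  f⇒≢ {u} h refl = true≢false h (irrefl F u)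

  wheel : ∀ h (c : Vec (Fin N) 8) → Unique c → (∀ i → lookup c i ∈ g h) →
          (∀ i j → toℕ j ≡ suc (toℕ i) → lookup c j ∈ g (lookup c i)) →
          lookup c 7F ∈ g (lookup c 0F) → W₈ ⊆ complement F
  wheel h c uniq spoke rim close = φ , inj , hom
    where
    φ : Fin 9 → Fin N
    φ zero    = h
    φ (suc i) = lookup c i
    inj : Injective _≡_ _≡_ φ
    inj {zero}  {zero}  eq = refl
    inj {zero}  {suc j} eq = ⊥-elim (g⇒≢ (spoke j) eq)
    inj {suc i} {zero}  eq = ⊥-elim (g⇒≢ (spoke i) (sym eq))
    inj {suc i} {suc j} eq = cong suc (lookup-injective uniq i j eq)
    flip : ∀ {u x} → x ∈ g u → u ∈ g x
    flip {u} {x} = trans (g-sym x u)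
    hom′ : ∀ u v → adj W₈ u v ≡ true → Kind u v → φ v ∈ g (φ u)
    hom′ zero    zero    ()
    hom′ zero    (suc j) _ _ = spoke j
    hom′ (suc i) zero    _ _ = flip (spoke i)
    hom′ (suc i) (suc j) _ (inj₁ eq)                             = rim i j (suc-injective eq)
    hom′ (suc i) (suc j) _ (inj₂ (inj₁ eq))                      = flip (rim j i (suc-injective eq))
    hom′ (suc i) (suc j) _ (inj₂ (inj₂ (inj₁ (refl , refl))))        = close
    hom′ (suc i) (suc j) _ (inj₂ (inj₂ (inj₂ (inj₁ (refl , refl))))) = flip close
    hom′ (suc i) (suc j) _ (inj₂ (inj₂ (inj₂ (inj₂ (inj₁ ())))))
    hom′ (suc i) (suc j) _ (inj₂ (inj₂ (inj₂ (inj₂ (inj₂ ())))))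
    hom : ∀ u v → adj W₈ u v ≡ true → φ v ∈ g (φ u)
    hom u v e = hom′ u v e (kinds u v e)

  -- The candidates for the rim vertex between the spokes `p` and `q`.
  S : (R : Fin N → Bool) (p q : Fin N) → Fin N → Bool
  S R p q x = R x ∧ g p x ∧ g q x

  -- Since `R` avoids the spokes, rim vertices drawn from `R` need only be distinct from one
  -- another.
  record Spokes (h : Fin N) (R : Fin N → Bool) (p : Fin 4 → Fin N) : Set where
    constructor spokes
    field
      p-inj : Injective _≡_ _≡_ p
      p∈gh  : ∀ i → p i ∈ g h
      p∉R   : ∀ i → p i ∉ R
      R⊆gh  : ∀ x → x ∈ R → x ∈ g h

  -- Spokes and representatives alternate around the rim, so every rim edge joins a representative
  -- to one of the two spokes that define its set.
  rim-through : ∀ {h R p} → Spokes h R p → ∀ i j k l → distinct₄ i j k l ≡ true →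
                SDR (S R (p i) (p j)) (S R (p j) (p k)) (S R (p k) (p l)) (S R (p l) (p i)) →
                W₈ ⊆ complement F
  rim-through {h} {R} {p} (spokes p-inj p∈gh p∉R R⊆gh) i j k l dist (a , b , c , d , as , bs , cs , ds , ab , ac , ad , bc , bd , cd) =
    wheel h cycle uniq spoke rim (S₃ (p l) (p i) ds)
    where
    flip : ∀ {u x} → x ∈ g u → u ∈ g x
    flip {u} {x} = trans (g-sym x u)
    S₁ : ∀ p q {x} → x ∈ S R p q → x ∈ R
    S₁ p q {x} m = proj₁ (∧-true {R x} m)
    S₂ : ∀ p q {x} → x ∈ S R p q → x ∈ g p
    S₂ p q {x} m = proj₁ (∧-true {g p x} (proj₂ (∧-true {R x} m)))
    S₃ : ∀ p q {x} → x ∈ S R p q → x ∈ g q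
    S₃ p q {x} m = proj₂ (∧-true {g p x} (proj₂ (∧-true {R x} m)))
    cycle : Vec (Fin N) 8
    cycle = p i ∷ a ∷ p j ∷ b ∷ p k ∷ c ∷ p l ∷ d ∷ []
    pp : Distinct₄ (p i) (p j) (p k) (p l)
    pp = let ij , ik , il , jk , jl , kl = distinct₄-sound i j k l dist in
      ij ∘ p-inj , ik ∘ p-inj , il ∘ p-inj , jk ∘ p-inj , jl ∘ p-inj , kl ∘ p-inj
    pR : ∀ i {x} → x ∈ R → p i ≢ x
    pR i xr eq = true≢false xr (subst (_∉ R) eq (p∉R i))
    Rp : ∀ i {x} → x ∈ R → x ≢ p i
    Rp i xr = pR i xr ∘ sym
    aR = S₁ (p i) (p j) as
    bR = S₁ (p j) (p k) bs
    cR = S₁ (p k) (p l) cs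
    dR = S₁ (p l) (p i) ds
    uniq : Unique cycle
    uniq = let ij , ik , il , jk , jl , kl = pp in
      (pR i aR ∷ ij ∷ pR i bR ∷ ik ∷ pR i cR ∷ il ∷ pR i dR ∷ []) ∷
      (Rp j aR ∷ ab ∷ Rp k aR ∷ ac ∷ Rp l aR ∷ ad ∷ []) ∷
      (pR j bR ∷ jk ∷ pR j cR ∷ jl ∷ pR j dR ∷ []) ∷
      (Rp k bR ∷ bc ∷ Rp l bR ∷ bd ∷ []) ∷
      (pR k cR ∷ kl ∷ pR k dR ∷ []) ∷
      (Rp l cR ∷ cd ∷ []) ∷ (pR l dR ∷ []) ∷ [] ∷ []
    spoke : ∀ m → lookup cycle m ∈ g h
    spoke 0F = p∈gh i
    spoke 1F = R⊆gh a aR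
    spoke 2F = p∈gh j
    spoke 3F = R⊆gh b bR
    spoke 4F = p∈gh k
    spoke 5F = R⊆gh c cR
    spoke 6F = p∈gh l
    spoke 7F = R⊆gh d dR
    rim : ∀ m n → toℕ n ≡ suc (toℕ m) → lookup cycle n ∈ g (lookup cycle m)
    rim 0F 1F _ = S₂ (p i) (p j) as
    rim 1F 2F _ = flip (S₃ (p i) (p j) as)
    rim 2F 3F _ = S₂ (p j) (p k) bs
    rim 3F 4F _ = flip (S₃ (p j) (p k) bs)
    rim 4F 5F _ = S₂ (p k) (p l) cs
    rim 5F 6F _ = flip (S₃ (p k) (p l) cs)
    rim 6F 7F _ = S₂ (p l) (p i) ds
    rim 7F n  e = ⊥-elim (<-irrefl e (toℕ<n n))

  module _ {h R p} (sp : Spokes h R p) (i j k l : Fin 4) (dist : distinct₄ i j k l ≡ true) where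
    private
      P₀ = S R (p i) (p j)
      P₁ = S R (p j) (p k)
      P₂ = S R (p k) (p l)
      P₃ = S R (p l) (p i)

    -- The two large sets share the spoke `p j`. The sets are reordered by size for `sdr`, and
    -- `turn` restores the cyclic order.
    rim-adjacent : 3 ≤ count P₀ → 3 ≤ count P₁ → 1 ≤ count P₂ → 2 ≤ count P₃ →
                   4 ≤ count (λ x → P₀ x ∨ P₁ x ∨ P₂ x ∨ P₃ x) → W₈ ⊆ complement F
    rim-adjacent s₀ s₁ s₂ s₃ u = rim-through sp i j k l dist (turn (sdr {P = P₂} {P₃} {P₀} {P₁} s₂ s₃ s₀ s₁
      (prove (P₀ ∷ P₁ ∷ P₂ ∷ P₃ ∷ []) [] ((♯ 4 ≼ ∣ A ⋎ B ⋎ C ⋎ D ∣) ∷ []) (♯ 4) (∣ C ⋎ D ⋎ A ⋎ B ∣) (1 ∷ 1 ∷ []) refl (u , tt))))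
      where
      turn : SDR P₂ P₃ P₀ P₁ → SDR P₀ P₁ P₂ P₃
      turn (a , b , c , d , as , bs , cs , ds , ab , ac , ad , bc , bd , cd) =
        c , d , a , b , cs , ds , as , bs , cd , ac ∘ sym , bc ∘ sym , ad ∘ sym , bd ∘ sym , ab

    rim-opposite : 3 ≤ count P₀ → 1 ≤ count P₁ → 3 ≤ count P₂ → 2 ≤ count P₃ →
                   4 ≤ count (λ x → P₀ x ∨ P₁ x ∨ P₂ x ∨ P₃ x) → W₈ ⊆ complement F
    rim-opposite s₀ s₁ s₂ s₃ u = rim-through sp i j k l dist (turn (sdr {P = P₁} {P₃} {P₀} {P₂} s₁ s₃ s₀ s₂
      (prove (P₀ ∷ P₁ ∷ P₂ ∷ P₃ ∷ []) [] ((♯ 4 ≼ ∣ A ⋎ B ⋎ C ⋎ D ∣) ∷ []) (♯ 4) (∣ B ⋎ D ⋎ A ⋎ C ∣) (1 ∷ 1 ∷ []) refl (u , tt))))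
      where
      turn : SDR P₁ P₃ P₀ P₂ → SDR P₀ P₁ P₂ P₃
      turn (a , b , c , d , as , bs , cs , ds , ab , ac , ad , bc , bd , cd) =
        c , a , d , b , cs , as , ds , bs , ac ∘ sym , cd , bc ∘ sym , ad , ab , bd ∘ sym

    rim-wide : 4 ≤ count P₀ → 4 ≤ count P₁ → 4 ≤ count P₂ → 4 ≤ count P₃ → W₈ ⊆ complement F
    rim-wide s₀ s₁ s₂ s₃ = rim-opposite (weaken s₀) (≤-trans (s≤s z≤n) s₁) (weaken s₂) (≤-trans (s≤s (s≤s z≤n)) s₃)
      (prove (P₀ ∷ P₁ ∷ P₂ ∷ P₃ ∷ []) [] ((♯ 4 ≼ ∣ A ∣) ∷ []) (♯ 4) (∣ A ⋎ B ⋎ C ⋎ D ∣) (1 ∷ 1 ∷ []) refl (s₀ , tt))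
      where
      weaken : ∀ {m} → 4 ≤ m → 3 ≤ m
      weaken = ≤-trans (n≤1+n 3)

completion : ∀ (i j : Fin 4) → ¬ i ≡ j → ∃[ k ] ∃[ l ] distinct₄ i j k l ≡ true
completion = from-yes (all? {n = 4} λ i → all? λ j → ¬? (i ≟ᶠ j) →-dec
  (any? λ k → any? λ l → distinct₄ i j k l ≟ᵇ true))

swaps : ∀ (i j k l : Fin 4) → distinct₄ i j k l ≡ true → distinct₄ j i k l ≡ true × distinct₄ j i l k ≡ true
swaps = from-yes (all? {n = 4} λ i → all? λ j → all? λ k → all? λ l → (distinct₄ i j k l ≟ᵇ true) →-dec
  ((distinct₄ j i k l ≟ᵇ true) ×-dec (distinct₄ j i l k ≟ᵇ true)))

-- Finding a cyclic order of the spokes from bounds on the vertices they miss.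

module EvenSpokes {N} (F : Graph N) where
  open Wheels F

  module _ {h R p} (sp : Spokes h R p) (large : 8 ≤ count R)
           (miss : ∀ i → count (λ x → R x ∧ not (g (p i) x)) ≤ 3) where
    private
      cod : Fin 4 → Fin 4 → ℕ
      cod i j = count (S R (p i) (p j))

    cod-sym : ∀ i j {m} → m ≤ cod i j → m ≤ cod j i
    cod-sym i j {m} le = prove (R ∷ g (p i) ∷ g (p j) ∷ []) (m ∷ []) ((atom 0 ≼ ∣ A ⋏ B ⋏ C ∣) ∷ [])
      (atom 0) (∣ A ⋏ C ⋏ B ∣) (1 ∷ 1 ∷ []) refl (le , tt)

    2≤cod : ∀ i j → 2 ≤ cod i j
    2≤cod i j = prove (R ∷ g (p i) ∷ g (p j) ∷ []) []
      ((♯ 8 ≼ ∣ A ∣) ∷ (∣ A ⋏ ∁ B ∣ ≼ ♯ 3) ∷ (∣ A ⋏ ∁ C ∣ ≼ ♯ 3) ∷ [])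
      (♯ 2) (∣ A ⋏ B ⋏ C ∣) (1 ∷ 1 ∷ 1 ∷ 1 ∷ []) refl (large , miss i , miss j , tt)

    1≤cod : ∀ i j → 1 ≤ cod i j
    1≤cod i j = ≤-trans (s≤s z≤n) (2≤cod i j)

    -- An element missed by m of the three spokes i, j, k lies in at least 2 - m of
    -- the three codegree sets, so the codegrees add up to at least 16 - 9.
    rich-pair : ∀ i j k → 3 ≤ cod i j ⊎ 3 ≤ cod i k ⊎ 3 ≤ cod j k
    rich-pair i j k with 3 ≤? cod i j | 3 ≤? cod i k | 3 ≤? cod j k
    ... | yes a | _     | _     = inj₁ a
    ... | no _  | yes b | _     = inj₂ (inj₁ b)
    ... | no _  | no _  | yes c = inj₂ (inj₂ c)
    ... | no a  | no b  | no c  = ⊥-elim (<-irrefl refl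
      (prove (R ∷ g (p i) ∷ g (p j) ∷ g (p k) ∷ []) []
        ((♯ 8 ≼ ∣ A ∣) ∷ (∣ A ⋏ ∁ B ∣ ≼ ♯ 3) ∷ (∣ A ⋏ ∁ C ∣ ≼ ♯ 3) ∷ (∣ A ⋏ ∁ D ∣ ≼ ♯ 3) ∷
         (♯ 1 ⊕ ∣ A ⋏ B ⋏ C ∣ ≼ ♯ 3) ∷ (♯ 1 ⊕ ∣ A ⋏ B ⋏ D ∣ ≼ ♯ 3) ∷ (♯ 1 ⊕ ∣ A ⋏ C ⋏ D ∣ ≼ ♯ 3) ∷ [])
        (♯ 1) (♯ 0) (0 ∷ 2 ∷ 1 ∷ 1 ∷ 1 ∷ 1 ∷ 1 ∷ 1 ∷ []) refl (large , miss i , miss j , miss k , ≰⇒> a , ≰⇒> b , ≰⇒> c , tt)))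

    -- For the second alternative, each element of `R` contributes at least 3 to the number of
    -- spokes missing it, plus the number of diagonal pairs i k and j l seeing it, plus its
    -- membership in the union. The misses total at most 12 and the diagonals at most 6, while 3 · 8
    -- = 24.
    union-4 : ∀ i j k l → 4 ≤ cod i j ⊎ cod i k ≤ 3 × cod j l ≤ 3 →
              4 ≤ count (λ x → S R (p i) (p j) x ∨ S R (p j) (p k) x ∨ S R (p k) (p l) x ∨ S R (p l) (p i) x)
    union-4 i j k l (inj₁ big) = prove (R ∷ g (p i) ∷ g (p j) ∷ g (p k) ∷ g (p l) ∷ []) []
      ((♯ 4 ≼ ∣ A ⋏ B ⋏ C ∣) ∷ []) (♯ 4)
      (∣ (A ⋏ B ⋏ C) ⋎ (A ⋏ C ⋏ D) ⋎ (A ⋏ D ⋏ E) ⋎ (A ⋏ E ⋏ B) ∣) (1 ∷ 1 ∷ []) refl (big , tt)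
    union-4 i j k l (inj₂ (ik , jl)) = prove (R ∷ g (p i) ∷ g (p j) ∷ g (p k) ∷ g (p l) ∷ []) []
      ((♯ 8 ≼ ∣ A ∣) ∷ (∣ A ⋏ ∁ B ∣ ≼ ♯ 3) ∷ (∣ A ⋏ ∁ C ∣ ≼ ♯ 3) ∷ (∣ A ⋏ ∁ D ∣ ≼ ♯ 3) ∷ (∣ A ⋏ ∁ E ∣ ≼ ♯ 3) ∷
       (∣ A ⋏ B ⋏ D ∣ ≼ ♯ 3) ∷ (∣ A ⋏ C ⋏ E ∣ ≼ ♯ 3) ∷ []) (♯ 4)
      (∣ (A ⋏ B ⋏ C) ⋎ (A ⋏ C ⋏ D) ⋎ (A ⋏ D ⋏ E) ⋎ (A ⋏ E ⋏ B) ∣) (1 ∷ 3 ∷ 1 ∷ 1 ∷ 1 ∷ 1 ∷ 1 ∷ 1 ∷ []) refl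
      (large , miss i , miss j , miss k , miss l , ik , jl , tt)

    -- A second pair of codegree at least 3 among `i`, `k`, `l` either meets the first in `i` or is
    -- disjoint from it. The cyclic order makes the two pairs adjacent or opposite sides
    -- accordingly.
    from-rich : ∀ i j k l → distinct₄ i j k l ≡ true → 3 ≤ cod i j →
                4 ≤ cod i j ⊎ (∀ i j → i ≢ j → cod i j ≤ 3) → W₈ ⊆ complement F
    from-rich i j k l dist ij bound = by-pair (rich-pair i k l)
      where
      ji = cod-sym i j ij
      dist₁ = proj₁ (swaps i j k l dist)
      dist₂ = proj₂ (swaps i j k l dist)
      ≢s = distinct₄-sound i j k l dist
      i≢k = proj₁ (proj₂ ≢s)
      i≢l = proj₁ (proj₂ (proj₂ ≢s))
      j≢k = proj₁ (proj₂ (proj₂ (proj₂ ≢s)))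
      j≢l = proj₁ (proj₂ (proj₂ (proj₂ (proj₂ ≢s))))
      by-pair : 3 ≤ cod i k ⊎ 3 ≤ cod i l ⊎ 3 ≤ cod k l → W₈ ⊆ complement F
      by-pair (inj₁ ik) = rim-adjacent sp j i k l dist₁ ji ik (1≤cod k l) (2≤cod l j)
        (union-4 j i k l (map-⊎ (cod-sym i j) (λ small → (small j k j≢k , small i l i≢l)) bound))
      by-pair (inj₂ (inj₁ il)) = rim-adjacent sp j i l k dist₂ ji il (1≤cod l k) (2≤cod k j)
        (union-4 j i l k (map-⊎ (cod-sym i j) (λ small → (small j l j≢l , small i k i≢k)) bound))
      by-pair (inj₂ (inj₂ kl)) = rim-opposite sp i j k l dist ij (1≤cod j k) kl (2≤cod l i)
        (union-4 i j k l (map₂ (λ small → (small i k i≢k , small j l j≢l)) bound))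

    -- For |R| = 8 the rim is given by a case of Jackson's theorem on cycles in bipartite graphs:
    -- four vertices of degree at least k = 5 against 2k - 2 = 8 vertices.
    jackson : W₈ ⊆ complement F
    -- A pair of codegree 4 settles the union by itself. If there is none, all codegrees are at most
    -- 3, in particular those of the diagonals.
    jackson = decide (any? λ i → any? λ j → ¬? (i ≟ᶠ j) ×-dec (4 ≤? cod i j))
      where
      extend : ∀ i j → i ≢ j → 3 ≤ cod i j → 4 ≤ cod i j ⊎ (∀ i j → i ≢ j → cod i j ≤ 3) → W₈ ⊆ complement F
      extend i j ne ij bound = let k , l , dist = completion i j ne in from-rich i j k l dist ij bound
      decide : Dec (∃[ i ] ∃[ j ] (i ≢ j × 4 ≤ cod i j)) → W₈ ⊆ complement F
      decide (yes (i , j , ne , big)) = extend i j ne (≤-trans (n≤1+n 3) big) (inj₁ big)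
      decide (no none) = by-pair (rich-pair 0F 1F 2F)
        where
        small : ∀ i j → i ≢ j → cod i j ≤ 3
        small i j ne = ≮⇒≥ λ big → none (i , j , ne , big)
        by-pair : 3 ≤ cod 0F 1F ⊎ 3 ≤ cod 0F 2F ⊎ 3 ≤ cod 1F 2F → W₈ ⊆ complement F
        by-pair (inj₁ r)        = extend 0F 1F (λ ()) r (inj₂ small)
        by-pair (inj₂ (inj₁ r)) = extend 0F 2F (λ ()) r (inj₂ small)
        by-pair (inj₂ (inj₂ r)) = extend 1F 2F (λ ()) r (inj₂ small)

module UnevenSpokes {N} (F : Graph N) where
  open Wheels F

  -- The spoke 0F is joined to all of Y, so only the other three spokes matter.
  module _ {h Y p} (sp : Spokes h Y p) (full : ∀ x → x ∈ Y → x ∈ g (p 0F)) where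
    private
      cod : Fin 4 → Fin 4 → ℕ
      cod i j = count (S Y (p i) (p j))

      Y⊆g₀ : ∀ x → not (Y x) ∨ g (p 0F) x ≡ true
      Y⊆g₀ = ⊆⇒always {P = Y} {g (p 0F)} full

      missed-by : Fin 4 → ℕ
      missed-by i = count (λ x → Y x ∧ not (g (p i) x))

    -- The spoke `0F` is placed between `l` and `j`. As it misses nothing, the two sets next to it
    -- omit from `Y` only what `l` and `j` both miss.
    thread : ∀ l j k → distinct₄ l 0F j k ≡ true →
             3 ≤ count (λ x → Y x ∧ g (p l) x) → 3 ≤ count (λ x → Y x ∧ g (p j) x) →
             1 ≤ cod j k → 2 ≤ cod k l →
             4 + count (λ x → Y x ∧ not (g (p l) x) ∧ not (g (p j) x)) ≤ count Y → W₈ ⊆ complement F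
    thread l j k dist sl sj jk kl u = rim-adjacent sp l 0F j k dist
      (prove (Y ∷ g (p 0F) ∷ g (p l) ∷ []) [] (always (∁ A ⋎ B) ∷ (♯ 3 ≼ ∣ A ⋏ C ∣) ∷ []) (♯ 3) (∣ A ⋏ C ⋏ B ∣) (1 ∷ 1 ∷ []) refl (Y⊆g₀ , sl , tt))
      (prove (Y ∷ g (p 0F) ∷ g (p j) ∷ []) [] (always (∁ A ⋎ B) ∷ (♯ 3 ≼ ∣ A ⋏ C ∣) ∷ []) (♯ 3) (∣ A ⋏ B ⋏ C ∣) (1 ∷ 1 ∷ []) refl (Y⊆g₀ , sj , tt))
      jk kl
      (prove (Y ∷ g (p 0F) ∷ g (p l) ∷ g (p j) ∷ g (p k) ∷ []) []
        (always (∁ A ⋎ B) ∷ (♯ 4 ⊕ ∣ A ⋏ ∁ C ⋏ ∁ D ∣ ≼ ∣ A ∣) ∷ []) (♯ 4)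
        (∣ (A ⋏ C ⋏ B) ⋎ (A ⋏ B ⋏ D) ⋎ (A ⋏ D ⋏ E) ⋎ (A ⋏ E ⋏ C) ∣) (1 ∷ 1 ∷ []) refl (Y⊆g₀ , u , tt))

    -- The first bound on `Y` serves the large sets and the union in `thread`, the second makes
    -- every codegree positive. The codegrees of the three spokes sum to at least 2|Y| - 3e ≥ 4, so
    -- one of them is at least 2.
    spread : ∀ e → (∀ i → missed-by (suc i) ≤ e) → 4 + e ≤ count Y → 1 + 2 * e ≤ count Y →
             4 + 3 * e ≤ 2 * count Y → W₈ ⊆ complement F
    spread e miss c₁ c₂ c₃ = by-pair (2 ≤? cod 2F 1F) (2 ≤? cod 3F 1F) (2 ≤? cod 3F 2F)
      where
      three : ∀ i → 3 ≤ count (λ x → Y x ∧ g (p (suc i)) x)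
      three i = prove (Y ∷ g (p (suc i)) ∷ []) (e ∷ [])
        ((∣ A ⋏ ∁ B ∣ ≼ atom 0) ∷ (♯ 4 ⊕ atom 0 ≼ ∣ A ∣) ∷ []) (♯ 3) (∣ A ⋏ B ∣) (1 ∷ 1 ∷ 1 ∷ []) refl (miss i , c₁ , tt)
      one : ∀ i j → 1 ≤ cod (suc i) (suc j)
      one i j = prove (Y ∷ g (p (suc i)) ∷ g (p (suc j)) ∷ []) (e ∷ [])
        ((∣ A ⋏ ∁ B ∣ ≼ atom 0) ∷ (∣ A ⋏ ∁ C ∣ ≼ atom 0) ∷ (♯ 1 ⊕ 2 ⊗ atom 0 ≼ ∣ A ∣) ∷ [])
        (♯ 1) (∣ A ⋏ B ⋏ C ∣) (1 ∷ 1 ∷ 1 ∷ 1 ∷ []) refl (miss i , miss j , c₂ , tt)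
      union : ∀ i j → 4 + count (λ x → Y x ∧ not (g (p (suc i)) x) ∧ not (g (p (suc j)) x)) ≤ count Y
      union i j = prove (Y ∷ g (p (suc i)) ∷ g (p (suc j)) ∷ []) (e ∷ [])
        ((∣ A ⋏ ∁ B ∣ ≼ atom 0) ∷ (♯ 4 ⊕ atom 0 ≼ ∣ A ∣) ∷ [])
        (♯ 4 ⊕ ∣ A ⋏ ∁ B ⋏ ∁ C ∣) (∣ A ∣) (1 ∷ 1 ∷ 1 ∷ []) refl (miss i , c₁ , tt)
      by-pair : Dec (2 ≤ cod 2F 1F) → Dec (2 ≤ cod 3F 1F) → Dec (2 ≤ cod 3F 2F) → W₈ ⊆ complement F
      by-pair (yes r) _ _ = thread 1F 3F 2F refl (three 0F) (three 2F) (one 2F 1F) r (union 0F 2F)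
      by-pair (no _) (yes r) _ = thread 1F 2F 3F refl (three 0F) (three 1F) (one 1F 2F) r (union 0F 1F)
      by-pair (no _) (no _) (yes r) = thread 2F 1F 3F refl (three 1F) (three 0F) (one 0F 2F) r (union 1F 0F)
      by-pair (no a) (no b) (no c) = ⊥-elim (<-irrefl refl
        (prove (Y ∷ g (p 1F) ∷ g (p 2F) ∷ g (p 3F) ∷ []) (e ∷ [])
          ((∣ A ⋏ ∁ B ∣ ≼ atom 0) ∷ (∣ A ⋏ ∁ C ∣ ≼ atom 0) ∷ (∣ A ⋏ ∁ D ∣ ≼ atom 0) ∷
           (♯ 4 ⊕ 3 ⊗ atom 0 ≼ 2 ⊗ ∣ A ∣) ∷
           (♯ 1 ⊕ ∣ A ⋏ C ⋏ B ∣ ≼ ♯ 2) ∷ (♯ 1 ⊕ ∣ A ⋏ D ⋏ B ∣ ≼ ♯ 2) ∷ (♯ 1 ⊕ ∣ A ⋏ D ⋏ C ∣ ≼ ♯ 2) ∷ [])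
          (♯ 1) (♯ 0) (0 ∷ 1 ∷ 1 ∷ 1 ∷ 1 ∷ 1 ∷ 1 ∷ 1 ∷ []) refl
          (miss 0F , miss 1F , miss 2F , c₃ , ≰⇒> a , ≰⇒> b , ≰⇒> c , tt)))

    -- Here |Y| may be one short of the bound 4 + e of `spread` with e = 1. Two spokes without a
    -- common missed vertex make up for it.
    spread₁ : (∀ i → missed-by (suc i) ≤ 1) → 4 ≤ count Y →
              count (λ x → Y x ∧ not (g (p 1F) x) ∧ not (g (p 2F) x)) ≤ 0 → W₈ ⊆ complement F
    spread₁ miss four disjoint = thread 1F 2F 3F refl (three 0F) (three 1F) (≤-trans (s≤s z≤n) (two 1F 2F)) (two 2F 0F)
      (prove (Y ∷ g (p 1F) ∷ g (p 2F) ∷ []) [] ((∣ A ⋏ ∁ B ⋏ ∁ C ∣ ≼ ♯ 0) ∷ (♯ 4 ≼ ∣ A ∣) ∷ [])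
        (♯ 4 ⊕ ∣ A ⋏ ∁ B ⋏ ∁ C ∣) (∣ A ∣) (1 ∷ 1 ∷ 1 ∷ []) refl (disjoint , four , tt))
      where
      three : ∀ i → 3 ≤ count (λ x → Y x ∧ g (p (suc i)) x)
      three i = prove (Y ∷ g (p (suc i)) ∷ []) []
        ((∣ A ⋏ ∁ B ∣ ≼ ♯ 1) ∷ (♯ 4 ≼ ∣ A ∣) ∷ []) (♯ 3) (∣ A ⋏ B ∣) (1 ∷ 1 ∷ 1 ∷ []) refl (miss i , four , tt)
      two : ∀ i j → 2 ≤ cod (suc i) (suc j)
      two i j = prove (Y ∷ g (p (suc i)) ∷ g (p (suc j)) ∷ []) []
        ((∣ A ⋏ ∁ B ∣ ≼ ♯ 1) ∷ (∣ A ⋏ ∁ C ∣ ≼ ♯ 1) ∷ (♯ 4 ≼ ∣ A ∣) ∷ [])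
        (♯ 2) (∣ A ⋏ B ⋏ C ∣) (1 ∷ 1 ∷ 1 ∷ 1 ∷ []) refl (miss i , miss j , four , tt)

    -- Likewise one short of 4 + e for e = 2; the union condition is assumed for one pair of spokes
    -- only.
    spread₂ : (∀ i → missed-by (suc i) ≤ 2) → 5 ≤ count Y →
              4 + count (λ x → Y x ∧ not (g (p 1F) x) ∧ not (g (p 2F) x)) ≤ count Y → W₈ ⊆ complement F
    spread₂ miss five u = by-pair (2 ≤? cod 3F 1F) (2 ≤? cod 3F 2F)
      where
      three : ∀ i → 3 ≤ count (λ x → Y x ∧ g (p (suc i)) x)
      three i = prove (Y ∷ g (p (suc i)) ∷ []) []
        ((∣ A ⋏ ∁ B ∣ ≼ ♯ 2) ∷ (♯ 5 ≼ ∣ A ∣) ∷ []) (♯ 3) (∣ A ⋏ B ∣) (1 ∷ 1 ∷ 1 ∷ []) refl (miss i , five , tt)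
      one : ∀ i j → 1 ≤ cod (suc i) (suc j)
      one i j = prove (Y ∷ g (p (suc i)) ∷ g (p (suc j)) ∷ []) []
        ((∣ A ⋏ ∁ B ∣ ≼ ♯ 2) ∷ (∣ A ⋏ ∁ C ∣ ≼ ♯ 2) ∷ (♯ 5 ≼ ∣ A ∣) ∷ [])
        (♯ 1) (∣ A ⋏ B ⋏ C ∣) (1 ∷ 1 ∷ 1 ∷ 1 ∷ []) refl (miss i , miss j , five , tt)
      by-pair : Dec (2 ≤ cod 3F 1F) → Dec (2 ≤ cod 3F 2F) → W₈ ⊆ complement F
      by-pair (yes r) _ = thread 1F 2F 3F refl (three 0F) (three 1F) (one 1F 2F) r u
      by-pair (no _) (yes r) = thread 2F 1F 3F refl (three 1F) (three 0F) (one 0F 2F) r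
        (prove (Y ∷ g (p 1F) ∷ g (p 2F) ∷ []) [] ((♯ 4 ⊕ ∣ A ⋏ ∁ B ⋏ ∁ C ∣ ≼ ∣ A ∣) ∷ [])
          (♯ 4 ⊕ ∣ A ⋏ ∁ C ⋏ ∁ B ∣) (∣ A ∣) (1 ∷ 1 ∷ []) refl (u , tt))
      -- Now |Y| = 5, and the spoke 3F misses exactly two vertices, neither of them missed by 1F or
      -- 2F. So 1F and 2F have those two in common, and 1F and 3F satisfy the union condition.
      by-pair (no a) (no b) = thread 1F 3F 2F refl (three 0F) (three 2F) (one 2F 1F)
        (prove (Y ∷ g (p 1F) ∷ g (p 2F) ∷ g (p 3F) ∷ []) []
          ((∣ A ⋏ ∁ B ∣ ≼ ♯ 2) ∷ (∣ A ⋏ ∁ C ∣ ≼ ♯ 2) ∷ (∣ A ⋏ ∁ D ∣ ≼ ♯ 2) ∷ (♯ 5 ≼ ∣ A ∣) ∷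
           (♯ 1 ⊕ ∣ A ⋏ D ⋏ B ∣ ≼ ♯ 2) ∷ (♯ 1 ⊕ ∣ A ⋏ D ⋏ C ∣ ≼ ♯ 2) ∷ [])
          (♯ 2) (∣ A ⋏ C ⋏ B ∣) (1 ∷ 1 ∷ 1 ∷ 1 ∷ 2 ∷ 1 ∷ 1 ∷ []) refl
          (miss 0F , miss 1F , miss 2F , five , ≰⇒> a , ≰⇒> b , tt))
        (prove (Y ∷ g (p 1F) ∷ g (p 3F) ∷ []) []
          ((∣ A ⋏ ∁ B ∣ ≼ ♯ 2) ∷ (∣ A ⋏ ∁ C ∣ ≼ ♯ 2) ∷ (♯ 5 ≼ ∣ A ∣) ∷ (♯ 1 ⊕ ∣ A ⋏ C ⋏ B ∣ ≼ ♯ 2) ∷ [])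
          (♯ 4 ⊕ ∣ A ⋏ ∁ B ⋏ ∁ C ∣) (∣ A ∣) (1 ∷ 1 ∷ 1 ∷ 2 ∷ 1 ∷ []) refl (miss 0F , miss 2F , five , ≰⇒> a , tt))

-- Embedding the double star.

trim : ∀ {N} k (P : Fin N → Bool) → k ≤ count P →
       Σ[ Q ∈ (Fin N → Bool) ] (∀ x → x ∈ Q → x ∈ P) × count Q ≡ k
trim {N} zero P le = (λ _ → false) , (λ _ ()) , sumF-0 N
trim {suc N} (suc k) P le with P zero in eq
... | true = let Q , sub , c = trim k (P ∘ suc) (≤-pred le) in
  (λ { zero → true ; (suc x) → Q x }) , (λ { zero _ → eq ; (suc x) → sub x }) , cong suc c
... | false = let Q , sub , c = trim (suc k) (P ∘ suc) le in
  (λ { zero → false ; (suc x) → Q x }) , (λ { zero () ; (suc x) → sub x }) , c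

cons : ∀ {m} {A : Set} → A → (Fin m → A) → Fin (suc m) → A
cons x c zero    = x
cons x c (suc i) = c i

cons-injective : ∀ {m} {A : Set} {x : A} {c : Fin m → A} → (∀ i → x ≢ c i) →
                 Injective _≡_ _≡_ c → Injective _≡_ _≡_ (cons x c)
cons-injective fresh inj {zero}  {zero}  eq = refl
cons-injective fresh inj {zero}  {suc j} eq = ⊥-elim (fresh j eq)
cons-injective fresh inj {suc i} {zero}  eq = ⊥-elim (fresh i (sym eq))
cons-injective fresh inj {suc i} {suc j} eq = cong suc (inj eq)

join : ∀ k {m} {A : Set} → (Fin k → A) → (Fin m → A) → Fin (k + m) → A
join zero    c d = d
join (suc k) c d = cons (c zero) (join k (c ∘ suc) d)

join-all : ∀ k {m} {A : Set} {c : Fin k → A} {d : Fin m → A} (Q : A → Set) →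
           (∀ i → Q (c i)) → (∀ j → Q (d j)) → ∀ i → Q (join k c d i)
join-all zero    Q qc qd i       = qd i
join-all (suc k) Q qc qd zero    = qc zero
join-all (suc k) Q qc qd (suc i) = join-all k Q (qc ∘ suc) qd i

join-injective : ∀ k {m} {A : Set} {c : Fin k → A} {d : Fin m → A} → (∀ i j → c i ≢ d j) →
                 Injective _≡_ _≡_ c → Injective _≡_ _≡_ d → Injective _≡_ _≡_ (join k c d)
join-injective zero    dis ic id = id
join-injective (suc k) {c = c} dis ic id = cons-injective
  (join-all k (c zero ≢_) (λ i eq → 0≢1+n (cong toℕ (ic eq))) (dis zero))
  (join-injective k (dis ∘ suc) (sucᶠ-injective ∘ ic) id)

module Stars {N} (F : Graph N) where
  open Wheels F

  star-map : ∀ m a b (L : Fin 4 → Fin N) (K : Fin m → Fin N) →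
             b ∈ f a → (∀ i → L i ∈ (λ x → f a x ∧ not (is b x))) → (∀ j → K j ∈ (λ x → f b x ∧ not (is a x))) →
             (∀ i j → L i ≢ K j) → Injective _≡_ _≡_ L → Injective _≡_ _≡_ K → Sn5 (6 + m) ⊆ F
  star-map m a b L K ab La Kb dis iL iK = φ , inj , hom
    where
    φ : Fin (6 + m) → Fin N
    -- This order follows the numbering in `Sn5`: centre 0, its leaves 1 to 4, centre 5, its leaves
    -- from 6 on.
    φ = cons a (join 4 L (cons b K))
    L∈ : ∀ i → L i ∈ f a
    L∈ i = proj₁ (∧-true (La i))
    K∈ : ∀ j → K j ∈ f b
    K∈ j = proj₁ (∧-true (Kb j))
    L≢b : ∀ i → b ≢ L i
    L≢b i = ∉is⇒≢ (proj₂ (∧-true {f a (L i)} (La i)))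
    K≢a : ∀ j → a ≢ K j
    K≢a j = ∉is⇒≢ (proj₂ (∧-true {f b (K j)} (Kb j)))
    inj : Injective _≡_ _≡_ φ
    inj = cons-injective
      (join-all 4 (a ≢_) (λ i → f⇒≢ (L∈ i)) λ { zero → f⇒≢ ab ; (suc j) → K≢a j })
      (join-injective 4 (λ { i zero → L≢b i ∘ sym ; i (suc j) → dis i j }) iL
        (cons-injective (λ j → f⇒≢ (K∈ j)) iK))
    star : ∀ u v → doubleStarEdge (toℕ u) (toℕ v) ≡ true → φ v ∈ f (φ u)
    star 0F 1F _ = L∈ 0F
    star 0F 2F _ = L∈ 1F
    star 0F 3F _ = L∈ 2F
    star 0F 4F _ = L∈ 3F
    star 0F 5F _ = ab
    star 5F (suc (suc (suc (suc (suc (suc j)))))) _ = K∈ j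
    star 0F 0F ()
    star 0F (suc (suc (suc (suc (suc (suc j)))))) ()
    star 1F _ ()
    star 2F _ ()
    star 3F _ ()
    star 4F _ ()
    star 5F 0F ()
    star 5F 1F ()
    star 5F 2F ()
    star 5F 3F ()
    star 5F 4F ()
    star 5F 5F ()
    star (suc (suc (suc (suc (suc (suc i)))))) _ ()
    hom : ∀ u v → adj (Sn5 (6 + m)) u v ≡ true → φ v ∈ f (φ u)
    hom u v e with doubleStarEdge (toℕ u) (toℕ v) in uv
    ... | true  = star u v uv
    ... | false = trans (f-sym (φ u) (φ v)) (star v u (proj₂ (∧-true {not (is u v)} e)))

  double-star : ∀ {n a b} → 6 ≤ n → b ∈ f a → 5 ≤ count (f a) → n ≤ 5 + count (f b) →
                n ≤ count (λ x → f a x ∨ f b x) → Sn5 n ⊆ F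
  double-star {n} {a} {b} 6≤n ab 5≤a n≤b n≤ab = with-order (m≤n⇒∃[o]m+o≡n 6≤n)
    where
    ab∈ = ∈-is {P = f a} ab
    ba∈ = ∈-is {P = f b} (trans (f-sym b a) ab)

    Leaves : ℕ → Set
    Leaves m = Σ[ Z ∈ (Fin N → Bool) ] (∀ x → x ∈ Z → x ∈ (λ x → f a x ∧ not (is b x))) × 4 ≤ count Z ×
               m ≤ count (λ x → (f b x ∧ not (is a x)) ∧ not (Z x))

    leaves : ∀ m → 6 + m ≡ n → Leaves m
    leaves m refl with 4 ≤? count (λ x → (f a x ∧ not (is b x)) ∧ not (f b x))
    ... | yes enough = (λ x → (f a x ∧ not (is b x)) ∧ not (f b x)) , (λ x → proj₁ ∘ ∧-true) , enough ,
      prove (f a ∷ f b ∷ is a ∷ is b ∷ []) (m ∷ [])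
        ((♯ 6 ⊕ atom 0 ≼ ♯ 5 ⊕ ∣ B ∣) ∷ (∣ C ∣ ≼ ♯ 1) ∷ []) (atom 0)
        (∣ (B ⋏ ∁ C) ⋏ ∁ ((A ⋏ ∁ D) ⋏ ∁ B) ∣) (1 ∷ 1 ∷ 1 ∷ []) refl (n≤b , is≤1 a , tt)
    -- All neighbours of `a` outside N(b) are used as leaves, and only the deficit is taken from
    -- N(b). Removing `a`, `b` and these four leaves from N(a) ∪ N(b) leaves n - 6 vertices for `b`.
    ... | no few = let Z , sub , c = trimmed in
      (λ x → (f a x ∧ not (is b x)) ∧ not (f b x) ∨ Z x) , member Z sub ,
      prove (f a ∷ f b ∷ is b ∷ Z ∷ []) [] (always (∁ D ⋎ A ⋏ B) ∷ (♯ 4 ≼ ∣ (A ⋏ ∁ C) ⋏ ∁ B ∣ ⊕ ∣ D ∣) ∷ [])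
        (♯ 4) (∣ (A ⋏ ∁ C) ⋏ ∁ B ⋎ D ∣) (1 ∷ 1 ∷ []) refl
        (⊆⇒always {P = Z} {λ x → f a x ∧ f b x} sub , ≤-reflexive (trans (sym (m+[n∸m]≡n k≤4)) (cong (k +_) (sym c))) , tt) ,
      prove (f a ∷ f b ∷ is a ∷ is b ∷ Z ∷ []) (m ∷ [])
        (always (∁ E ⋎ A ⋏ B) ∷ always (∁ D ⋎ ∁ B) ∷ (♯ 6 ⊕ atom 0 ≼ ∣ A ⋎ B ∣) ∷ (∣ C ∣ ≼ ♯ 1) ∷ (∣ D ∣ ≼ ♯ 1) ∷
         (∣ (A ⋏ ∁ D) ⋏ ∁ B ∣ ⊕ ∣ E ∣ ≼ ♯ 4) ∷ [])
        (atom 0) (∣ (B ⋏ ∁ C) ⋏ ∁ ((A ⋏ ∁ D) ⋏ ∁ B ⋎ E) ∣) (1 ∷ 1 ∷ 1 ∷ 1 ∷ 1 ∷ []) refl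
        (⊆⇒always {P = Z} {λ x → f a x ∧ f b x} sub , f-irr b , n≤ab , is≤1 a , is≤1 b ,
         ≤-reflexive (trans (cong (k +_) c) (m+[n∸m]≡n k≤4)) , tt)
      where
      k = count (λ x → (f a x ∧ not (is b x)) ∧ not (f b x))
      k≤4 : k ≤ 4
      k≤4 = <⇒≤ (≰⇒> few)
      room : 4 ≤ k + count (λ x → f a x ∧ f b x)
      room = prove (f a ∷ f b ∷ is b ∷ []) [] ((♯ 5 ≼ ∣ A ∣) ∷ (∣ C ∣ ≼ ♯ 1) ∷ []) (♯ 4)
        (∣ (A ⋏ ∁ C) ⋏ ∁ B ∣ ⊕ ∣ A ⋏ B ∣) (1 ∷ 1 ∷ 1 ∷ []) refl (5≤a , is≤1 b , tt)
      trimmed : Σ[ Z ∈ (Fin N → Bool) ] (∀ x → x ∈ Z → x ∈ (λ x → f a x ∧ f b x)) × count Z ≡ 4 ∸ k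
      trimmed = trim (4 ∸ k) (λ x → f a x ∧ f b x) (m≤n+o⇒m∸n≤o 4 k room)
      member : ∀ Z → (∀ x → x ∈ Z → x ∈ (λ x → f a x ∧ f b x)) → ∀ x →
               (f a x ∧ not (is b x)) ∧ not (f b x) ∨ Z x ≡ true → f a x ∧ not (is b x) ≡ true
      member Z sub x h with ∈-or-∉ Z x
      ... | inj₁ z = let xa , xb = ∧-true {f a x} (sub x z) in
        ∧-∈ xa (not-∈ (≢⇒∉is {u = b} {x} (λ { refl → true≢false xb (irrefl F b) })))
      ... | inj₂ z rewrite z = proj₁ (∧-true (trans (sym (∨-identityʳ _)) h))

    with-order : ∃[ m ] 6 + m ≡ n → Sn5 n ⊆ F
    with-order (m , refl) =
      let Z , sub , four , rest = leaves m refl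
          L , iL , L∈ = choose 4 {Z} four
          K , iK , K∈ = choose m {λ x → (f b x ∧ not (is a x)) ∧ not (Z x)} rest
      in star-map m a b L K ab (λ i → sub (L i) (L∈ i)) (λ j → proj₁ (∧-true (K∈ j)))
           (λ i j eq → true≢false (subst (_∈ Z) eq (L∈ i)) (not-∉ (proj₂ (∧-true {f b (K j) ∧ not (is a (K j))} (K∈ j)))))
           iL iK

-- Four-cycles in graphs of order seven: the bound R(C₄, K₃) ≤ 7.

four : ∀ {A : Set} → A → A → A → A → Fin 4 → A
four a b c d = cons a (cons b (cons c (cons d λ ())))

four-injective : ∀ {A : Set} {a b c d : A} → Distinct₄ a b c d → Injective _≡_ _≡_ (four a b c d)
four-injective (ab , ac , ad , bc , bd , cd) =
  cons-injective {m = 3} (λ { 0F → ab ; 1F → ac ; 2F → ad })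
  (cons-injective {m = 2} (λ { 0F → bc ; 1F → bd })
  (cons-injective {m = 1} (λ { 0F → cd })
  (cons-injective {m = 0} (λ ()) λ { {()} })))

four-all : ∀ {A : Set} (Q : A → Set) {a b c d : A} → Q a → Q b → Q c → Q d → ∀ i → Q (four a b c d i)
four-all Q qa qb qc qd 0F = qa
four-all Q qa qb qc qd 1F = qb
four-all Q qa qb qc qd 2F = qc
four-all Q qa qb qc qd 3F = qd

handshake : ∀ {N} (r : Fin N → Fin N → Bool) → (∀ x y → r x y ≡ r y x) → (∀ x → r x x ≡ false) →
            ∃[ k ] sumF (λ x → count (r x)) ≡ 2 * k
handshake {zero}  r r-sym r-irr = 0 , refl
handshake {suc N} r r-sym r-irr =
  let k , eq = handshake (λ x y → r (suc x) (suc y)) (λ x y → r-sym (suc x) (suc y)) (r-irr ∘ suc)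
      c = count (λ y → r zero (suc y))
      open ≡-Reasoning
  in c + k , (begin
    (bit (r zero zero) + c) + sumF (λ x → bit (r (suc x) zero) + count (λ y → r (suc x) (suc y)))
      ≡⟨ cong (λ b → (bit b + c) + sumF (λ x → bit (r (suc x) zero) + count (λ y → r (suc x) (suc y)))) (r-irr zero) ⟩
    c + sumF (λ x → bit (r (suc x) zero) + count (λ y → r (suc x) (suc y)))
      ≡⟨ cong (c +_) (sumF-+ (λ x → bit (r (suc x) zero)) _) ⟩
    c + (count (λ x → r (suc x) zero) + sumF (λ x → count (λ y → r (suc x) (suc y))))
      ≡⟨ cong₂ (λ u v → c + (u + v)) (sumF-cong (λ x → cong bit (r-sym (suc x) zero))) eq ⟩
    c + (c + 2 * k)
      ≡⟨ solve 2 (λ c k → c :+ (c :+ con 2 :* k) := con 2 :* (c :+ k)) refl c k ⟩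
    2 * (c + k) ∎)
  where open +-*-Solver using (solve; _:+_; _:*_; _:=_; con)

odd≢2* : ∀ m k → (m % 2 ≡ 1) → m ≡ 2 * k → ⊥
odd≢2* m k odd eq = 0≢1+n (trans (sym (m*n%n≡0 k 2)) (trans (cong (_% 2) (trans (*-comm k 2) (sym eq))) odd))

module _ (r : Fin 7 → Fin 7 → Bool) (r-sym : ∀ x y → r x y ≡ r y x) (r-irr : ∀ x → x ∉ r x)
         (no-independent-triple : ∀ {i j k} → i ≢ j → i ≢ k → j ≢ k → j ∈ r i ⊎ k ∈ r i ⊎ k ∈ r j) where
  private
    flip : ∀ {u x} → x ∈ r u → u ∈ r x
    flip {u} {x} = trans (r-sym x u)

    r⇒≢ : ∀ {u x} → x ∈ r u → u ≢ x
    r⇒≢ {u} h refl = true≢false h (r-irr u)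

    FourCycle : Set
    FourCycle = ∃[ i ] ∃[ j ] ∃[ k ] ∃[ l ] (Distinct₄ i j k l × j ∈ r i × k ∈ r j × l ∈ r k × i ∈ r l)

    cherry : ∀ {v a b e} → a ∈ r v → b ∈ r v → a ≢ b → v ≢ e → e ∈ r a → e ∈ r b → FourCycle
    cherry va vb a≢b v≢e ae be = _ , _ , _ , _ ,
      (r⇒≢ va , v≢e , r⇒≢ vb , r⇒≢ ae , a≢b , r⇒≢ be ∘ sym) , va , ae , flip be , flip vb

    independent-of : ∀ v {a b} → v ≢ a → v ≢ b → a ≢ b → a ∉ r v → b ∉ r v → b ∈ r a
    independent-of v va vb ab av bv with no-independent-triple va vb ab
    ... | inj₁ h        = ⊥-elim (true≢false h av)
    ... | inj₂ (inj₁ h) = ⊥-elim (true≢false h bv)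
    ... | inj₂ (inj₂ h) = h

    -- Non-neighbours of `v` are pairwise adjacent, so four of them form a complete graph.
    many-non-neighbours : ∀ v → 4 ≤ count (λ x → not (is v x) ∧ not (r v x)) → FourCycle
    many-non-neighbours v le =
      let c , inj , mem = choose 4 {λ x → not (is v x) ∧ not (r v x)} le
          apart : ∀ i → v ≢ c i
          apart i = ∉is⇒≢ (proj₁ (∧-true {not (is v (c i))} (mem i)))
          far : ∀ i → c i ∉ r v
          far i = not-∉ (proj₂ (∧-true {not (is v (c i))} (mem i)))
          edge : ∀ i j → i ≢ j → c j ∈ r (c i)
          edge i j ne = independent-of v (apart i) (apart j) (ne ∘ inj) (far i) (far j)
      in c 0F , c 1F , c 2F , c 3F ,
         ((λ ()) ∘ inj , (λ ()) ∘ inj , (λ ()) ∘ inj , (λ ()) ∘ inj , (λ ()) ∘ inj , (λ ()) ∘ inj) ,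
         edge 0F 1F (λ ()) , edge 1F 2F (λ ()) , edge 2F 3F (λ ()) , edge 3F 0F (λ ())

    -- A further vertex e with at most one neighbour among a, b, c, d makes the other
    -- three a clique, which forms a four-cycle with v.
    many-neighbours : ∀ v → 4 ≤ count (r v) → FourCycle
    many-neighbours v le = with-four (choose 4 {r v} le)
      where
      with-four : Σ[ c ∈ (Fin 4 → Fin 7) ] Injective _≡_ _≡_ c × (∀ i → c i ∈ r v) → FourCycle
      with-four (c , inj , mem) = with-e (pick (prove ((λ _ → true) ∷ is v ∷ is (c 0F) ∷ is (c 1F) ∷ is (c 2F) ∷ is (c 3F) ∷ []) []
          (always A ∷ (♯ 7 ≼ ∣ A ∣) ∷ (∣ B ∣ ≼ ♯ 1) ∷ (∣ C ∣ ≼ ♯ 1) ∷ (∣ D ∣ ≼ ♯ 1) ∷ (∣ E ∣ ≼ ♯ 1) ∷ (∣ G ∣ ≼ ♯ 1) ∷ [])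
          (♯ 1) (∣ ∁ B ⋏ ∁ C ⋏ ∁ D ⋏ ∁ E ⋏ ∁ G ∣) (1 ∷ 1 ∷ 1 ∷ 1 ∷ 1 ∷ 1 ∷ 1 ∷ []) refl
          ((λ _ → refl) , ≤-refl , is≤1 v , is≤1 (c 0F) , is≤1 (c 1F) , is≤1 (c 2F) , is≤1 (c 3F) , tt)))
        where
        with-e : ∃[ e ] e ∈ (λ x → not (is v x) ∧ not (is (c 0F) x) ∧ not (is (c 1F) x) ∧ not (is (c 2F) x) ∧ not (is (c 3F) x)) → FourCycle
        with-e (e , h) = by-edges (∈-or-∉ (r e) (c 0F)) (∈-or-∉ (r e) (c 1F)) (∈-or-∉ (r e) (c 2F)) (∈-or-∉ (r e) (c 3F))
          where
          h₁ = ∧-true {not (is v e)} h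
          h₂ = ∧-true {not (is (c 0F) e)} (proj₂ h₁)
          h₃ = ∧-true {not (is (c 1F) e)} (proj₂ h₂)
          h₄ = ∧-true {not (is (c 2F) e)} (proj₂ h₃)
          v≢e : v ≢ e
          v≢e = ∉is⇒≢ (proj₁ h₁)
          c≢e : ∀ i → c i ≢ e
          c≢e 0F = ∉is⇒≢ (proj₁ h₂)
          c≢e 1F = ∉is⇒≢ (proj₁ h₃)
          c≢e 2F = ∉is⇒≢ (proj₁ h₄)
          c≢e 3F = ∉is⇒≢ (proj₂ h₄)
          two-edges : ∀ i j → i ≢ j → c i ∈ r e → c j ∈ r e → FourCycle
          two-edges i j ne ei ej = cherry (mem i) (mem j) (ne ∘ inj) v≢e (flip ei) (flip ej)
          clique : ∀ i j k → i ≢ j → i ≢ k → j ≢ k → c i ∉ r e → c j ∉ r e → c k ∉ r e → FourCycle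
          clique i j k ij ik jk ei ej ek =
            cherry (mem i) (mem k) (ik ∘ inj) (r⇒≢ (mem j))
              (independent-of e (c≢e i ∘ sym) (c≢e j ∘ sym) (ij ∘ inj) ei ej)
              (flip (independent-of e (c≢e j ∘ sym) (c≢e k ∘ sym) (jk ∘ inj) ej ek))
          by-edges : c 0F ∈ r e ⊎ c 0F ∉ r e → c 1F ∈ r e ⊎ c 1F ∉ r e →
                     c 2F ∈ r e ⊎ c 2F ∉ r e → c 3F ∈ r e ⊎ c 3F ∉ r e → FourCycle
          by-edges (inj₁ a) (inj₁ b) _ _ = two-edges 0F 1F (λ ()) a b
          by-edges (inj₁ a) (inj₂ _) (inj₁ b) _ = two-edges 0F 2F (λ ()) a b
          by-edges (inj₁ a) (inj₂ _) (inj₂ _) (inj₁ b) = two-edges 0F 3F (λ ()) a b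
          by-edges (inj₁ _) (inj₂ a) (inj₂ b) (inj₂ c) = clique 1F 2F 3F (λ ()) (λ ()) (λ ()) a b c
          by-edges (inj₂ _) (inj₁ a) (inj₁ b) _ = two-edges 1F 2F (λ ()) a b
          by-edges (inj₂ _) (inj₁ a) (inj₂ _) (inj₁ b) = two-edges 1F 3F (λ ()) a b
          by-edges (inj₂ a) (inj₁ _) (inj₂ b) (inj₂ c) = clique 0F 2F 3F (λ ()) (λ ()) (λ ()) a b c
          by-edges (inj₂ _) (inj₂ _) (inj₁ a) (inj₁ b) = two-edges 2F 3F (λ ()) a b
          by-edges (inj₂ a) (inj₂ b) (inj₁ _) (inj₂ c) = clique 0F 1F 3F (λ ()) (λ ()) (λ ()) a b c
          by-edges (inj₂ a) (inj₂ b) (inj₂ c) _ = clique 0F 1F 2F (λ ()) (λ ()) (λ ()) a b c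

  -- Otherwise r is cubic on seven vertices, which is impossible by parity.
  four-cycle : FourCycle
  four-cycle = decide (any? λ v → 4 ≤? count (r v)) (any? λ v → 4 ≤? count (λ x → not (is v x) ∧ not (r v x)))
    where
    decide : Dec (∃[ v ] 4 ≤ count (r v)) → Dec (∃[ v ] 4 ≤ count (λ x → not (is v x) ∧ not (r v x))) → FourCycle
    decide (yes (v , le)) _ = many-neighbours v le
    decide (no _) (yes (v , le)) = many-non-neighbours v le
    decide (no few) (no dense) = ⊥-elim (odd (handshake r r-sym r-irr))
      where
      cubic : ∀ v → count (r v) ≡ 3
      cubic v = ≤-antisym (≮⇒≥ λ le → few (v , le))
        (prove ((λ _ → true) ∷ is v ∷ r v ∷ []) []
          (always A ∷ (♯ 7 ≼ ∣ A ∣) ∷ (∣ B ∣ ≼ ♯ 1) ∷ (∣ ∁ B ⋏ ∁ C ∣ ≼ ♯ 3) ∷ []) (♯ 3) (∣ C ∣) (1 ∷ 1 ∷ 1 ∷ 1 ∷ []) refl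
          ((λ _ → refl) , ≤-refl , is≤1 v , ≮⇒≥ (λ le → dense (v , le)) , tt))
      odd : ∃[ k ] sumF (λ x → count (r x)) ≡ 2 * k → ⊥
      odd (k , eq) = odd≢2* 21 k refl (trans (sym (sumF-cong cubic)) eq)

-- Maximum degree at most n - 6.

≤ᵇ-false : ∀ m n → (m ≤ᵇ n) ≡ false → n < m
≤ᵇ-false m n eq = ≰⇒> λ le → subst T eq (≤⇒≤ᵇ le)

module SparseCase {N} (F : Graph N) where
  open Wheels F

  -- No spoke is its own complement neighbour, so of six common neighbours of two spokes at most the
  -- other two spokes have to be discarded, and four remain.
  rich-cycle : ∀ h (p : Fin 4 → Fin N) → Injective _≡_ _≡_ p → (∀ i → p i ∈ g h) →
               (∀ i j → toℕ j ≡ suc (toℕ i) % 4 → 6 ≤ count (λ x → g h x ∧ g (p i) x ∧ g (p j) x)) →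
               W₈ ⊆ complement F
  rich-cycle h p inj p∈ rich = rim-wide sp 0F 1F 2F 3F refl
    (wide 0F 1F 2F 3F (⊆R 0F 1F 2F 3F λ _ a b c d → ∧-∈ a (∧-∈ b (∧-∈ c d))) (rich 0F 1F refl))
    (wide 1F 2F 3F 0F (⊆R 1F 2F 3F 0F λ _ a b c d → ∧-∈ d (∧-∈ a (∧-∈ b c))) (rich 1F 2F refl))
    (wide 2F 3F 0F 1F (⊆R 2F 3F 0F 1F λ _ a b c d → ∧-∈ c (∧-∈ d (∧-∈ a b))) (rich 2F 3F refl))
    (wide 3F 0F 1F 2F (⊆R 3F 0F 1F 2F λ _ a b c d → ∧-∈ b (∧-∈ c (∧-∈ d a))) (rich 3F 0F refl))
    where
    away : Fin 4 → Fin N → Bool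
    away i x = not (is (p i) x)
    R : Fin N → Bool
    R x = g h x ∧ away 0F x ∧ away 1F x ∧ away 2F x ∧ away 3F x
    sp : Spokes h R p
    sp = spokes inj p∈ (λ i → ∉R i (∈-or-∉ R (p i))) (λ x → proj₁ ∘ ∧-true {g h x})
      where
      away-all : ∀ x → x ∈ R → ∀ j → x ∈ away j
      away-all x m j = let _ , m₀ = ∧-true {g h x} m
                           a₀ , m₁ = ∧-true {away 0F x} m₀
                           a₁ , m₂ = ∧-true {away 1F x} m₁
                           a₂ , a₃ = ∧-true {away 2F x} m₂
                       in by-index a₀ a₁ a₂ a₃ j
        where
        by-index : x ∈ away 0F → x ∈ away 1F → x ∈ away 2F → x ∈ away 3F → ∀ j → x ∈ away j
        by-index a b c d 0F = a
        by-index a b c d 1F = b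
        by-index a b c d 2F = c
        by-index a b c d 3F = d
      ∉R : ∀ i → p i ∈ R ⊎ p i ∉ R → p i ∉ R
      ∉R i (inj₂ m) = m
      ∉R i (inj₁ m) = ⊥-elim (∉is⇒≢ {u = p i} (away-all (p i) m i) refl)
    ⊆R : ∀ i j k l → (∀ x → x ∈ away i → x ∈ away j → x ∈ away k → x ∈ away l →
           away 0F x ∧ away 1F x ∧ away 2F x ∧ away 3F x ≡ true) →
         ∀ x → x ∈ (λ x → g h x ∧ away i x ∧ away j x ∧ away k x ∧ away l x) → x ∈ R
    ⊆R i j k l arrange x m =
      let a , m₀ = ∧-true {g h x} m
          b , m₁ = ∧-true {away i x} m₀
          c , m₂ = ∧-true {away j x} m₁
          d , e  = ∧-true {away k x} m₂
      in ∧-∈ a (arrange x b c d e)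
    wide : ∀ i j k l → (∀ x → x ∈ (λ x → g h x ∧ away i x ∧ away j x ∧ away k x ∧ away l x) → x ∈ R) →
           6 ≤ count (λ x → g h x ∧ g (p i) x ∧ g (p j) x) → 4 ≤ count (S R (p i) (p j))
    wide i j k l sub six = ≤-trans
      (prove (g h ∷ g (p i) ∷ g (p j) ∷ is (p i) ∷ is (p j) ∷ is (p k) ∷ is (p l) ∷ []) []
        (always (∁ D ⋎ ∁ B) ∷ always (∁ E ⋎ ∁ C) ∷ (♯ 6 ≼ ∣ A ⋏ B ⋏ C ∣) ∷ (∣ G ∣ ≼ ♯ 1) ∷ (∣ var 6 ∣ ≼ ♯ 1) ∷ [])
        (♯ 4) (∣ (A ⋏ ∁ D ⋏ ∁ E ⋏ ∁ G ⋏ ∁ var 6) ⋏ B ⋏ C ∣) (1 ∷ 1 ∷ 1 ∷ 1 ∷ []) refl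
        (∉-is {P = g (p i)} (g-irr (p i)) , ∉-is {P = g (p j)} (g-irr (p j)) , six , is≤1 (p k) , is≤1 (p l) , tt))
      (count-mono {P = λ x → (g h x ∧ away i x ∧ away j x ∧ away k x ∧ away l x) ∧ g (p i) x ∧ g (p j) x} {S R (p i) (p j)}
        λ x m → let a , b = ∧-true {g h x ∧ away i x ∧ away j x ∧ away k x ∧ away l x} m in ∧-∈ (sub x a) b)

  module _ {n} (order : suc N ≡ 2 * n) (sparse : ∀ v → 6 + count (f v) ≤ n) (h : Fin N) where
    private
      H U : Fin N → Bool
      H = g h
      U u = not (H u)

      -- The degree bound ties the two together: a vertex of `H` missing much of `U` has few
      -- neighbours left in `H`, hence a large `w`.
      defect w : Fin N → ℕ
      defect y = count (λ u → U u ∧ f y u)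
      w y = count (λ z → H z ∧ g y z)

      N≥ : N ≤ count {N} (λ _ → true)
      N≥ = ≤-reflexive (sym (count-all N))
      N≤ : count {N} (λ _ → true) ≤ N
      N≤ = ≤-reflexive (count-all N)

    H-size : 4 + n ≤ count H
    H-size = prove ((λ _ → true) ∷ is h ∷ f h ∷ []) (n ∷ N ∷ [])
      (always A ∷ (atom 1 ≼ ∣ A ∣) ∷ (2 ⊗ atom 0 ≼ ♯ 1 ⊕ atom 1) ∷ (♯ 6 ⊕ ∣ C ∣ ≼ atom 0) ∷ (∣ B ∣ ≼ ♯ 1) ∷ [])
      (♯ 4 ⊕ atom 0) (∣ ∁ B ⋏ ∁ C ∣) (1 ∷ 1 ∷ 1 ∷ 1 ∷ 1 ∷ []) refl
      ((λ _ → refl) , N≥ , ≤-reflexive (sym order) , sparse h , is≤1 h , tt)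

    U-size : 2 * n ≤ 1 + count U + count H
    U-size = prove ((λ _ → true) ∷ H ∷ []) (n ∷ N ∷ [])
      (always A ∷ (atom 1 ≼ ∣ A ∣) ∷ (2 ⊗ atom 0 ≼ ♯ 1 ⊕ atom 1) ∷ [])
      (2 ⊗ atom 0) (♯ 1 ⊕ ∣ ∁ B ∣ ⊕ ∣ B ∣) (1 ∷ 1 ∷ 1 ∷ []) refl ((λ _ → refl) , N≥ , ≤-reflexive (sym order) , tt)

    -- Of the at most n - 6 neighbours of `y`, `defect y` lie in `U` and |H| - 1 - w y in `H`.
    defect-bound : ∀ y → y ∈ H → 5 + (defect y + count H) ≤ n + w y
    defect-bound y yH = prove (H ∷ is y ∷ f y ∷ []) (n ∷ [])
      (always (∁ B ⋎ A) ∷ always (∁ B ⋎ ∁ C) ∷ (♯ 6 ⊕ ∣ C ∣ ≼ atom 0) ∷ (∣ B ∣ ≼ ♯ 1) ∷ [])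
      (♯ 5 ⊕ (∣ ∁ A ⋏ C ∣ ⊕ ∣ A ∣)) (atom 0 ⊕ ∣ A ⋏ ∁ B ⋏ ∁ C ∣) (1 ∷ 1 ∷ 1 ∷ []) refl
      (∈-is {P = H} yH , f-irr y , sparse y , is≤1 y , tt)

    unjoined : ∀ y → y ∈ H → count (λ u → U u ∧ not (g y u)) ≤ defect y
    unjoined y yH = prove (H ∷ is y ∷ f y ∷ []) [] (always (∁ B ⋎ A) ∷ [])
      (∣ ∁ A ⋏ ∁ (∁ B ⋏ ∁ C) ∣) (∣ ∁ A ⋏ C ∣) (1 ∷ []) refl (∈-is {P = H} yH , tt)

    module _ {x} (xH : x ∈ H) (x-min : ∀ y → y ∈ H → w x ≤ w y) where
      private
        -- A condition on a single spoke for the hub `x`. Adding it for two spokes and halving shows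
        -- that `x` and both of them have four common complement neighbours in `U`.
        ok : Fin N → Bool
        ok y = (4 + (defect x + 2 * defect y)) ≤ᵇ count U

        Bad : Fin N → Bool
        Bad y = (H y ∧ g x y) ∧ not (ok y)

        cod : Fin N → Fin N → ℕ
        cod y z = count (λ u → H u ∧ g y u ∧ g z u)

        Bad⇒H : ∀ {y} → y ∈ Bad → y ∈ H
        Bad⇒H {y} m = proj₁ (∧-true {H y} (proj₁ (∧-true {H y ∧ g x y} m)))

        Bad⇒g : ∀ {y} → y ∈ Bad → x ∈ g y
        Bad⇒g {y} m = trans (g-sym y x) (proj₂ (∧-true {H y} (proj₁ (∧-true {H y ∧ g x y} m))))

      four-ok : 4 ≤ count (λ y → (H y ∧ g x y) ∧ ok y) → W₈ ⊆ complement F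
      four-ok le = with-four (choose 4 {λ y → (H y ∧ g x y) ∧ ok y} le)
        where
        R : Fin N → Bool
        R u = U u ∧ g x u
        with-four : Σ[ p ∈ (Fin 4 → Fin N) ] Injective _≡_ _≡_ p × (∀ i → p i ∈ (λ y → (H y ∧ g x y) ∧ ok y)) → W₈ ⊆ complement F
        with-four (p , inj , mem) = rim-wide sp 0F 1F 2F 3F refl (wide 0F 1F) (wide 1F 2F) (wide 2F 3F) (wide 3F 0F)
          where
          pH : ∀ i → p i ∈ H
          pH i = proj₁ (∧-true {H (p i)} (proj₁ (∧-true {H (p i) ∧ g x (p i)} (mem i))))
          px : ∀ i → p i ∈ g x
          px i = proj₂ (∧-true {H (p i)} (proj₁ (∧-true {H (p i) ∧ g x (p i)} (mem i))))
          p-ok : ∀ i → 4 + (defect x + 2 * defect (p i)) ≤ count U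
          p-ok i = ≤ᵇ-true (4 + (defect x + 2 * defect (p i))) (count U) (proj₂ (∧-true {H (p i) ∧ g x (p i)} (mem i)))
          sp : Spokes x R p
          sp = spokes inj px (λ i → ∉R i (pH i)) (λ u m → proj₂ (∧-true {U u} m))
            where
            ∉R : ∀ i → p i ∈ H → p i ∉ R
            ∉R i m rewrite m = refl
          wide : ∀ i j → 4 ≤ count (S R (p i) (p j))
          wide i j = prove (H ∷ g x ∷ g (p i) ∷ g (p j) ∷ []) (defect x ∷ defect (p i) ∷ defect (p j) ∷ [])
            ((∣ ∁ A ⋏ ∁ B ∣ ≼ atom 0) ∷ (∣ ∁ A ⋏ ∁ C ∣ ≼ atom 1) ∷ (∣ ∁ A ⋏ ∁ D ∣ ≼ atom 2) ∷
             (♯ 4 ⊕ (atom 0 ⊕ 2 ⊗ atom 1) ≼ ∣ ∁ A ∣) ∷ (♯ 4 ⊕ (atom 0 ⊕ 2 ⊗ atom 2) ≼ ∣ ∁ A ∣) ∷ [])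
            (♯ 4) (∣ (∁ A ⋏ B) ⋏ C ⋏ D ∣) (2 ∷ 2 ∷ 2 ∷ 2 ∷ 1 ∷ 1 ∷ []) refl
            (unjoined x xH , unjoined (p i) (pH i) , unjoined (p j) (pH j) , p-ok i , p-ok j , tt)

      many-bad : ¬ 4 ≤ count (λ y → (H y ∧ g x y) ∧ ok y) → w x ≤ 3 + count Bad
      many-bad few = prove (H ∷ g x ∷ ok ∷ []) [] ((∣ (A ⋏ B) ⋏ C ∣ ≼ ♯ 3) ∷ [])
        (∣ A ⋏ B ∣) (♯ 3 ⊕ ∣ (A ⋏ B) ⋏ ∁ C ∣) (1 ∷ 1 ∷ []) refl (≤-pred (≰⇒> few) , tt)

      w-large : 9 ≤ w x
      w-large = prove {0} [] (n ∷ count H ∷ defect x ∷ w x ∷ [])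
        ((♯ 4 ⊕ atom 0 ≼ atom 1) ∷ (♯ 5 ⊕ (atom 2 ⊕ atom 1) ≼ atom 0 ⊕ atom 3) ∷ []) (♯ 9) (atom 3) (1 ∷ 1 ∷ 1 ∷ []) refl
        (H-size , defect-bound x xH , tt)

      -- Failure of `ok` makes the defects of `x` and `y` large compared with |U|, and
      -- `defect-bound` converts defects into degrees into `H`.
      bad-degree : ∀ {y} → y ∈ Bad → 11 + 2 * count H ≤ n + (2 * w y + w x)
      bad-degree {y} m = prove {0} [] (n ∷ count H ∷ count U ∷ defect x ∷ defect y ∷ w x ∷ w y ∷ [])
        ((2 ⊗ atom 0 ≼ ♯ 1 ⊕ atom 2 ⊕ atom 1) ∷ (♯ 5 ⊕ (atom 3 ⊕ atom 1) ≼ atom 0 ⊕ atom 5) ∷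
         (♯ 5 ⊕ (atom 4 ⊕ atom 1) ≼ atom 0 ⊕ atom 6) ∷ (♯ 1 ⊕ atom 2 ≼ ♯ 4 ⊕ (atom 3 ⊕ 2 ⊗ atom 4)) ∷ [])
        (♯ 11 ⊕ 2 ⊗ atom 1) (atom 0 ⊕ (2 ⊗ atom 6 ⊕ atom 5)) (1 ∷ 1 ∷ 1 ∷ 2 ∷ 1 ∷ []) refl
        (U-size , defect-bound x xH , defect-bound y (Bad⇒H m) ,
         ≤ᵇ-false (4 + (defect x + 2 * defect y)) (count U) (not-∉ (proj₂ (∧-true {H y ∧ g x y} m))) , tt)

      -- The degrees of `y` and `z` into `H` sum to at least 2|H| - n + 2, so they overlap in at
      -- least |H| - n + 2 ≥ 6 vertices.
      rich-pairs : w x ≤ 9 → ∀ {y z} → y ∈ Bad → z ∈ Bad → 6 ≤ cod y z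
      rich-pairs small {y} {z} yB zB = prove (H ∷ g y ∷ g z ∷ []) (n ∷ w x ∷ [])
        ((♯ 4 ⊕ atom 0 ≼ ∣ A ∣) ∷ (atom 1 ≼ ♯ 9) ∷ (♯ 11 ⊕ 2 ⊗ ∣ A ∣ ≼ atom 0 ⊕ (2 ⊗ ∣ A ⋏ B ∣ ⊕ atom 1)) ∷
         (♯ 11 ⊕ 2 ⊗ ∣ A ∣ ≼ atom 0 ⊕ (2 ⊗ ∣ A ⋏ C ∣ ⊕ atom 1)) ∷ [])
        (♯ 6) (∣ A ⋏ B ⋏ C ∣) (2 ∷ 2 ∷ 2 ∷ 1 ∷ 1 ∷ []) refl (H-size , small , bad-degree yB , bad-degree zB , tt)

      -- The three degrees into `H` sum to at least |H| + 15. A vertex in m of the three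
      -- neighbourhoods lies in at least m - 1 of their pairwise intersections, and `x`, which lies
      -- in all three neighbourhoods, in one more than that. So the codegrees sum to at least 16,
      -- more than 3 · 5.
      rich-triples : ∀ {y z t} → y ∈ Bad → z ∈ Bad → t ∈ Bad → cod y z < 6 → cod y t < 6 → cod z t < 6 → ⊥
      rich-triples {y} {z} {t} yB zB tB yz yt zt = <-irrefl refl
        (prove (H ∷ g y ∷ g z ∷ g t ∷ is x ∷ []) (n ∷ w x ∷ [])
          (always (∁ E ⋎ A) ∷ always (∁ E ⋎ B) ∷ always (∁ E ⋎ C) ∷ always (∁ E ⋎ D) ∷ (♯ 1 ≼ ∣ E ∣) ∷
           (♯ 4 ⊕ atom 0 ≼ ∣ A ∣) ∷
           (♯ 11 ⊕ 2 ⊗ ∣ A ∣ ≼ atom 0 ⊕ (2 ⊗ ∣ A ⋏ B ∣ ⊕ atom 1)) ∷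
           (♯ 11 ⊕ 2 ⊗ ∣ A ∣ ≼ atom 0 ⊕ (2 ⊗ ∣ A ⋏ C ∣ ⊕ atom 1)) ∷
           (♯ 11 ⊕ 2 ⊗ ∣ A ∣ ≼ atom 0 ⊕ (2 ⊗ ∣ A ⋏ D ∣ ⊕ atom 1)) ∷
           (atom 1 ≼ ∣ A ⋏ B ∣) ∷ (atom 1 ≼ ∣ A ⋏ C ∣) ∷ (atom 1 ≼ ∣ A ⋏ D ∣) ∷
           (♯ 1 ⊕ ∣ A ⋏ B ⋏ C ∣ ≼ ♯ 6) ∷ (♯ 1 ⊕ ∣ A ⋏ B ⋏ D ∣ ≼ ♯ 6) ∷ (♯ 1 ⊕ ∣ A ⋏ C ⋏ D ∣ ≼ ♯ 6) ∷ [])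
          (♯ 1) (♯ 0) (0 ∷ 2 ∷ 2 ∷ 0 ∷ 1 ∷ 1 ∷ 2 ∷ 0 ∷ 0 ∷ 2 ∷ 2 ∷ 2 ∷ []) refl
          (∈-is {P = H} xH , ∈-is {P = g y} (Bad⇒g yB) , ∈-is {P = g z} (Bad⇒g zB) , ∈-is {P = g t} (Bad⇒g tB) , 1≤is x ,
           H-size , bad-degree yB , bad-degree zB , bad-degree tB ,
           x-min y (Bad⇒H yB) , x-min z (Bad⇒H zB) , x-min t (Bad⇒H tB) , yz , yt , zt , tt))

      from-bad : w x ≤ 3 + count Bad → W₈ ⊆ complement F
      from-bad le with w x ≤? 9
      ... | yes small =
        let p , inj , mem = choose 4 {Bad} (+-cancelˡ-≤ 3 _ _ (≤-trans (≤-trans (m≤n+m 7 2) w-large) le))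
        in rich-cycle h p inj (λ i → Bad⇒H (mem i)) λ i j _ → rich-pairs small (mem i) (mem j)
      -- At most three of at least ten candidates are `ok`, which leaves the seven bad vertices that
      -- `four-cycle` needs.
      ... | no large = with-seven (choose 7 {Bad} (+-cancelˡ-≤ 3 _ _ (≤-trans (≰⇒> large) le)))
        where
        with-seven : Σ[ y ∈ (Fin 7 → Fin N) ] Injective _≡_ _≡_ y × (∀ i → y i ∈ Bad) → W₈ ⊆ complement F
        with-seven (y , inj , mem) = from-cycle (four-cycle r r-sym r-irr triple)
          where
          r : Fin 7 → Fin 7 → Bool
          r i j = not (is i j) ∧ (6 ≤ᵇ cod (y i) (y j))
          cod-sym : ∀ u v → cod u v ≤ cod v u
          cod-sym u v = prove (H ∷ g u ∷ g v ∷ []) [] [] (∣ A ⋏ B ⋏ C ∣) (∣ A ⋏ C ⋏ B ∣) (1 ∷ []) refl tt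
          r-sym : ∀ i j → r i j ≡ r j i
          r-sym i j = cong₂ (λ a b → not a ∧ (6 ≤ᵇ b)) (≡ᵇ-sym (toℕ i) (toℕ j))
            (≤-antisym (cod-sym (y i) (y j)) (cod-sym (y j) (y i)))
          r-irr : ∀ i → i ∉ r i
          r-irr i rewrite is-refl i = refl
          r-small : ∀ {i j} → i ≢ j → j ∉ r i → cod (y i) (y j) < 6
          r-small {i} {j} ne h rewrite ≢⇒∉is ne = ≤ᵇ-false 6 (cod (y i) (y j)) h
          triple : ∀ {i j k} → i ≢ j → i ≢ k → j ≢ k → j ∈ r i ⊎ k ∈ r i ⊎ k ∈ r j
          triple {i} {j} {k} ij ik jk = split (∈-or-∉ (r i) j) (∈-or-∉ (r i) k) (∈-or-∉ (r j) k)
            where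
            split : j ∈ r i ⊎ j ∉ r i → k ∈ r i ⊎ k ∉ r i → k ∈ r j ⊎ k ∉ r j → j ∈ r i ⊎ k ∈ r i ⊎ k ∈ r j
            split (inj₁ a) _ _ = inj₁ a
            split (inj₂ _) (inj₁ b) _ = inj₂ (inj₁ b)
            split (inj₂ _) (inj₂ _) (inj₁ c) = inj₂ (inj₂ c)
            split (inj₂ a) (inj₂ b) (inj₂ c) =
              ⊥-elim (rich-triples (mem i) (mem j) (mem k) (r-small ij a) (r-small ik b) (r-small jk c))
          from-cycle : ∃[ i ] ∃[ j ] ∃[ k ] ∃[ l ] (Distinct₄ i j k l × j ∈ r i × k ∈ r j × l ∈ r k × i ∈ r l) → W₈ ⊆ complement F
          from-cycle (i , j , k , l , dist , ij , jk , kl , li) =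
            rich-cycle h (y ∘ four i j k l) (four-injective dist ∘ inj) (λ m → Bad⇒H (mem (four i j k l m))) rich
            where
            six : ∀ {i j} → j ∈ r i → 6 ≤ cod (y i) (y j)
            six {i} {j} m = ≤ᵇ-true 6 (cod (y i) (y j)) (proj₂ (∧-true {not (is i j)} m))
            rich : ∀ m n → toℕ n ≡ suc (toℕ m) % 4 → 6 ≤ cod (y (four i j k l m)) (y (four i j k l n))
            rich 0F 1F _ = six ij
            rich 1F 2F _ = six jk
            rich 2F 3F _ = six kl
            rich 3F 0F _ = six li

      sparse-at : W₈ ⊆ complement F
      sparse-at with 4 ≤? count (λ y → (H y ∧ g x y) ∧ ok y)
      ... | yes le = four-ok le
      ... | no few = from-bad (many-bad few)

    sparse⇒wheel : W₈ ⊆ complement F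
    sparse⇒wheel = let x , xH , x-min = minimal {P = H} w (≤-trans (s≤s z≤n) H-size) in sparse-at xH x-min

-- Sets of n vertices of complement degree at most three.

module CubicCase {N} (F : Graph N) where
  open Wheels F
  open Stars F

  module _ {n} (9≤n : 9 ≤ n) {W : Fin N → Bool} (size : count W ≡ n)
           (degree : ∀ x → x ∈ W → count (λ y → W y ∧ g x y) ≤ 3) where
    private
      common : Fin N → Fin N → Fin N → Bool
      common u v x = W x ∧ g u x ∧ g v x

      n≤W : n ≤ count W
      n≤W = ≤-reflexive (sym size)

      W≤n : count W ≤ n
      W≤n = ≤-reflexive size

    -- Both `u` and `v` have at least n - 4 neighbours in `W`, and without a common complement
    -- neighbour N(u) ∪ N(v) covers all n vertices of `W`.
    far-pair : ∀ {u v} → u ∈ W → v ∈ W → v ∈ f u → count (common u v) ≤ 0 → Sn5 n ⊆ F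
    far-pair {u} {v} uW vW uv none = double-star (≤-trans (m≤n+m 6 3) 9≤n) uv
      (prove (W ∷ is u ∷ f u ∷ []) (n ∷ [])
        ((atom 0 ≼ ∣ A ∣) ∷ (♯ 9 ≼ atom 0) ∷ (∣ B ∣ ≼ ♯ 1) ∷ (∣ A ⋏ ∁ B ⋏ ∁ C ∣ ≼ ♯ 3) ∷ [])
        (♯ 5) (∣ C ∣) (1 ∷ 1 ∷ 1 ∷ 1 ∷ 1 ∷ []) refl (n≤W , 9≤n , is≤1 u , degree u uW , tt))
      (prove (W ∷ is v ∷ f v ∷ []) (n ∷ [])
        ((atom 0 ≼ ∣ A ∣) ∷ (∣ B ∣ ≼ ♯ 1) ∷ (∣ A ⋏ ∁ B ⋏ ∁ C ∣ ≼ ♯ 3) ∷ [])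
        (atom 0) (♯ 5 ⊕ ∣ C ∣) (1 ∷ 1 ∷ 1 ∷ 1 ∷ []) refl (n≤W , is≤1 v , degree v vW , tt))
      (prove (W ∷ is u ∷ f u ∷ is v ∷ f v ∷ []) (n ∷ [])
        (always (∁ B ⋎ E) ∷ always (∁ D ⋎ C) ∷ (atom 0 ≼ ∣ A ∣) ∷
         (∣ A ⋏ (∁ B ⋏ ∁ C) ⋏ ∁ D ⋏ ∁ E ∣ ≼ ♯ 0) ∷ [])
        (atom 0) (∣ C ⋎ E ∣) (1 ∷ 1 ∷ 1 ∷ []) refl
        (∈-is {P = f v} (trans (f-sym v u) uv) , ∈-is {P = f u} uv , n≤W , none , tt))

    Adjacent : Fin N → Fin N → Set
    Adjacent u v = v ∈ (λ v → W v ∧ g u v)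

    Diameter₂ : Set
    Diameter₂ = ∀ {u v} → u ∈ W → v ∈ W → u ≢ v → v ∉ g u → 1 ≤ count (common u v)

    diameter : Sn5 n ⊆ F ⊎ Diameter₂
    diameter = decide (any? λ u → any? λ v →
      (W u ≟ᵇ true) ×-dec (W v ≟ᵇ true) ×-dec (f u v ≟ᵇ true) ×-dec (count (common u v) ≤? 0))
      where
      decide : Dec (∃[ u ] ∃[ v ] (u ∈ W × v ∈ W × v ∈ f u × count (common u v) ≤ 0)) → Sn5 n ⊆ F ⊎ Diameter₂
      decide (yes (u , v , uW , vW , uv , none)) = inj₁ (far-pair uW vW uv none)
      decide (no close) = inj₂ λ {u} {v} uW vW ne ug →
        ≰⇒> λ none → close (u , v , uW , vW , joined u v ne ug , none)
        where
        joined : ∀ u v → u ≢ v → v ∉ g u → v ∈ f u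
        joined u v ne h rewrite ≢⇒∉is ne = trans (sym (not-involutive (f u v))) (not-∈ h)

    module _ (diam : Diameter₂) where
      private
        ball : Fin N → Fin N → Bool
        ball u v = W v ∧ not (is u v) ∧ not (g u v)

      -- Counting paths of length two from u.
      moore-bound : ∀ u → u ∈ W → count W ≤ 1 + 3 * count (λ x → W x ∧ g u x)
      moore-bound u uW = prove (W ∷ is u ∷ g u ∷ []) []
        ((∣ B ∣ ≼ ♯ 1) ∷ (∣ A ⋏ ∁ B ⋏ ∁ C ∣ ≼ 2 ⊗ ∣ A ⋏ C ∣) ∷ []) (∣ A ∣) (♯ 1 ⊕ 3 ⊗ ∣ A ⋏ C ∣) (1 ∷ 1 ∷ 1 ∷ []) refl
        (is≤1 u , paths , tt)
        where
        Γ : Fin N → Bool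
        Γ x = W x ∧ g u x
        open ≤-Reasoning
        lower : ∀ v → v ∈ ball u → 1 ≤ count (λ x → Γ x ∧ g v x)
        lower v m = ≤-trans
          (let vW , r = ∧-true {W v} m
               a , b  = ∧-true {not (is u v)} r
           in diam uW vW (∉is⇒≢ a) (not-∉ b))
          (prove (W ∷ g u ∷ g v ∷ []) [] [] (∣ A ⋏ B ⋏ C ∣) (∣ (A ⋏ B) ⋏ C ∣) (1 ∷ []) refl tt)
        upper : ∀ x → x ∈ Γ → count (λ v → ball u v ∧ g x v) ≤ 2
        upper x m = let xW , ux = ∧-true {W x} m in
          prove (W ∷ is u ∷ g u ∷ g x ∷ []) []
            (always (∁ B ⋎ A) ∷ always (∁ B ⋎ D) ∷ (♯ 1 ≼ ∣ B ∣) ∷ (∣ A ⋏ D ∣ ≼ ♯ 3) ∷ [])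
            (∣ (A ⋏ ∁ B ⋏ ∁ C) ⋏ D ∣) (♯ 2) (1 ∷ 1 ∷ 1 ∷ []) refl
            (∈-is {P = W} uW , ∈-is {P = g x} (trans (g-sym x u) ux) , 1≤is u , degree x xW , tt)
        paths : count (ball u) ≤ 2 * count Γ
        paths = begin
          count (ball u)                                 ≡⟨ *-identityˡ _ ⟨
          1 * count (ball u)                             ≤⟨ ≤-sumOver lower ⟩
          sumOver (ball u) (λ v → count (λ x → Γ x ∧ g v x)) ≡⟨ double-count (ball u) Γ g g g-sym ⟩
          sumOver Γ (λ x → count (λ v → ball u v ∧ g x v))   ≤⟨ sumOver-≤ upper ⟩
          2 * count Γ                                    ∎

      -- By `moore-bound`, 9 ≤ 1 + 3 · degree, so integrality gives 3.
      regular : ∀ u → u ∈ W → 3 ≤ count (λ x → W x ∧ g u x)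
      regular u uW = prove {0} [] (n ∷ count W ∷ count (λ x → W x ∧ g u x) ∷ [])
        ((♯ 9 ≼ atom 0) ∷ (atom 0 ≼ atom 1) ∷ (atom 1 ≼ ♯ 1 ⊕ 3 ⊗ atom 2) ∷ []) (♯ 3) (atom 2) (3 ∷ 1 ∷ 1 ∷ 1 ∷ []) refl
        (9≤n , n≤W , moore-bound u uW , tt)

      W-nonempty : 1 ≤ count W
      W-nonempty = ≤-trans (≤-trans (s≤s z≤n) 9≤n) n≤W

      n≤10 : n ≤ 10
      n≤10 = let u , uW = pick {P = W} W-nonempty in
        prove {0} [] (n ∷ count W ∷ count (λ x → W x ∧ g u x) ∷ [])
        ((atom 0 ≼ atom 1) ∷ (atom 1 ≼ ♯ 1 ⊕ 3 ⊗ atom 2) ∷ (atom 2 ≼ ♯ 3) ∷ []) (atom 0) (♯ 10) (1 ∷ 1 ∷ 1 ∷ 3 ∷ []) refl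
        (n≤W , moore-bound u uW , degree u uW , tt)

      -- A cubic graph on nine vertices would have the odd degree sum 27.
      n≢9 : n ≢ 9
      n≢9 refl = odd (handshake r r-sym (λ x → r-irr x (∈-or-∉ W x)))
        where
        r : Fin N → Fin N → Bool
        r x y = W x ∧ W y ∧ g x y
        r-sym : ∀ x y → r x y ≡ r y x
        r-sym x y rewrite g-sym x y with W x | W y
        ... | true  | true  = refl
        ... | true  | false = refl
        ... | false | true  = refl
        ... | false | false = refl
        r-irr : ∀ x → x ∈ W ⊎ x ∉ W → r x x ≡ false
        r-irr x (inj₁ h) rewrite h = g-irr x
        r-irr x (inj₂ h) rewrite h = refl
        deg : Fin N → ℕ
        deg x = count (λ y → W y ∧ g x y)
        restrict : ∀ x → count (r x) ≡ bit (W x) * deg x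
        restrict x with W x
        ... | true  = sym (*-identityˡ _)
        ... | false = sumF-0 N
        27-edges : sumF (λ x → count (r x)) ≡ 27
        27-edges = trans (sumF-cong restrict) (≤-antisym
          (≤-trans (sumOver-≤ {P = W} {deg} {3} degree) (≤-reflexive (cong (3 *_) size)))
          (≤-trans (≤-reflexive (cong (3 *_) (sym size))) (≤-sumOver {P = W} {deg} {3} regular)))
        odd : ∃[ k ] sumF (λ x → count (r x)) ≡ 2 * k → ⊥
        odd (k , eq) = odd≢2* 27 k refl (trans (sym 27-edges) eq)

      10≤n : 10 ≤ n
      10≤n = ≤∧≢⇒< 9≤n (n≢9 ∘ sym)

      -- The Moore bound is attained, so W induces a graph of girth five.
      module _ {u x₁ x₂ x₃} (uW : u ∈ W) (ux₁ : Adjacent u x₁) (ux₂ : Adjacent u x₂) (ux₃ : Adjacent u x₃)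
               (x₁₂ : x₁ ≢ x₂) (x₁₃ : x₁ ≢ x₃) (x₂₃ : x₂ ≢ x₃) where
        private
          nbr : Fin N → Bool
          nbr x = W x ∧ g u x

          back : ∀ {x} → Adjacent u x → u ∈ g x
          back {x} m = trans (g-sym x u) (proj₂ (∧-true {W x} m))

        covers : ∀ c → Adjacent u c → x₁ ≡ c ⊎ x₂ ≡ c ⊎ x₃ ≡ c
        covers c uc = split (∈-or-∉ (is x₁) c) (∈-or-∉ (is x₂) c) (∈-or-∉ (is x₃) c)
          where
          split : c ∈ is x₁ ⊎ c ∉ is x₁ → c ∈ is x₂ ⊎ c ∉ is x₂ → c ∈ is x₃ ⊎ c ∉ is x₃ → x₁ ≡ c ⊎ x₂ ≡ c ⊎ x₃ ≡ c
          split (inj₁ h) _ _ = inj₁ (is⇒≡ h)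
          split (inj₂ _) (inj₁ h) _ = inj₂ (inj₁ (is⇒≡ h))
          split (inj₂ _) (inj₂ _) (inj₁ h) = inj₂ (inj₂ (is⇒≡ h))
          split (inj₂ h₁) (inj₂ h₂) (inj₂ h₃) = ⊥-elim (<-irrefl refl
            (prove (nbr ∷ is x₁ ∷ is x₂ ∷ is x₃ ∷ is c ∷ []) []
              (always (∁ B ⋎ A) ∷ always (∁ C ⋎ A) ∷ always (∁ D ⋎ A) ∷ always (∁ E ⋎ A) ∷
               always (∁ E ⋎ ∁ B) ∷ always (∁ E ⋎ ∁ C) ∷ always (∁ E ⋎ ∁ D) ∷
               always (∁ C ⋎ ∁ B) ∷ always (∁ D ⋎ ∁ B) ∷ always (∁ D ⋎ ∁ C) ∷
               (♯ 1 ≼ ∣ B ∣) ∷ (♯ 1 ≼ ∣ C ∣) ∷ (♯ 1 ≼ ∣ D ∣) ∷ (♯ 1 ≼ ∣ E ∣) ∷ (∣ A ∣ ≼ ♯ 3) ∷ [])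
              (♯ 1) (♯ 0) (0 ∷ 1 ∷ 1 ∷ 1 ∷ 1 ∷ 1 ∷ []) refl
              (∈-is {P = nbr} ux₁ , ∈-is {P = nbr} ux₂ , ∈-is {P = nbr} ux₃ , ∈-is {P = nbr} uc ,
               ∉-is {P = is x₁} h₁ , ∉-is {P = is x₂} h₂ , ∉-is {P = is x₃} h₃ ,
               ∉-is {P = is x₁} (≢⇒∉is x₁₂) , ∉-is {P = is x₁} (≢⇒∉is x₁₃) , ∉-is {P = is x₂} (≢⇒∉is x₂₃) ,
               1≤is x₁ , 1≤is x₂ , 1≤is x₃ , 1≤is c , degree u uW , tt)))

        reach : ∀ v → not (ball u v) ∨ (g x₁ v ∨ g x₂ v ∨ g x₃ v) ≡ true
        reach = ⊆⇒always {P = ball u} {λ v → g x₁ v ∨ g x₂ v ∨ g x₃ v} λ v m →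
          let vW , r = ∧-true {W v} m
              a , b  = ∧-true {not (is u v)} r
          in via v (pick {P = common u v} (diam uW vW (∉is⇒≢ a) (not-∉ b)))
          where
          via : ∀ v → ∃[ c ] c ∈ common u v → g x₁ v ∨ g x₂ v ∨ g x₃ v ≡ true
          via v (c , m) = let cW , r = ∧-true {W c} m
                              uc , vc = ∧-true {g u c} r
                          in by-nbr (covers c (∧-∈ cW uc)) (trans (g-sym c v) vc)
            where
            by-nbr : x₁ ≡ c ⊎ x₂ ≡ c ⊎ x₃ ≡ c → v ∈ g c → g x₁ v ∨ g x₂ v ∨ g x₃ v ≡ true
            by-nbr (inj₁ refl) h rewrite h = refl
            by-nbr (inj₂ (inj₁ refl)) h rewrite h = ∨-zeroʳ _
            by-nbr (inj₂ (inj₂ refl)) h rewrite h | ∨-zeroʳ (g x₂ v) = ∨-zeroʳ _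

        -- At least six vertices lie at distance two from `u`, and each of x₁, x₂, x₃ has at most
        -- two neighbours besides `u` with which to reach them. So none of these is wasted on a
        -- neighbour of `u` or on a vertex reached twice.
        tight : count (λ v → W v ∧ g u v ∧ g x₁ v) + count (λ v → W v ∧ g x₁ v ∧ g x₂ v ∧ not (is u v)) ≤ 0
        tight = prove (W ∷ g u ∷ g x₁ ∷ g x₂ ∷ g x₃ ∷ is u ∷ []) (n ∷ [])
          (always (∁ (A ⋏ ∁ G ⋏ ∁ B) ⋎ (C ⋎ D ⋎ E)) ∷
           always (∁ G ⋎ A) ∷ always (∁ G ⋎ ∁ B) ∷ always (∁ G ⋎ C) ∷ always (∁ G ⋎ D) ∷ always (∁ G ⋎ E) ∷
           (♯ 10 ≼ atom 0) ∷ (atom 0 ≼ ∣ A ∣) ∷ (∣ A ⋏ B ∣ ≼ ♯ 3) ∷ (∣ A ⋏ C ∣ ≼ ♯ 3) ∷ (∣ A ⋏ D ∣ ≼ ♯ 3) ∷ (∣ A ⋏ E ∣ ≼ ♯ 3) ∷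
           (♯ 1 ≼ ∣ G ∣) ∷ [])
          (∣ A ⋏ B ⋏ C ∣ ⊕ ∣ A ⋏ C ⋏ D ⋏ ∁ G ∣) (♯ 0) (1 ∷ 1 ∷ 1 ∷ 1 ∷ 1 ∷ 1 ∷ 1 ∷ 2 ∷ []) refl
          (reach , ∈-is {P = W} uW , ∉-is {P = g u} (g-irr u) , ∈-is {P = g x₁} (back ux₁) , ∈-is {P = g x₂} (back ux₂) ,
           ∈-is {P = g x₃} (back ux₃) , 10≤n , n≤W , degree u uW ,
           degree x₁ (proj₁ (∧-true ux₁)) , degree x₂ (proj₁ (∧-true ux₂)) , degree x₃ (proj₁ (∧-true ux₃)) ,
           1≤is u , tt)

      third : ∀ {u x y} → u ∈ W → ∃[ z ] z ∈ (λ z → (W z ∧ g u z) ∧ not (is x z) ∧ not (is y z))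
      third {u} {x} {y} uW = pick (prove ((λ z → W z ∧ g u z) ∷ is x ∷ is y ∷ []) []
        ((♯ 3 ≼ ∣ A ∣) ∷ (∣ B ∣ ≼ ♯ 1) ∷ (∣ C ∣ ≼ ♯ 1) ∷ []) (♯ 1) (∣ A ⋏ ∁ B ⋏ ∁ C ∣) (1 ∷ 1 ∷ 1 ∷ 1 ∷ []) refl
        (regular u uW , is≤1 x , is≤1 y , tt))

      girth-5 : ∀ {u x y} → u ∈ W → Adjacent u x → Adjacent u y → x ≢ y →
                count (λ v → W v ∧ g u v ∧ g x v) + count (λ v → W v ∧ g x v ∧ g y v ∧ not (is u v)) ≤ 0
      girth-5 {u} {x} {y} uW ux uy ne = with-third (third {u} {x} {y} uW)
        where
        with-third : ∃[ z ] z ∈ (λ z → (W z ∧ g u z) ∧ not (is x z) ∧ not (is y z)) →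
                     count (λ v → W v ∧ g u v ∧ g x v) + count (λ v → W v ∧ g x v ∧ g y v ∧ not (is u v)) ≤ 0
        with-third (z , m) = let uz , r = ∧-true {W z ∧ g u z} m
                                 xz , yz = ∧-true {not (is x z)} r
                             in tight uW ux uy uz ne (∉is⇒≢ xz) (∉is⇒≢ yz)

      triangle-free : ∀ {u x y} → u ∈ W → Adjacent u x → Adjacent u y → Adjacent x y → ⊥
      triangle-free {u} {x} {y} uW ux uy xy = <⇒≱ (∈⇒1≤ {P = λ v → W v ∧ g u v ∧ g x v} {y}
          (∧-∈ (proj₁ (∧-true {W y} uy)) (∧-∈ (proj₂ (∧-true {W y} uy)) (proj₂ (∧-true {W y} xy)))))
        (m+n≤o⇒m≤o _ (girth-5 uW ux uy (g⇒≢ (proj₂ (∧-true {W y} xy)))))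

      square-free : ∀ {u x y v} → u ∈ W → Adjacent u x → Adjacent u y → x ≢ y → Adjacent x v → Adjacent y v → u ≡ v
      square-free {u} {x} {y} {v} uW ux uy ne xv yv with ∈-or-∉ (is u) v
      ... | inj₁ h = is⇒≡ h
      ... | inj₂ h = ⊥-elim (<⇒≱ (∈⇒1≤ {P = λ v → W v ∧ g x v ∧ g y v ∧ not (is u v)} {v}
          (∧-∈ (proj₁ (∧-true {W v} xv)) (∧-∈ (proj₂ (∧-true {W v} xv)) (∧-∈ (proj₂ (∧-true {W v} yv)) (not-∈ h)))))
        (m+n≤o⇒n≤o (count (λ v → W v ∧ g u v ∧ g x v)) (girth-5 uW ux uy ne)))

      reverse : ∀ {u x} → u ∈ W → Adjacent u x → Adjacent x u
      reverse {u} {x} uW ux = ∧-∈ uW (trans (g-sym x u) (proj₂ (∧-true {W x} ux)))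

      end∈W : ∀ {u x} → Adjacent u x → x ∈ W
      end∈W {x = x} ux = proj₁ (∧-true {W x} ux)

      joint : ∀ {u v} → u ∈ W → v ∈ W → u ≢ v → ¬ Adjacent u v → ∃[ c ] Adjacent u c × Adjacent c v
      joint {u} {v} uW vW ne far = via (pick {P = common u v} (diam uW vW ne (apart (∈-or-∉ (g u) v))))
        where
        apart : v ∈ g u ⊎ v ∉ g u → v ∉ g u
        apart (inj₁ h) = ⊥-elim (far (∧-∈ vW h))
        apart (inj₂ h) = h
        via : ∃[ c ] c ∈ common u v → ∃[ c ] Adjacent u c × Adjacent c v
        via (c , m) = let cW , r = ∧-true {W c} m
                          uc , vc = ∧-true {g u c} r
                      in c , ∧-∈ cW uc , ∧-∈ vW (trans (g-sym c v) vc)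

      -- An eight-cycle of the Petersen graph: u and the vertices x₁, x₂ adjacent to it,
      -- closed up by a path of five vertices at distance two from u.
      petersen : ∀ {h} → (∀ x → x ∈ W → x ∈ g h) → W₈ ⊆ complement F
      petersen {h} W⊆gh = from-u (pick {P = W} W-nonempty)
        where
        module _ {u x₁ x₂ x₃} (uW : u ∈ W) (ux₁ : Adjacent u x₁) (ux₂ : Adjacent u x₂) (ux₃ : Adjacent u x₃)
                 (x₁₂ : x₁ ≢ x₂) (x₁₃ : x₁ ≢ x₃) (x₂₃ : x₂ ≢ x₃) where
          record Outer (i v : Fin N) : Set where
            constructor outer
            field
              parent : Adjacent u i
              edge   : Adjacent i v
              proper : u ≢ v
          open Outer

          not-inner : ∀ {i v} → Outer i v → ¬ Adjacent u v
          not-inner o uv = triangle-free uW (parent o) uv (edge o)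

          outer≢inner : ∀ {i v x} → Outer i v → Adjacent u x → x ≢ v
          outer≢inner o ux refl = not-inner o ux

          apart : ∀ {i j v w} → i ≢ j → Outer i v → Outer j w → v ≢ w
          apart ne o o′ refl = proper o (square-free uW (parent o) (parent o′) ne (edge o) (edge o′))

          -- The vertex `v` is not adjacent to `j`, since u, i, v, j would be a four-cycle; diameter
          -- two then supplies `w`.
          step : ∀ {i j v} → i ≢ j → Outer i v → Adjacent u j → ∃[ w ] Outer j w × Adjacent v w
          step {i} {j} {v} ne o uj =
            let w , vw , wj = joint (end∈W (edge o)) (end∈W uj) (outer≢inner o uj ∘ sym)
                                (λ vj → proper o (square-free uW (parent o) uj ne (edge o) (reverse (end∈W (edge o)) vj)))
            in w , outer uj (reverse (end∈W vw) wj)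
                     (λ eq → not-inner o (reverse (end∈W (edge o)) (subst (Adjacent v) (sym eq) vw))) , vw

          child : ∀ {i} → Adjacent u i → ∃[ v ] Outer i v
          child {i} ui = let v , m = third {i} {u} {u} (end∈W ui)
                             iv , r = ∧-true {W v ∧ g i v} m
                         in v , outer ui iv (∉is⇒≢ (proj₁ (∧-true {not (is u v)} r)))

          eight-cycle : W₈ ⊆ complement F
          eight-cycle = build (child ux₁)
            where
            close : ∀ {a b r a′ b′} → Outer x₁ a → Outer x₂ b → Outer x₃ r → Outer x₁ a′ → Outer x₂ b′ →
                    Adjacent a b → Adjacent b r → Adjacent r a′ → Adjacent a′ b′ → W₈ ⊆ complement F
            close {a} {b} {r} {a′} {b′} ao bo ro ao′ bo′ ab br ra′ ab′ =
              wheel h (u ∷ x₁ ∷ a ∷ b ∷ r ∷ a′ ∷ b′ ∷ x₂ ∷ [])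
                ((g⇒≢ (nb ux₁) ∷ proper ao ∷ proper bo ∷ proper ro ∷ proper ao′ ∷ proper bo′ ∷ g⇒≢ (nb ux₂) ∷ []) ∷
                 (outer≢inner ao ux₁ ∷ outer≢inner bo ux₁ ∷ outer≢inner ro ux₁ ∷ outer≢inner ao′ ux₁ ∷ outer≢inner bo′ ux₁ ∷ x₁₂ ∷ []) ∷
                 (apart x₁₂ ao bo ∷ apart x₁₃ ao ro ∷ a≢a′ ∷ apart x₁₂ ao bo′ ∷ outer≢inner ao ux₂ ∘ sym ∷ []) ∷
                 (apart x₂₃ bo ro ∷ apart (x₁₂ ∘ sym) bo ao′ ∷ b≢b′ ∷ outer≢inner bo ux₂ ∘ sym ∷ []) ∷
                 (apart (x₁₃ ∘ sym) ro ao′ ∷ apart (x₂₃ ∘ sym) ro bo′ ∷ outer≢inner ro ux₂ ∘ sym ∷ []) ∷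
                 (apart x₁₂ ao′ bo′ ∷ outer≢inner ao′ ux₂ ∘ sym ∷ []) ∷
                 (outer≢inner bo′ ux₂ ∘ sym ∷ []) ∷ [] ∷ [])
                spoke rim (nb ux₂)
              where
              nb : ∀ {v w} → Adjacent v w → w ∈ g v
              nb {w = w} m = proj₂ (∧-true {W w} m)
              oW : ∀ {i v} → Outer i v → v ∈ W
              oW o = end∈W (edge o)
              -- The path comes back below x₁ and x₂ at new vertices: a repetition would close the
              -- triangle a, b, r or b, r, a′.
              a≢a′ : a ≢ a′
              a≢a′ refl = triangle-free (oW ao) ab (reverse (oW ro) ra′) br
              b≢b′ : b ≢ b′
              b≢b′ refl = triangle-free (oW bo) br (reverse (oW ao′) ab′) ra′
              spoke : ∀ i → lookup (u ∷ x₁ ∷ a ∷ b ∷ r ∷ a′ ∷ b′ ∷ x₂ ∷ []) i ∈ g h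
              spoke 0F = W⊆gh u uW
              spoke 1F = W⊆gh x₁ (end∈W ux₁)
              spoke 2F = W⊆gh a (oW ao)
              spoke 3F = W⊆gh b (oW bo)
              spoke 4F = W⊆gh r (oW ro)
              spoke 5F = W⊆gh a′ (oW ao′)
              spoke 6F = W⊆gh b′ (oW bo′)
              spoke 7F = W⊆gh x₂ (end∈W ux₂)
              rim : ∀ i j → toℕ j ≡ suc (toℕ i) → lookup (u ∷ x₁ ∷ a ∷ b ∷ r ∷ a′ ∷ b′ ∷ x₂ ∷ []) j ∈
                                                  g (lookup (u ∷ x₁ ∷ a ∷ b ∷ r ∷ a′ ∷ b′ ∷ x₂ ∷ []) i)
              rim 0F 1F _ = nb ux₁
              rim 1F 2F _ = nb (edge ao)
              rim 2F 3F _ = nb ab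
              rim 3F 4F _ = nb br
              rim 4F 5F _ = nb ra′
              rim 5F 6F _ = nb ab′
              rim 6F 7F _ = nb (reverse (end∈W ux₂) (edge bo′))
              rim 7F j  e = ⊥-elim (<-irrefl e (toℕ<n j))
            -- The five vertices at distance two lie below x₁, x₂, x₃, x₁, x₂ in turn.
            build : ∃[ a ] Outer x₁ a → W₈ ⊆ complement F
            build (a , ao) =
              let b  , bo  , ab  = step x₁₂ ao ux₂
                  r  , ro  , br  = step x₂₃ bo ux₃
                  a′ , ao′ , ra′ = step (x₁₃ ∘ sym) ro ux₁
                  b′ , bo′ , ab′ = step x₁₂ ao′ ux₂
              in close ao bo ro ao′ bo′ ab br ra′ ab′

        from-u : ∃[ u ] u ∈ W → W₈ ⊆ complement F
        from-u (u , uW) =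
          let x , inj , ux = choose 3 {λ x → W x ∧ g u x} (regular u uW)
          in eight-cycle uW (ux 0F) (ux 1F) (ux 2F) ((λ ()) ∘ inj) ((λ ()) ∘ inj) ((λ ()) ∘ inj)

    low-degree : ∀ {h} → (∀ x → x ∈ W → x ∈ g h) → Sn5 n ⊆ F ⊎ W₈ ⊆ complement F
    low-degree W⊆gh with diameter
    ... | inj₁ s    = inj₁ s
    ... | inj₂ diam = inj₂ (petersen diam W⊆gh)

-- Lower bound.

twoCliques : ℕ → ∀ M → Graph M
twoCliques k M = record
  { adj    = λ i j → not (is i j) ∧ same i j
  ; sym    = λ i j → cong₂ (λ a b → not a ∧ b) (≡ᵇ-sym (toℕ i) (toℕ j)) (same-sym (side i) (side j))
  ; irrefl = λ i → cong (λ a → not a ∧ same i i) (is-refl i)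
  }
  where
  side : Fin M → Bool
  side i = toℕ i <ᵇ k
  same : Fin M → Fin M → Bool
  same i j = not (side i xor side j)
  same-sym : ∀ a b → not (a xor b) ≡ not (b xor a)
  same-sym true  true  = refl
  same-sym true  false = refl
  same-sym false true  = refl
  same-sym false false = refl

module _ {k M : ℕ} where
  private
    side : Fin M → Bool
    side i = toℕ i <ᵇ k

  same-side : ∀ i j → adj (twoCliques k M) i j ≡ true → side i ≡ side j
  same-side i j e = unxor (side i) (side j) (proj₂ (∧-true {not (is i j)} e))
    where
    unxor : ∀ a b → not (a xor b) ≡ true → a ≡ b
    unxor true  true  _ = refl
    unxor false false _ = refl

  other-side : ∀ i j → adj (complement (twoCliques k M)) i j ≡ true → side j ≡ not (side i)
  other-side i j e = xored (is i j) (side i) (side j) e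
    where
    xored : ∀ c a b → not c ∧ not (not c ∧ not (a xor b)) ≡ true → b ≡ not a
    xored false true  false _ = refl
    xored false false true  _ = refl

  -- The hub and two consecutive rim vertices form a triangle, whereas the complement of two cliques
  -- is bipartite.
  no-wheel : ¬ W₈ ⊆ complement (twoCliques k M)
  no-wheel (φ , _ , hom) = not-¬ {side (φ 2F)} refl
    (trans (other-side (φ 1F) (φ 2F) (hom 1F 2F refl)) (cong not (trans (other-side (φ 0F) (φ 1F) (hom 0F 1F refl)) (sym (other-side (φ 0F) (φ 2F) (hom 0F 2F refl))))))

  -- All vertices of the tree lie on the side of the centre 0, and each side
  -- has at most k vertices.
  no-double-star : ∀ m → M ≤ k + k → k < 6 + m → ¬ Sn5 (6 + m) ⊆ twoCliques k M
  no-double-star m M≤2k k<n (φ , inj , hom) = let i , j , i<j , eq = pigeonhole k<n slot in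
    <⇒≢ i<j (cong toℕ (inj (slot-injective i j eq)))
    where
    one-side : ∀ i → side (φ i) ≡ side (φ 0F)
    one-side 0F = refl
    one-side 1F = sym (same-side (φ 0F) (φ 1F) (hom 0F 1F refl))
    one-side 2F = sym (same-side (φ 0F) (φ 2F) (hom 0F 2F refl))
    one-side 3F = sym (same-side (φ 0F) (φ 3F) (hom 0F 3F refl))
    one-side 4F = sym (same-side (φ 0F) (φ 4F) (hom 0F 4F refl))
    one-side 5F = sym (same-side (φ 0F) (φ 5F) (hom 0F 5F refl))
    one-side (suc (suc (suc (suc (suc (suc i)))))) =
      trans (sym (same-side (φ 5F) (φ (suc (suc (suc (suc (suc (suc i))))))) (hom 5F (suc (suc (suc (suc (suc (suc i)))))) refl))) (one-side 5F)
    right : ∀ x → side x ≡ false → toℕ x ∸ k < k × k ≤ toℕ x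
    right x eq = +-cancelˡ-< k _ _ (≤-trans (s≤s (≤-reflexive (m+[n∸m]≡n k≤x))) (≤-trans (toℕ<n x) M≤2k)) , k≤x
      where
      k≤x : k ≤ toℕ x
      k≤x = ≮⇒≥ λ lt → subst T eq (<⇒<ᵇ lt)
    left : ∀ x → side x ≡ true → toℕ x < k
    left x eq = <ᵇ⇒< (toℕ x) k (subst T (sym eq) tt)
    place : ∀ b x → side x ≡ b → Fin k
    place true  x eq = fromℕ< (left x eq)
    place false x eq = fromℕ< (proj₁ (right x eq))
    place-injective : ∀ b x y (p : side x ≡ b) (q : side y ≡ b) → place b x p ≡ place b y q → x ≡ y
    place-injective true  x y p q eq = toℕ-injective (fromℕ<-injective _ _ (left x p) (left y q) eq)
    place-injective false x y p q eq = toℕ-injective (∸-cancelʳ-≡ (proj₂ (right x p)) (proj₂ (right y q))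
      (fromℕ<-injective _ _ (proj₁ (right x p)) (proj₁ (right y q)) eq))
    slot : Fin (6 + m) → Fin k
    slot i = place (side (φ 0F)) (φ i) (one-side i)
    slot-injective : ∀ i j → slot i ≡ slot j → φ i ≡ φ j
    slot-injective i j = place-injective (side (φ 0F)) (φ i) (φ j) (one-side i) (one-side j)

lower-bound : ∀ n → 9 ≤ n → ∀ M → M < 2 * n ∸ 1 → ¬ Arrows M (Sn5 n) W₈
lower-bound (suc k) 9≤n M M<N arrows = refute (arrows (twoCliques k M))
  where
  M≤2k : M ≤ k + k
  M≤2k = ≤-pred (≤-trans M<N (≤-reflexive (trans (cong (k +_) (+-identityʳ (suc k))) (+-suc k k))))
  refute : Sn5 (suc k) ⊆ twoCliques k M ⊎ W₈ ⊆ complement (twoCliques k M) → ⊥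
  refute (inj₁ s) = at-order (m≤n⇒∃[o]m+o≡n {6} (≤-trans (m≤n+m 6 3) 9≤n)) s
    where
    at-order : ∃[ m ] 6 + m ≡ suc k → ¬ Sn5 (suc k) ⊆ twoCliques k M
    at-order (m , refl) = no-double-star m M≤2k ≤-refl
  refute (inj₂ w) = no-wheel {k} {M} w

-- Maximum degree at least n - 5: hubs among the low-degree neighbours of `b`.

module DenseCase {N} (F : Graph N) where
  open Wheels F
  open Stars F
  open EvenSpokes F
  open UnevenSpokes F
  open CubicCase F

  even-wheel : ∀ v {Z R : Fin N → Bool} → 4 ≤ count Z → (∀ x → x ∈ Z → x ∈ g v) → (∀ x → x ∈ R → x ∈ g v) →
               (∀ x → x ∈ Z → x ∉ R) → 8 ≤ count R →
               (∀ p → p ∈ Z → count (λ x → R x ∧ not (g p x)) ≤ 3) → W₈ ⊆ complement F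
  even-wheel v {Z} four Z⊆ R⊆ dis large miss =
    let p , inj , p∈ = choose 4 {Z} four
    in jackson (spokes {p = p} inj (λ i → Z⊆ _ (p∈ i)) (λ i → dis _ (p∈ i)) R⊆) large (λ i → miss _ (p∈ i))

  module _ {n b} (order : suc N ≡ 2 * n) (9≤n : 9 ≤ n) (b-max : ∀ v → count (f v) ≤ count (f b))
           (no-star : ∀ a → a ∈ f b → 5 ≤ count (f a) → count (λ x → f a x ∨ f b x) < n) where
    private
      d : ℕ
      d = count (f b)

      M : Fin N → Bool
      M = g b

      order≥ : 2 * n ≤ 1 + count {N} (λ _ → true)
      order≥ = ≤-reflexive (trans (sym order) (cong suc (sym (count-all N))))

      order≤ : 1 + count {N} (λ _ → true) ≤ 2 * n
      order≤ = ≤-reflexive (trans (cong suc (count-all N)) order)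

      flip : ∀ {u x} → x ∈ f u → u ∈ f x
      flip {u} {x} = trans (f-sym x u)

    -- N(a) ∪ N(b) contains `b` besides N(b), hence at least n vertices, which `no-star` excludes
    -- for degree at least 5.
    low : n ≤ 1 + d → ∀ a → a ∈ f b → count (f a) ≤ 4
    low n≤ a ab = ≮⇒≥ λ high → <⇒≱ (no-star a ab high)
      (prove (f a ∷ f b ∷ is b ∷ []) (n ∷ [])
        (always (∁ C ⋎ A) ∷ always (∁ C ⋎ ∁ B) ∷ (♯ 1 ≼ ∣ C ∣) ∷ (atom 0 ≼ ♯ 1 ⊕ ∣ B ∣) ∷ [])
        (atom 0) (∣ A ⋎ B ∣) (1 ∷ 1 ∷ 1 ∷ []) refl (∈-is {P = f a} (flip ab) , f-irr b , 1≤is b , n≤ , tt))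

    -- Hub and spokes are neighbours of `b` of degree at most 4. One neighbour of each spoke is `b`,
    -- which the hub excludes from the rim, so a spoke misses at most three vertices. From 2n - 1 ≥
    -- 17, removing the hub, its four neighbours and the four spokes leaves eight.
    dense⇒wheel : n ≤ 1 + d → W₈ ⊆ complement F
    dense⇒wheel n≤ = at-neighbour (pick {P = f b} (prove (f b ∷ []) (n ∷ [])
        ((atom 0 ≼ ♯ 1 ⊕ ∣ A ∣) ∷ (♯ 9 ≼ atom 0) ∷ []) (♯ 1) (∣ A ∣) (1 ∷ 1 ∷ 1 ∷ []) refl (n≤ , 9≤n , tt)))
      where
      at-neighbour : ∃[ v ] v ∈ f b → W₈ ⊆ complement F
      at-neighbour (v , bv) = with-set (trim 4 (λ x → f b x ∧ g v x)
          (prove (f b ∷ is b ∷ is v ∷ f v ∷ []) (n ∷ [])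
            (always (∁ B ⋎ ∁ A) ∷ always (∁ B ⋎ D) ∷ (♯ 1 ≼ ∣ B ∣) ∷ (∣ C ∣ ≼ ♯ 1) ∷ (∣ D ∣ ≼ ♯ 4) ∷
             (♯ 9 ≼ atom 0) ∷ (atom 0 ≼ ♯ 1 ⊕ ∣ A ∣) ∷ [])
            (♯ 4) (∣ A ⋏ ∁ C ⋏ ∁ D ∣) (1 ∷ 1 ∷ 1 ∷ 1 ∷ 1 ∷ 1 ∷ []) refl
            (f-irr b , ∈-is {P = f v} (flip bv) , 1≤is b , is≤1 v , low n≤ v bv , 9≤n , n≤ , tt)))
        where
        with-set : Σ[ Z ∈ (Fin N → Bool) ] (∀ x → x ∈ Z → x ∈ (λ x → f b x ∧ g v x)) × count Z ≡ 4 → W₈ ⊆ complement F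
        with-set (Z , sub , c) = even-wheel v {Z} {λ x → g v x ∧ not (Z x)} (≤-reflexive (sym c))
          (λ x m → proj₂ (∧-true {f b x} (sub x m))) (λ x m → proj₁ (∧-true {g v x} m)) outside
          (prove ((λ _ → true) ∷ is v ∷ f v ∷ Z ∷ []) (n ∷ [])
            (always A ∷ (2 ⊗ atom 0 ≼ ♯ 1 ⊕ ∣ A ∣) ∷ (♯ 9 ≼ atom 0) ∷ (∣ B ∣ ≼ ♯ 1) ∷ (∣ C ∣ ≼ ♯ 4) ∷ (∣ D ∣ ≼ ♯ 4) ∷ [])
            (♯ 8) (∣ (∁ B ⋏ ∁ C) ⋏ ∁ D ∣) (1 ∷ 1 ∷ 2 ∷ 1 ∷ 1 ∷ 1 ∷ []) refl
            ((λ _ → refl) , order≥ , 9≤n , is≤1 v , low n≤ v bv , ≤-reflexive c , tt))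
          miss
          where
          outside : ∀ x → x ∈ Z → g v x ∧ not (Z x) ≡ false
          outside x m rewrite m = ∧-zeroʳ (g v x)
          miss : ∀ p → p ∈ Z → count (λ x → (g v x ∧ not (Z x)) ∧ not (g p x)) ≤ 3
          miss p pZ = let bp = proj₁ (∧-true {f b p} (sub p pZ)) in
            prove (is v ∷ f v ∷ Z ∷ is p ∷ f p ∷ is b ∷ []) []
              (always (∁ G ⋎ E) ∷ always (∁ G ⋎ B) ∷ always (∁ D ⋎ C) ∷ (♯ 1 ≼ ∣ G ∣) ∷ (∣ E ∣ ≼ ♯ 4) ∷ [])
              (∣ ((∁ A ⋏ ∁ B) ⋏ ∁ C) ⋏ ∁ (∁ D ⋏ ∁ E) ∣) (♯ 3) (1 ∷ 1 ∷ 1 ∷ []) refl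
              (∈-is {P = f p} (flip bp) , ∈-is {P = f v} (flip bv) , ∈-is {P = Z} pZ , 1≤is b , low n≤ p bp , tt)

    module _ {q} (q≤3 : q ≤ 3) (degree-b : 2 + q + d ≡ n) where
      private
        d≤ : 2 + q + d ≤ n
        d≤ = ≤-reflexive degree-b
        d≥ : n ≤ 2 + q + d
        d≥ = ≤-reflexive (sym degree-b)

      M-size≥ : n + q ≤ count M
      M-size≥ = prove ((λ _ → true) ∷ is b ∷ f b ∷ []) (n ∷ q ∷ [])
        (always A ∷ (2 ⊗ atom 0 ≼ ♯ 1 ⊕ ∣ A ∣) ∷ (∣ B ∣ ≼ ♯ 1) ∷ (♯ 2 ⊕ atom 1 ⊕ ∣ C ∣ ≼ atom 0) ∷ [])
        (atom 0 ⊕ atom 1) (∣ ∁ B ⋏ ∁ C ∣) (1 ∷ 1 ∷ 1 ∷ 1 ∷ []) refl ((λ _ → refl) , order≥ , is≤1 b , d≤ , tt)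

      M-size≤ : count M ≤ n + q
      M-size≤ = prove ((λ _ → true) ∷ is b ∷ f b ∷ []) (n ∷ q ∷ [])
        (always A ∷ always (∁ B ⋎ ∁ C) ∷ (♯ 1 ⊕ ∣ A ∣ ≼ 2 ⊗ atom 0) ∷ (♯ 1 ≼ ∣ B ∣) ∷ (atom 0 ≼ ♯ 2 ⊕ atom 1 ⊕ ∣ C ∣) ∷ [])
        (∣ ∁ B ⋏ ∁ C ∣) (atom 0 ⊕ atom 1) (1 ∷ 1 ∷ 1 ∷ 1 ∷ []) refl ((λ _ → refl) , f-irr b , order≤ , 1≤is b , d≥ , tt)

      -- N(a) ∪ N(b) has at most n - 1 vertices, and `b` with N(b) already accounts for d + 1 = n -
      -- 1 - q of them.
      high-few : ∀ a → a ∈ f b → 5 ≤ count (f a) → count (λ x → M x ∧ f a x) ≤ q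
      high-few a ab high = prove (f a ∷ f b ∷ is b ∷ []) (n ∷ q ∷ [])
        (always (∁ C ⋎ A) ∷ always (∁ C ⋎ ∁ B) ∷ (♯ 1 ≼ ∣ C ∣) ∷ (atom 0 ≼ ♯ 2 ⊕ atom 1 ⊕ ∣ B ∣) ∷ (♯ 1 ⊕ ∣ A ⋎ B ∣ ≼ atom 0) ∷ [])
        (∣ (∁ C ⋏ ∁ B) ⋏ A ∣) (atom 1) (1 ∷ 1 ∷ 1 ∷ 1 ∷ []) refl (∈-is {P = f a} (flip ab) , f-irr b , 1≤is b , d≥ , no-star a ab high , tt)

      -- One of the at most four neighbours is `b`, which lies in neither set.
      low-few : ∀ a → a ∈ f b → count (f a) ≤ 4 → count (λ x → f b x ∧ f a x) + count (λ x → M x ∧ f a x) ≤ 3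
      low-few a ab low = prove (f a ∷ f b ∷ is b ∷ []) []
        (always (∁ C ⋎ A) ∷ always (∁ C ⋎ ∁ B) ∷ (♯ 1 ≼ ∣ C ∣) ∷ (∣ A ∣ ≼ ♯ 4) ∷ [])
        (∣ B ⋏ A ∣ ⊕ ∣ (∁ C ⋏ ∁ B) ⋏ A ∣) (♯ 3) (1 ∷ 1 ∷ 1 ∷ []) refl (∈-is {P = f a} (flip ab) , f-irr b , 1≤is b , low , tt)

      -- A neighbour v of b of degree at most 4 with more than q neighbours in M is the
      -- hub: four further neighbours of b alternate with M ∩ g v, topped up to eight
      -- vertices by a set E of neighbours of b.
      low-hub : ∀ v → v ∈ f b → q < count (λ x → M x ∧ f v x) → W₈ ⊆ complement F
      low-hub v bv q< = with-sets (trim 4 Γ (m+n≤o⇒m≤o 4 pool))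
        where
        Y Γ : Fin N → Bool
        Y x = M x ∧ g v x
        Γ x = f b x ∧ g v x

        v-low : count (f v) ≤ 4
        v-low = ≮⇒≥ λ high → <⇒≱ q< (high-few v bv high)

        q≤2 : 1 + q ≤ 3
        q≤2 = ≤-trans q< (m+n≤o⇒n≤o (count (λ x → f b x ∧ f v x)) (low-few v bv v-low))

        Y-size : 6 + q ≤ count Y
        Y-size = prove (M ∷ f v ∷ is v ∷ f b ∷ []) (n ∷ q ∷ [])
          (always (∁ C ⋎ D) ∷ always (∁ D ⋎ ∁ A) ∷ (atom 0 ⊕ atom 1 ≼ ∣ A ∣) ∷ (♯ 9 ≼ atom 0) ∷
           (∣ D ⋏ B ∣ ⊕ ∣ A ⋏ B ∣ ≼ ♯ 3) ∷ [])
          (♯ 6 ⊕ atom 1) (∣ A ⋏ ∁ C ⋏ ∁ B ∣) (1 ∷ 1 ∷ 1 ∷ 1 ∷ []) refl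
          (∈-is {P = f b} bv , f∩g , M-size≥ , 9≤n , low-few v bv v-low , tt)
          where
          f∩g : ∀ x → not (f b x) ∨ not (M x) ≡ true
          f∩g x with f b x
          ... | true  = cong not (∧-zeroʳ (not (is b x)))
          ... | false = refl

        pool : 4 + (8 ∸ count Y) ≤ count Γ
        pool = by-size (≤-total 8 (count Y))
          where
          -- There are 2n - 2 ≥ 16 vertices other than `b`; only `v` and at most three of its
          -- neighbours are lost.
          room : 12 ≤ count Y + count Γ
          room = prove (is b ∷ f b ∷ is v ∷ f v ∷ []) (n ∷ q ∷ [])
            (always (∁ C ⋎ B) ∷ always (∁ C ⋎ ∁ D) ∷ always (∁ A ⋎ ∁ B) ∷ (∣ C ∣ ≼ ♯ 1) ∷
             (atom 0 ⊕ atom 1 ≼ ∣ ∁ A ⋏ ∁ B ∣) ∷ (atom 0 ≼ ♯ 2 ⊕ atom 1 ⊕ ∣ B ∣) ∷ (♯ 9 ≼ atom 0) ∷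
             (∣ B ⋏ D ∣ ⊕ ∣ (∁ A ⋏ ∁ B) ⋏ D ∣ ≼ ♯ 3) ∷ [])
            (♯ 12) (∣ (∁ A ⋏ ∁ B) ⋏ ∁ C ⋏ ∁ D ∣ ⊕ ∣ B ⋏ ∁ C ⋏ ∁ D ∣) (1 ∷ 1 ∷ 1 ∷ 1 ∷ 2 ∷ 1 ∷ []) refl
            (∈-is {P = f b} bv , f-irr v , f-irr b , is≤1 v , M-size≥ , d≥ , 9≤n , low-few v bv v-low , tt)
          Γ-size : 4 ≤ count Γ
          Γ-size = prove (is b ∷ f b ∷ is v ∷ f v ∷ []) (n ∷ q ∷ [])
            (always (∁ C ⋎ B) ∷ (∣ C ∣ ≼ ♯ 1) ∷ (♯ 1 ⊕ atom 1 ≼ ♯ 3) ∷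
             (atom 0 ≼ ♯ 2 ⊕ atom 1 ⊕ ∣ B ∣) ∷ (♯ 9 ≼ atom 0) ∷ (♯ 1 ⊕ atom 1 ≼ ∣ (∁ A ⋏ ∁ B) ⋏ D ∣) ∷
             (∣ B ⋏ D ∣ ⊕ ∣ (∁ A ⋏ ∁ B) ⋏ D ∣ ≼ ♯ 3) ∷ [])
            (♯ 4) (∣ B ⋏ ∁ C ⋏ ∁ D ∣) (1 ∷ 1 ∷ 0 ∷ 1 ∷ 1 ∷ 1 ∷ 1 ∷ []) refl
            (∈-is {P = f b} bv , is≤1 v , q≤2 , d≥ , 9≤n , q< , low-few v bv v-low , tt)
          by-size : 8 ≤ count Y ⊎ count Y ≤ 8 → 4 + (8 ∸ count Y) ≤ count Γ
          by-size (inj₁ le) rewrite m≤n⇒m∸n≡0 le = Γ-size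
          by-size (inj₂ ge) = prove {0} [] (count Y ∷ 8 ∸ count Y ∷ count Γ ∷ [])
            ((♯ 12 ≼ atom 0 ⊕ atom 2) ∷ (atom 0 ⊕ atom 1 ≼ ♯ 8) ∷ []) (♯ 4 ⊕ atom 1) (atom 2) (1 ∷ 1 ∷ 1 ∷ []) refl
            (room , ≤-reflexive (m+[n∸m]≡n ge) , tt)

        with-sets : Σ[ Z ∈ (Fin N → Bool) ] (∀ x → x ∈ Z → x ∈ Γ) × count Z ≡ 4 → W₈ ⊆ complement F
        with-sets (Z , Z⊆Γ , Z-size) = with-E (trim (8 ∸ count Y) (λ x → Γ x ∧ not (Z x))
            (prove (Γ ∷ Z ∷ []) (8 ∸ count Y ∷ []) ((∣ B ∣ ≼ ♯ 4) ∷ (♯ 4 ⊕ atom 0 ≼ ∣ A ∣) ∷ [])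
              (atom 0) (∣ A ⋏ ∁ B ∣) (1 ∷ 1 ∷ 1 ∷ []) refl (≤-reflexive Z-size , pool , tt)))
          where
          with-E : Σ[ E ∈ (Fin N → Bool) ] (∀ x → x ∈ E → x ∈ (λ x → Γ x ∧ not (Z x))) × count E ≡ 8 ∸ count Y → W₈ ⊆ complement F
          with-E (E₀ , E⊆ , E-size) = even-wheel v {Z} {R} (≤-reflexive (sym Z-size))
            (λ x m → proj₂ (∧-true {f b x} (Z⊆Γ x m))) R⊆ Z∉R R-size miss
            where
            R : Fin N → Bool
            R x = Y x ∨ E₀ x

            E⇒b : ∀ x → not (E₀ x) ∨ f b x ≡ true
            E⇒b = ⊆⇒always {P = E₀} {f b} λ x m → proj₁ (∧-true {f b x} (proj₁ (∧-true {Γ x} (E⊆ x m))))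

            R⊆ : ∀ x → x ∈ R → x ∈ g v
            R⊆ x m with ∈-or-∉ E₀ x
            ... | inj₁ h = proj₂ (∧-true {f b x} (proj₁ (∧-true {Γ x} (E⊆ x h))))
            ... | inj₂ h rewrite h = proj₂ (∧-true {M x} (trans (sym (∨-identityʳ (Y x))) m))

            Z∉R : ∀ x → x ∈ Z → x ∉ R
            Z∉R x m with ∈-or-∉ E₀ x
            ... | inj₁ h = ⊥-elim (true≢false m (not-∉ (proj₂ (∧-true {Γ x} (E⊆ x h)))))
            ... | inj₂ h rewrite h | proj₁ (∧-true {f b x} (Z⊆Γ x m)) | ∧-zeroʳ (not (is b x)) = refl

            R-size : 8 ≤ count R
            R-size = prove (is b ∷ f b ∷ g v ∷ E₀ ∷ []) (8 ∸ count Y ∷ [])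
              (always (∁ D ⋎ B) ∷ (atom 0 ≼ ∣ D ∣) ∷ (♯ 8 ≼ ∣ (∁ A ⋏ ∁ B) ⋏ C ∣ ⊕ atom 0) ∷ [])
              (♯ 8) (∣ (∁ A ⋏ ∁ B) ⋏ C ⋎ D ∣) (1 ∷ 1 ∷ 1 ∷ []) refl
              (E⇒b , ≤-reflexive (sym E-size) , m≤n+m∸n 8 (count Y) , tt)

            -- With at least 6 + q vertices in `Y`, at most 2 - q have to be added. This pays for
            -- the spokes of high degree, which miss at most q vertices of `M` but possibly all of
            -- `E₀`.
            E-small : count E₀ + q ≤ 2 ⊎ count E₀ ≤ 0
            E-small with ≤-total 8 (count Y)
            ... | inj₁ le = inj₂ (≤-reflexive (trans E-size (m≤n⇒m∸n≡0 le)))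
            ... | inj₂ ge = inj₁ (prove {0} [] (count E₀ ∷ q ∷ count Y ∷ 8 ∸ count Y ∷ [])
              ((atom 0 ≼ atom 3) ∷ (atom 2 ⊕ atom 3 ≼ ♯ 8) ∷ (♯ 6 ⊕ atom 1 ≼ atom 2) ∷ [])
              (atom 0 ⊕ atom 1) (♯ 2) (1 ∷ 1 ∷ 1 ∷ 1 ∷ []) refl
              (≤-reflexive E-size , ≤-reflexive (m+[n∸m]≡n ge) , Y-size , tt))

            few : count E₀ + q ≤ 2 ⊎ count E₀ ≤ 0 → count E₀ + q ≤ 3
            few (inj₁ le) = ≤-trans le (n≤1+n 2)
            few (inj₂ le) = ≤-trans (+-monoˡ-≤ q le) q≤3

            miss : ∀ p → p ∈ Z → count (λ x → R x ∧ not (g p x)) ≤ 3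
            miss p pZ = by-degree (≤-<-connex (count (f p)) 4)
              where
              bp : p ∈ f b
              bp = proj₁ (∧-true {f b p} (Z⊆Γ p pZ))
              by-degree : count (f p) ≤ 4 ⊎ 4 < count (f p) → count (λ x → R x ∧ not (g p x)) ≤ 3
              by-degree (inj₁ p-low) = prove (R ∷ is p ∷ f p ∷ f b ∷ M ∷ []) []
                (always (∁ B ⋎ ∁ A) ∷ always (∁ A ⋎ (E ⋎ D)) ∷ (∣ D ⋏ C ∣ ⊕ ∣ E ⋏ C ∣ ≼ ♯ 3) ∷ [])
                (∣ A ⋏ ∁ (∁ B ⋏ ∁ C) ∣) (♯ 3) (1 ∷ 1 ∷ []) refl
                (∉-is {P = R} (Z∉R p pZ) , R⊆Mb , low-few p bp p-low , tt)
                where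
                R⊆Mb : ∀ x → not (R x) ∨ (M x ∨ f b x) ≡ true
                R⊆Mb = ⊆⇒always {P = R} {λ x → M x ∨ f b x} λ x m → split x m (∈-or-∉ E₀ x)
                  where
                  split : ∀ x → x ∈ R → x ∈ E₀ ⊎ x ∉ E₀ → M x ∨ f b x ≡ true
                  split x m (inj₁ h) rewrite proj₁ (∧-true {f b x} (proj₁ (∧-true {Γ x} (E⊆ x h)))) = ∨-zeroʳ _
                  split x m (inj₂ h) rewrite h | proj₁ (∧-true {M x} (trans (sym (∨-identityʳ (Y x))) m)) = refl
              by-degree (inj₂ high) = prove (M ∷ g v ∷ E₀ ∷ is p ∷ f p ∷ []) (q ∷ [])
                (always (∁ D ⋎ ∁ (A ⋏ B ⋎ C)) ∷ (∣ A ⋏ E ∣ ≼ atom 0) ∷ (∣ C ∣ ⊕ atom 0 ≼ ♯ 3) ∷ [])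
                (∣ (A ⋏ B ⋎ C) ⋏ ∁ (∁ D ⋏ ∁ E) ∣) (♯ 3) (1 ∷ 1 ∷ 1 ∷ []) refl
                (∉-is {P = R} (Z∉R p pZ) , high-few p bp high , few E-small , tt)

triple-injective : ∀ {A : Set} {a b c : A} → a ≢ b → a ≢ c → b ≢ c → Injective _≡_ _≡_ (cons a (cons b (cons c λ ())))
triple-injective ab ac bc =
  cons-injective {m = 2} (λ { 0F → ab ; 1F → ac })
  (cons-injective {m = 1} (λ { 0F → bc })
  (cons-injective {m = 0} (λ ()) λ { {()} }))

-- Maximum degree from n - 5 to n - 2: hubs in M when every neighbour of `b` has at most q
-- neighbours there.

module MiddleCase {N} (F : Graph N) where
  open Wheels F
  open Stars F
  open UnevenSpokes F
  open CubicCase F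

  module _ {n q b} (9≤n : 9 ≤ n) (q≤3 : q ≤ 3) (b-max : ∀ v → count (f v) ≤ count (f b))
           (degree-b : 2 + q + count (f b) ≡ n) (M-size≥ : n + q ≤ count (g b)) (M-size≤ : count (g b) ≤ n + q)
           (few : ∀ a → a ∈ f b → count (λ x → g b x ∧ f a x) ≤ q) where
    private
      d : ℕ
      d = count (f b)

      M : Fin N → Bool
      M = g b

      d≥ : n ≤ 2 + q + d
      d≥ = ≤-reflexive (sym degree-b)
      d≤ : 2 + q + d ≤ n
      d≤ = ≤-reflexive degree-b

      Γ : Fin N → Fin N → Bool
      Γ x a = f b a ∧ g x a

      m : Fin N → ℕ
      m x = count (λ a → f b a ∧ f x a)

    f⇒∉M : ∀ {a} → a ∈ f b → a ∉ M
    f⇒∉M {a} h rewrite h = ∧-zeroʳ (not (is b a))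

    M⇒∉f : ∀ {x} → x ∈ M → x ∉ f b
    M⇒∉f {x} h with ∈-or-∉ (f b) x
    ... | inj₁ k = ⊥-elim (true≢false h (f⇒∉M k))
    ... | inj₂ k = k

    -- By maximality of `d`, at most d - m x of the neighbours of `x` lie in `M`, which has n + q
    -- vertices.
    neighbour-degree : ∀ x → x ∈ M → 1 + 2 * q + m x ≤ count (λ y → M y ∧ g x y)
    neighbour-degree x xM = prove (is b ∷ f b ∷ is x ∷ f x ∷ []) (n ∷ q ∷ [])
      (always (∁ C ⋎ (∁ A ⋏ ∁ B)) ∷ always (∁ A ⋎ ∁ D) ∷ (∣ C ∣ ≼ ♯ 1) ∷ (∣ D ∣ ≼ ∣ B ∣) ∷
       (atom 0 ⊕ atom 1 ≼ ∣ ∁ A ⋏ ∁ B ∣) ∷ (♯ 2 ⊕ atom 1 ⊕ ∣ B ∣ ≼ atom 0) ∷ [])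
      (♯ 1 ⊕ 2 ⊗ atom 1 ⊕ ∣ B ⋏ D ∣) (∣ (∁ A ⋏ ∁ B) ⋏ ∁ C ⋏ ∁ D ∣) (1 ∷ 1 ∷ 1 ∷ 1 ∷ 1 ∷ []) refl
      (∈-is {P = M} xM , ∉-is {P = f x} b∉fx , is≤1 x , b-max x , M-size≥ , d≤ , tt)
      where
      b∉fx : b ∉ f x
      b∉fx = trans (f-sym x b) (M⇒∉f xM)

    Γ-size : ∀ x → x ∈ M → d ≤ count (Γ x) + m x
    Γ-size x xM = prove (f b ∷ is x ∷ f x ∷ []) [] (always (∁ B ⋎ ∁ A) ∷ [])
      (∣ A ∣) (∣ A ⋏ ∁ B ⋏ ∁ C ∣ ⊕ ∣ A ⋏ C ∣) (1 ∷ []) refl (∉-is {P = f b} (M⇒∉f xM) , tt)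

    sum-m : ∀ k → (∀ x → x ∈ M → k ≤ m x) → k * count M ≤ q * d
    sum-m k le = begin
      k * count M                                       ≤⟨ ≤-sumOver le ⟩
      sumOver M m                                       ≡⟨ double-count M (f b) f f f-sym ⟩
      sumOver (f b) (λ a → count (λ x → M x ∧ f a x))   ≤⟨ sumOver-≤ few ⟩
      q * d                                             ∎
      where open ≤-Reasoning

    missed : ∀ {Y} → (∀ x → x ∈ Y → x ∈ M) → ∀ a → a ∈ f b → count (λ x → Y x ∧ not (g a x)) ≤ count (λ x → Y x ∧ f a x)
    missed {Y} Y⊆M a ab = prove (Y ∷ is a ∷ f a ∷ M ∷ []) [] (always (∁ A ⋎ D) ∷ always (∁ B ⋎ ∁ D) ∷ [])
      (∣ A ⋏ ∁ (∁ B ⋏ ∁ C) ∣) (∣ A ⋏ C ∣) (1 ∷ []) refl (⊆⇒always {P = Y} {M} Y⊆M , ∉-is {P = M} (f⇒∉M ab) , tt)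

    missed≤q : ∀ {Y} → (∀ x → x ∈ Y → x ∈ M) → ∀ a → a ∈ f b → count (λ x → Y x ∧ not (g a x)) ≤ q
    missed≤q {Y} Y⊆M a ab = ≤-trans (missed Y⊆M a ab)
      (≤-trans (count-mono {P = λ x → Y x ∧ f a x} {λ x → M x ∧ f a x}
        λ x h → let y , fa = ∧-true {Y x} h in ∧-∈ (Y⊆M x y) fa) (few a ab))

    untouched : ∀ {Y a x} → (∀ x → x ∈ Y → x ∈ M) → a ∈ f b → count (λ x → Y x ∧ f a x) ≤ 0 → x ∈ Y → x ∈ g a
    untouched {Y} {a} {x} Y⊆M ab none xY with ∈-or-∉ (g a) x
    ... | inj₁ h = h
    ... | inj₂ h = ⊥-elim (<⇒≱ (∈⇒1≤ {P = λ x → Y x ∧ not (g a x)} {x} (∧-∈ xY (not-∈ h))) (≤-trans (missed Y⊆M a ab) none))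

    -- The hub is a vertex of `M`, and `b` serves as the spoke that misses nothing, since `Y` lies
    -- in its complement neighbourhood `M`.
    frame : ∀ {x Y c} → x ∈ M → (∀ y → y ∈ Y → y ∈ (λ y → M y ∧ g x y)) → Injective _≡_ _≡_ c →
            (∀ i → c i ∈ Γ x) → Spokes x Y (cons b c)
    frame {x} {Y} {c} xM Y⊆ inj c∈ = spokes
      (cons-injective (λ i → f⇒≢ (proj₁ (∧-true (c∈ i)))) inj)
      (λ { zero → trans (g-sym x b) xM ; (suc i) → proj₂ (∧-true {f b (c i)} (c∈ i)) })
      (λ { zero → b∉Y ; (suc i) → outside (f⇒∉M (proj₁ (∧-true (c∈ i)))) })
      (λ y h → proj₂ (∧-true {M y} (Y⊆ y h)))
      where
      outside : ∀ {y} → y ∉ M → y ∉ Y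
      outside {y} h with ∈-or-∉ Y y
      ... | inj₁ k = ⊥-elim (true≢false (proj₁ (∧-true (Y⊆ y k))) h)
      ... | inj₂ k = k
      b∉Y : b ∉ Y
      b∉Y = outside (g-irr b)

    from-three : ∀ {x Y} e → x ∈ M → (∀ y → y ∈ Y → y ∈ (λ y → M y ∧ g x y)) → 3 ≤ count (Γ x) →
                 (∀ a → a ∈ f b → count (λ y → Y y ∧ not (g a y)) ≤ e) →
                 4 + e ≤ count Y → 1 + 2 * e ≤ count Y → 4 + 3 * e ≤ 2 * count Y → W₈ ⊆ complement F
    from-three {x} {Y} e xM Y⊆ three miss c₁ c₂ c₃ =
      let c , inj , c∈ = choose 3 {Γ x} three
      in spread (frame xM Y⊆ inj c∈) (λ y h → proj₁ (∧-true {M y} (Y⊆ y h))) e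
           (λ i → miss (c i) (proj₁ (∧-true (c∈ i)))) c₁ c₂ c₃

    M-nonempty : 1 ≤ count M
    M-nonempty = ≤-trans (≤-trans (≤-trans (s≤s z≤n) 9≤n) (m≤m+n n q)) M-size≥

    4≤d : 4 ≤ d
    4≤d = prove {0} [] (n ∷ q ∷ d ∷ []) ((♯ 9 ≼ atom 0) ∷ (atom 1 ≼ ♯ 3) ∷ (atom 0 ≼ ♯ 2 ⊕ atom 1 ⊕ atom 2) ∷ [])
      (♯ 4) (atom 2) (1 ∷ 1 ∷ 1 ∷ 1 ∷ []) refl (9≤n , q≤3 , d≥ , tt)

    -- No spoke misses anything in `W`, so four complement neighbours in `W` make a vertex a hub. If
    -- no vertex has four, `low-degree` applies with any neighbour of `b` as hub.
    fully-joined : ∀ {W} → (∀ x → x ∈ W → x ∈ M) → count W ≡ n → (∀ a x → a ∈ f b → x ∈ W → x ∈ g a) →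
                   Sn5 n ⊆ F ⊎ W₈ ⊆ complement F
    fully-joined {W} W⊆M size joined = decide (any? λ x → (W x ≟ᵇ true) ×-dec (4 ≤? count (λ y → W y ∧ g x y)))
      where
      decide : Dec (∃[ x ] (x ∈ W × 4 ≤ count (λ y → W y ∧ g x y))) → Sn5 n ⊆ F ⊎ W₈ ⊆ complement F
      decide (yes (x , xW , four)) = inj₂ (from-three {x} {λ y → W y ∧ g x y} 0 (W⊆M x xW)
        (λ y h → let yW , xy = ∧-true {W y} h in ∧-∈ (W⊆M y yW) xy)
        (≤-trans (≤-trans (n≤1+n 3) 4≤d) (count-mono {P = f b} {Γ x} λ a ab → ∧-∈ ab (trans (g-sym x a) (joined a x ab xW))))
        (λ a ab → ≤-trans (count-mono {P = λ y → (W y ∧ g x y) ∧ not (g a y)} {λ _ → false}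
          λ y h → let wg , na = ∧-true {W y ∧ g x y} h in
            ⊥-elim (true≢false (joined a y ab (proj₁ (∧-true {W y} wg))) (not-∉ na))) (≤-reflexive (sumF-0 N)))
        four (≤-trans (s≤s z≤n) four) (*-monoʳ-≤ 2 (≤-trans (s≤s (s≤s z≤n)) four)))
      decide (no none) =
        let a , ab = pick {P = f b} (≤-trans (s≤s z≤n) 4≤d)
        in low-degree 9≤n size (λ x xW → ≮⇒≥ λ four → none (x , xW , four)) {h = a} (λ x → joined a x ab)

    Γ-three : ∀ {x} → x ∈ M → 3 + m x ≤ d → 3 ≤ count (Γ x)
    Γ-three {x} xM le = prove {0} [] (d ∷ m x ∷ count (Γ x) ∷ [])
      ((atom 0 ≼ atom 2 ⊕ atom 1) ∷ (♯ 3 ⊕ atom 1 ≼ atom 0) ∷ []) (♯ 3) (atom 2) (1 ∷ 1 ∷ 1 ∷ []) refl (Γ-size x xM , le , tt)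

    q≡0⇒ : q ≡ 0 → Sn5 n ⊆ F ⊎ W₈ ⊆ complement F
    q≡0⇒ refl = fully-joined (λ x h → h)
      (≤-antisym (≤-trans M-size≤ (≤-reflexive (+-identityʳ n))) (≤-trans (≤-reflexive (sym (+-identityʳ n))) M-size≥))
      (λ a x ab xM → untouched {M} (λ _ h → h) ab (few a ab) xM)

    -- Seven complement neighbours in `M` just meet the bounds of `spread` for e = 3. Averaging m
    -- over `M` is needed only to find three spokes.
    q≡3⇒ : q ≡ 3 → W₈ ⊆ complement F
    q≡3⇒ refl = at-minimum (minimal {P = M} m M-nonempty)
      where
      at-minimum : ∃[ x ] x ∈ M × (∀ y → y ∈ M → m x ≤ m y) → W₈ ⊆ complement F
      at-minimum (x , xM , x-min) = from-three {x} 3 xM (λ y h → h) (Γ-three xM (by-m (2 ≤? m x)))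
        (missed≤q λ y h → proj₁ (∧-true h)) seven seven (≤-trans (n≤1+n 13) (*-monoʳ-≤ 2 seven))
        where
        seven : 7 ≤ count (λ y → M y ∧ g x y)
        seven = ≤-trans (m≤m+n 7 (m x)) (neighbour-degree x xM)
        average : ∀ k → k ≤ m x → k * count M ≤ 3 * d
        average k le = sum-m k λ y yM → ≤-trans le (x-min y yM)
        m≤2 : m x ≤ 2
        m≤2 = ≮⇒≥ λ lt → <⇒≱ (prove {0} [] (n ∷ d ∷ count M ∷ [])
          ((atom 0 ⊕ ♯ 3 ≼ atom 2) ∷ (♯ 5 ⊕ atom 1 ≼ atom 0) ∷ []) (♯ 1 ⊕ 3 ⊗ atom 1) (3 ⊗ atom 2) (1 ∷ 3 ∷ 3 ∷ []) refl
          (M-size≥ , d≤ , tt)) (average 3 lt)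
        by-m : Dec (2 ≤ m x) → 3 + m x ≤ d
        -- If m is at least 2 throughout `M`, then 2(n + 3) ≤ 3(n - 5), so `d` is at least 16.
        by-m (yes 2≤m) = prove {0} [] (n ∷ d ∷ count M ∷ m x ∷ [])
          ((atom 0 ⊕ ♯ 3 ≼ atom 2) ∷ (♯ 5 ⊕ atom 1 ≼ atom 0) ∷ (atom 0 ≼ ♯ 5 ⊕ atom 1) ∷ (2 ⊗ atom 2 ≼ 3 ⊗ atom 1) ∷ (atom 3 ≼ ♯ 2) ∷ [])
          (♯ 3 ⊕ atom 3) (atom 1) (1 ∷ 2 ∷ 2 ∷ 0 ∷ 1 ∷ 1 ∷ []) refl (M-size≥ , d≤ , d≥ , average 2 2≤m , m≤2 , tt)
        by-m (no m<2) = ≤-trans (+-monoʳ-≤ 3 (≤-pred (≰⇒> m<2))) 4≤d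

    q≡2⇒ : q ≡ 2 → Sn5 n ⊆ F ⊎ W₈ ⊆ complement F
    q≡2⇒ refl = at-minimum (minimal {P = M} m M-nonempty)
      where
      at-minimum : ∃[ x ] x ∈ M × (∀ y → y ∈ M → m x ≤ m y) → Sn5 n ⊆ F ⊎ W₈ ⊆ complement F
      at-minimum (x , xM , x-min) = by-m (1 ≤? m x)
        where
        Y : Fin N → Bool
        Y y = M y ∧ g x y
        Y⊆M : ∀ y → y ∈ Y → y ∈ M
        Y⊆M y h = proj₁ (∧-true {M y} h)
        m≤1 : m x ≤ 1
        m≤1 = ≮⇒≥ λ lt → <⇒≱ (prove {0} [] (n ∷ d ∷ count M ∷ [])
          ((atom 0 ⊕ ♯ 2 ≼ atom 2) ∷ (♯ 4 ⊕ atom 1 ≼ atom 0) ∷ []) (♯ 1 ⊕ 2 ⊗ atom 1) (2 ⊗ atom 2) (1 ∷ 2 ∷ 2 ∷ []) refl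
          (M-size≥ , d≤ , tt)) (sum-m 2 λ y yM → ≤-trans lt (x-min y yM))
        by-m : Dec (1 ≤ m x) → Sn5 n ⊆ F ⊎ W₈ ⊆ complement F
        by-m (yes 1≤m) = inj₂ (from-three {x} 2 xM (λ y h → h) (Γ-three xM (≤-trans (+-monoʳ-≤ 3 m≤1) 4≤d))
          (missed≤q Y⊆M) six (≤-trans (n≤1+n 5) six) (≤-trans (m≤m+n 10 2) (*-monoʳ-≤ 2 six)))
          where
          six : 6 ≤ count Y
          six = ≤-trans (+-monoʳ-≤ 5 1≤m) (neighbour-degree x xM)
        by-m (no m≡0) = at-first (pick {P = Γ x} (≤-trans (s≤s z≤n) Γ≥4))
          where
          -- One short of what `spread` asks for e = 2, hence the search below for two spokes
          -- satisfying the union condition of `spread₂`.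
          five : 5 ≤ count Y
          five = ≤-trans (m≤m+n 5 (m x)) (neighbour-degree x xM)
          Γ≥4 : 4 ≤ count (Γ x)
          Γ≥4 = prove {0} [] (d ∷ m x ∷ count (Γ x) ∷ []) ((atom 0 ≼ atom 2 ⊕ atom 1) ∷ (♯ 4 ≼ atom 0) ∷ (atom 1 ≼ ♯ 0) ∷ [])
            (♯ 4) (atom 2) (1 ∷ 1 ∷ 1 ∷ 1 ∷ []) refl (Γ-size x xM , 4≤d , ≤-pred (≰⇒> m≡0) , tt)
          f⊆Γ : ∀ a → a ∈ f b → a ∈ Γ x
          f⊆Γ a ab with ∈-or-∉ (f x) a
          ... | inj₁ h = ⊥-elim (m≡0 (∈⇒1≤ {P = λ a → f b a ∧ f x a} {a} (∧-∈ ab h)))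
          ... | inj₂ h = ∧-∈ ab (∧-∈ (not-∈ (≢⇒∉is {u = x} {a} λ eq → true≢false ab (subst (_∉ f b) eq (M⇒∉f xM)))) (not-∈ h))
          at-first : ∃[ a₁ ] a₁ ∈ Γ x → Sn5 n ⊆ F ⊎ W₈ ⊆ complement F
          at-first (a₁ , a₁∈) = decide (any? λ a → (Γ x a ≟ᵇ true) ×-dec ¬? (a₁ ≟ᶠ a) ×-dec
              (4 + count (λ y → Y y ∧ not (g a₁ y) ∧ not (g a y)) ≤? count Y))
            where
            a₁b : a₁ ∈ f b
            a₁b = proj₁ (∧-true {f b a₁} a₁∈)
            W : Fin N → Bool
            W y = M y ∧ g a₁ y
            decide : Dec (∃[ a ] (a ∈ Γ x × a₁ ≢ a × 4 + count (λ y → Y y ∧ not (g a₁ y) ∧ not (g a y)) ≤ count Y)) →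
                     Sn5 n ⊆ F ⊎ W₈ ⊆ complement F
            decide (yes (a , a∈ , ne , u)) = inj₂ (with-third (pick {P = λ c → Γ x c ∧ not (is a₁ c) ∧ not (is a c)}
                (prove (Γ x ∷ is a₁ ∷ is a ∷ []) [] ((♯ 4 ≼ ∣ A ∣) ∷ (∣ B ∣ ≼ ♯ 1) ∷ (∣ C ∣ ≼ ♯ 1) ∷ [])
                  (♯ 1) (∣ A ⋏ ∁ B ⋏ ∁ C ∣) (1 ∷ 1 ∷ 1 ∷ 1 ∷ []) refl (Γ≥4 , is≤1 a₁ , is≤1 a , tt))))
              where
              with-third : ∃[ c ] c ∈ (λ c → Γ x c ∧ not (is a₁ c) ∧ not (is a c)) → W₈ ⊆ complement F
              with-third (c , h) =
                let c∈ , r   = ∧-true {Γ x c} h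
                    a₁c , ac = ∧-true {not (is a₁ c)} r
                    all∈ : ∀ i → cons a₁ (cons a (cons c λ ())) i ∈ Γ x
                    all∈ = λ { 0F → a₁∈ ; 1F → a∈ ; 2F → c∈ }
                in spread₂ (frame xM (λ y h → h) (triple-injective ne (∉is⇒≢ a₁c) (∉is⇒≢ ac)) all∈)
                     Y⊆M (λ i → missed≤q Y⊆M _ (proj₁ (∧-true (all∈ i)))) five u
            decide (no none) = fully-joined {W} (λ y h → proj₁ (∧-true {M y} h)) (≤-antisym W≤n n≤W) joined
              where
              -- The union condition fails for a₁ and `a`. As each has at most two neighbours in
              -- `M`, all of N(b) has the same two there, and deleting them yields `W`.
              shared : ∀ a → a ∈ f b → a₁ ≢ a → 2 ≤ count (λ y → M y ∧ f a₁ y ∧ f a y)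
              shared a ab ne = prove (M ∷ is a₁ ∷ f a₁ ∷ is a ∷ f a ∷ g x ∷ []) []
                (always (∁ B ⋎ ∁ A) ∷ always (∁ D ⋎ ∁ A) ∷ (♯ 5 ≼ ∣ A ⋏ G ∣) ∷
                 (♯ 1 ⊕ ∣ A ⋏ G ∣ ≼ ♯ 4 ⊕ ∣ (A ⋏ G) ⋏ ∁ (∁ B ⋏ ∁ C) ⋏ ∁ (∁ D ⋏ ∁ E) ∣) ∷ [])
                (♯ 2) (∣ A ⋏ C ⋏ E ∣) (1 ∷ 1 ∷ 1 ∷ []) refl
                (∉-is {P = M} (f⇒∉M a₁b) , ∉-is {P = M} (f⇒∉M ab) , five , ≰⇒> (λ u → none (a , f⊆Γ a ab , ne , u)) , tt)
              another : ∃[ a ] a ∈ (λ a → f b a ∧ not (is a₁ a))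
              another = pick (prove (f b ∷ is a₁ ∷ []) [] ((♯ 4 ≼ ∣ A ∣) ∷ (∣ B ∣ ≼ ♯ 1) ∷ []) (♯ 1) (∣ A ⋏ ∁ B ∣) (1 ∷ 1 ∷ 1 ∷ []) refl
                (4≤d , is≤1 a₁ , tt))
              n≤W : n ≤ count W
              n≤W = prove (M ∷ is a₁ ∷ f a₁ ∷ []) (n ∷ []) (always (∁ B ⋎ ∁ A) ∷ (atom 0 ⊕ ♯ 2 ≼ ∣ A ∣) ∷ (∣ A ⋏ C ∣ ≼ ♯ 2) ∷ [])
                (atom 0) (∣ A ⋏ ∁ B ⋏ ∁ C ∣) (1 ∷ 1 ∷ 1 ∷ []) refl (∉-is {P = M} (f⇒∉M a₁b) , M-size≥ , few a₁ a₁b , tt)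
              W≤n : count W ≤ n
              W≤n = let a , h = another
                        ab , ne = ∧-true {f b a} h
                    in prove (M ∷ is a₁ ∷ f a₁ ∷ f a ∷ []) (n ∷ [])
                      ((∣ A ∣ ≼ atom 0 ⊕ ♯ 2) ∷ (♯ 2 ≼ ∣ A ⋏ C ⋏ D ∣) ∷ [])
                      (∣ A ⋏ ∁ B ⋏ ∁ C ∣) (atom 0) (1 ∷ 1 ∷ 1 ∷ []) refl (M-size≤ , shared a ab (∉is⇒≢ ne) , tt)
              joined : ∀ a y → a ∈ f b → y ∈ W → y ∈ g a
              joined a y ab yW with a₁ ≟ᶠ a
              ... | yes refl = proj₂ (∧-true {M y} yW)
              ... | no ne = untouched {W} (λ y h → proj₁ (∧-true {M y} h)) ab
                (prove (M ∷ is a₁ ∷ f a₁ ∷ f a ∷ []) []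
                  ((♯ 2 ≼ ∣ A ⋏ C ⋏ D ∣) ∷ (∣ A ⋏ D ∣ ≼ ♯ 2) ∷ [])
                  (∣ (A ⋏ ∁ B ⋏ ∁ C) ⋏ D ∣) (♯ 0) (1 ∷ 1 ∷ 1 ∷ []) refl (shared a ab ne , few a ab , tt)) yW

    q≡1⇒ : q ≡ 1 → Sn5 n ⊆ F ⊎ W₈ ⊆ complement F
    q≡1⇒ refl = at-maximum (maximal {P = M} m M-nonempty)
      where
      -- For q = 1 a neighbour of `b` has at most one neighbour in `M`, so the vertices of `M` have
      -- disjoint neighbourhoods in N(b).
      private-neighbours : ∀ {x w} → x ∈ M → w ∈ M → x ≢ w → ∀ a → not (f x a ∧ f w a ∧ f b a) ≡ true
      private-neighbours {x} {w} xM wM ne a = not-∈ (excluded (∈-or-∉ (λ a → f x a ∧ f w a ∧ f b a) a))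
        where
        excluded : f x a ∧ f w a ∧ f b a ≡ true ⊎ f x a ∧ f w a ∧ f b a ≡ false → f x a ∧ f w a ∧ f b a ≡ false
        excluded (inj₂ h) = h
        excluded (inj₁ h) =
          let xa , r  = ∧-true {f x a} h
              wa , ba = ∧-true {f w a} r
              both : ∀ {u} → u ∈ M → a ∈ f u → u ∈ (λ y → M y ∧ f a y)
              both {u} uM ua = ∧-∈ uM (trans (f-sym a u) ua)
          in ⊥-elim (<-irrefl refl (prove ((λ y → M y ∧ f a y) ∷ is x ∷ is w ∷ []) []
               (always (∁ B ⋎ A) ∷ always (∁ C ⋎ A) ∷ always (∁ C ⋎ ∁ B) ∷ (♯ 1 ≼ ∣ B ∣) ∷ (♯ 1 ≼ ∣ C ∣) ∷ (∣ A ∣ ≼ ♯ 1) ∷ [])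
               (♯ 1) (♯ 0) (0 ∷ 1 ∷ 1 ∷ 1 ∷ []) refl
               (∈-is {P = λ y → M y ∧ f a y} (both xM xa) , ∈-is {P = λ y → M y ∧ f a y} (both wM wa) ,
                ∉-is {P = is x} (≢⇒∉is ne) , 1≤is x , 1≤is w , few a ba , tt)))

      at-maximum : ∃[ y ] y ∈ M × (∀ z → z ∈ M → m z ≤ m y) → Sn5 n ⊆ F ⊎ W₈ ⊆ complement F
      at-maximum (y , yM , y-max) = decide (any? λ x → (W x ≟ᵇ true) ×-dec (4 ≤? count (λ z → W z ∧ g x z)))
        where
        W : Fin N → Bool
        W x = M x ∧ not (is y x)
        W⊆M : ∀ x → x ∈ W → x ∈ M
        W⊆M x h = proj₁ (∧-true {M x} h)
        W≢y : ∀ {x} → x ∈ W → y ≢ x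
        W≢y {x} h = ∉is⇒≢ (proj₂ (∧-true {M x} h))
        size : count W ≡ n
        size = ≤-antisym
          (prove (M ∷ is y ∷ []) (n ∷ []) (always (∁ B ⋎ A) ∷ (♯ 1 ≼ ∣ B ∣) ∷ (∣ A ∣ ≼ atom 0 ⊕ ♯ 1) ∷ [])
            (∣ A ⋏ ∁ B ∣) (atom 0) (1 ∷ 1 ∷ 1 ∷ []) refl (∈-is {P = M} yM , 1≤is y , M-size≤ , tt))
          (prove (M ∷ is y ∷ []) (n ∷ []) ((∣ B ∣ ≼ ♯ 1) ∷ (atom 0 ⊕ ♯ 1 ≼ ∣ A ∣) ∷ [])
            (atom 0) (∣ A ⋏ ∁ B ∣) (1 ∷ 1 ∷ 1 ∷ []) refl (is≤1 y , M-size≥ , tt))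

        module _ {x} (xW : x ∈ W) (four : 4 ≤ count (λ z → W z ∧ g x z)) where
          private
            xM : x ∈ M
            xM = W⊆M x xW
            Y : Fin N → Bool
            Y z = W z ∧ g x z
            Y⊆M : ∀ z → z ∈ Y → z ∈ M
            Y⊆M z h = W⊆M z (proj₁ (∧-true {W z} h))

          -- Disjointness and the choice of `y` give 2 · m x ≤ m x + m y ≤ d, and d ≥ 6.
          Γ≥3 : 3 ≤ count (Γ x)
          Γ≥3 = prove (f b ∷ f x ∷ f y ∷ is x ∷ []) (n ∷ [])
            (always (∁ (B ⋏ C ⋏ A)) ∷ always (∁ D ⋎ ∁ A) ∷ (∣ A ⋏ B ∣ ≼ ∣ A ⋏ C ∣) ∷ (atom 0 ≼ ♯ 3 ⊕ ∣ A ∣) ∷ (♯ 9 ≼ atom 0) ∷ [])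
            (♯ 3) (∣ A ⋏ ∁ D ⋏ ∁ B ∣) (2 ∷ 1 ∷ 1 ∷ 1 ∷ []) refl
            (private-neighbours xM yM (W≢y xW ∘ sym) , ∉-is {P = f b} (M⇒∉f xM) , y-max x xM , d≥ , 9≤n , tt)

          -- If any two vertices of Γ x had a common neighbour in Y, then all of Γ x
          -- would be joined to a single w, against the choice of y.
          not-all-joined : ∀ {w} → w ∈ Y → (∀ a → a ∈ Γ x → a ∈ f w) → ⊥
          not-all-joined {w} wY all = <-irrefl refl (prove (f b ∷ f x ∷ f y ∷ f w ∷ is x ∷ []) (n ∷ [])
            (always (∁ (B ⋏ C ⋏ A)) ∷ always (∁ (B ⋏ D ⋏ A)) ∷ always (∁ (D ⋏ C ⋏ A)) ∷
             always (∁ (A ⋏ ∁ E ⋏ ∁ B) ⋎ D) ∷ always (∁ E ⋎ ∁ A) ∷ (∣ A ⋏ D ∣ ≼ ∣ A ⋏ C ∣) ∷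
             (♯ 3 ≼ ∣ A ⋏ ∁ E ⋏ ∁ B ∣) ∷ [])
            (♯ 1) (♯ 0) (0 ∷ 1 ∷ 1 ∷ []) refl
            (private-neighbours xM yM (W≢y xW ∘ sym) , private-neighbours xM wM (g⇒≢ xw) ,
             private-neighbours wM yM (W≢y wW ∘ sym) , ⊆⇒always {P = Γ x} {f w} all ,
             ∉-is {P = f b} (M⇒∉f xM) , y-max w wM , Γ≥3 , tt))
            where
            wW : w ∈ W
            wW = proj₁ (∧-true {W w} wY)
            wM : w ∈ M
            wM = W⊆M w wW
            xw : w ∈ g x
            xw = proj₂ (∧-true {W w} wY)

          Missed : Fin N → Fin N → Fin N → Bool
          Missed a c z = Y z ∧ not (g a z) ∧ not (g c z)

          missed⇒f : ∀ {a z} → a ∈ f b → z ∈ Y → z ∉ g a → z ∈ f a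
          missed⇒f {a} {z} ab zY h rewrite ≢⇒∉is {u = a} {z} (λ eq → true≢false (Y⊆M z zY) (subst (_∉ M) eq (f⇒∉M ab))) =
            trans (sym (not-involutive (f a z))) (not-∈ h)

          -- By `spread₁` two spokes with no common missed vertex suffice. Otherwise any two
          -- vertices of `Γ x` have a common neighbour in `Y`; each has only one neighbour in `M`,
          -- so it is the same `w` for all of them.
          hub : W₈ ⊆ complement F
          hub = search (any? λ a → any? λ c → (Γ x a ≟ᵇ true) ×-dec (Γ x c ≟ᵇ true) ×-dec ¬? (a ≟ᶠ c) ×-dec
              (count (Missed a c) ≤? 0))
            where
            search : Dec (∃[ a ] ∃[ c ] (a ∈ Γ x × c ∈ Γ x × a ≢ c × count (Missed a c) ≤ 0)) → W₈ ⊆ complement F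
            search (yes (a , c , a∈ , c∈ , ne , none)) = with-third (pick {P = λ e → Γ x e ∧ not (is a e) ∧ not (is c e)}
                (prove (Γ x ∷ is a ∷ is c ∷ []) [] ((♯ 3 ≼ ∣ A ∣) ∷ (∣ B ∣ ≼ ♯ 1) ∷ (∣ C ∣ ≼ ♯ 1) ∷ [])
                  (♯ 1) (∣ A ⋏ ∁ B ⋏ ∁ C ∣) (1 ∷ 1 ∷ 1 ∷ 1 ∷ []) refl (Γ≥3 , is≤1 a , is≤1 c , tt)))
              where
              with-third : ∃[ e ] e ∈ (λ e → Γ x e ∧ not (is a e) ∧ not (is c e)) → W₈ ⊆ complement F
              with-third (e , h) =
                let e∈ , r  = ∧-true {Γ x e} h
                    ae , ce = ∧-true {not (is a e)} r
                    all∈ : ∀ i → cons a (cons c (cons e λ ())) i ∈ Γ x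
                    all∈ = λ { 0F → a∈ ; 1F → c∈ ; 2F → e∈ }
                in spread₁ (frame xM (λ z h → ∧-∈ (Y⊆M z h) (proj₂ (∧-true {W z} h)))
                       (triple-injective ne (∉is⇒≢ ae) (∉is⇒≢ ce)) all∈)
                     Y⊆M (λ i → missed≤q Y⊆M _ (proj₁ (∧-true (all∈ i)))) four none
            search (no crossing) =
              let c , inj , c∈ = choose 2 {Γ x} (≤-trans (n≤1+n 2) Γ≥3)
              in from-pair (c∈ 0F) (meet (c∈ 0F) (c∈ 1F) ((λ ()) ∘ inj))
              where
              meet : ∀ {a c} → a ∈ Γ x → c ∈ Γ x → a ≢ c → ∃[ w ] w ∈ Missed a c
              meet {a} {c} a∈ c∈ ne = pick (≰⇒> λ none → crossing (a , c , a∈ , c∈ , ne , none))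
              from-pair : ∀ {a c} → a ∈ Γ x → ∃[ w ] w ∈ Missed a c → W₈ ⊆ complement F
              from-pair {a} {c} a∈ (w , h) = ⊥-elim (not-all-joined wY λ e e∈ → joined e e∈ (a ≟ᶠ e))
                where
                wY : w ∈ Y
                wY = proj₁ (∧-true {Y w} h)
                ab : a ∈ f b
                ab = proj₁ (∧-true {f b a} a∈)
                aw : w ∈ f a
                aw = missed⇒f ab wY (not-∉ (proj₁ (∧-true {not (g a w)} (proj₂ (∧-true {Y w} h)))))
                joined : ∀ e → e ∈ Γ x → Dec (a ≡ e) → e ∈ f w
                joined e e∈ (yes refl) = trans (f-sym w e) aw
                joined e e∈ (no ne) = same (meet a∈ e∈ ne)
                  where
                  same : ∃[ z ] z ∈ Missed a e → e ∈ f w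
                  same (z , k) = by-eq (w ≟ᶠ z)
                    where
                    zY : z ∈ Y
                    zY = proj₁ (∧-true {Y z} k)
                    r = ∧-true {not (g a z)} (proj₂ (∧-true {Y z} k))
                    az : z ∈ f a
                    az = missed⇒f ab zY (not-∉ (proj₁ r))
                    ez : z ∈ f e
                    ez = missed⇒f (proj₁ (∧-true {f b e} e∈)) zY (not-∉ (proj₂ r))
                    by-eq : Dec (w ≡ z) → e ∈ f w
                    by-eq (yes eq) = trans (f-sym w e) (subst (_∈ f e) (sym eq) ez)
                    by-eq (no ne)  = ⊥-elim (true≢false
                      (∧-∈ (trans (f-sym w a) aw) (∧-∈ (trans (f-sym z a) az) ab))
                      (not-∉ (private-neighbours (Y⊆M w wY) (Y⊆M z zY) ne a)))

        -- A common neighbour of `b` and `y` has used up its single neighbour in `M` on `y`. If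
        -- there is none, then by maximality of m at `y` there are no edges between N(b) and `M` at
        -- all.
        hub-for-W : ∃[ a ] a ∈ f b × (∀ x → x ∈ W → x ∈ g a)
        hub-for-W = by-m (find (λ a → f b a ∧ f y a))
          where
          joined : ∀ a → a ∈ f b → count (λ x → W x ∧ f a x) ≤ 0 → ∃[ a ] a ∈ f b × (∀ x → x ∈ W → x ∈ g a)
          joined a ab none = a , ab , λ x → untouched {W} W⊆M ab none
          by-m : (∃[ a ] a ∈ (λ a → f b a ∧ f y a)) ⊎ (∀ a → a ∉ (λ a → f b a ∧ f y a)) →
                 ∃[ a ] a ∈ f b × (∀ x → x ∈ W → x ∈ g a)
          by-m (inj₁ (a , h)) = let ab , ya = ∧-true {f b a} h in joined a ab
            (prove (M ∷ is y ∷ f a ∷ []) []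
              (always (∁ B ⋎ A) ∷ always (∁ B ⋎ C) ∷ (♯ 1 ≼ ∣ B ∣) ∷ (∣ A ⋏ C ∣ ≼ ♯ 1) ∷ [])
              (∣ (A ⋏ ∁ B) ⋏ C ∣) (♯ 0) (1 ∷ 1 ∷ 1 ∷ []) refl
              (∈-is {P = M} yM , ∈-is {P = f a} (trans (f-sym a y) ya) , 1≤is y , few a ab , tt))
          by-m (inj₂ none) = let a , ab = pick {P = f b} (≤-trans (s≤s z≤n) 4≤d) in
            joined a ab (≤-trans (count-mono {P = λ x → W x ∧ f a x} {λ _ → false} λ x h →
              let xW , ax = ∧-true {W x} h in
              ⊥-elim (<⇒≱ (∈⇒1≤ {P = λ a → f b a ∧ f x a} {a} (∧-∈ ab (trans (f-sym x a) ax)))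
                (≤-trans (y-max x (W⊆M x xW)) m-y≡0))) (≤-reflexive (sumF-0 N)))
            where
            m-y≡0 : m y ≤ 0
            m-y≡0 = ≤-trans (count-mono {P = λ a → f b a ∧ f y a} {λ _ → false} λ a h → ⊥-elim (true≢false h (none a)))
              (≤-reflexive (sumF-0 N))

        decide : Dec (∃[ x ] (x ∈ W × 4 ≤ count (λ z → W z ∧ g x z))) → Sn5 n ⊆ F ⊎ W₈ ⊆ complement F
        decide (yes (x , xW , four)) = inj₂ (hub xW four)
        decide (no none) = let a , _ , W⊆ga = hub-for-W in
          low-degree 9≤n size (λ x xW → ≮⇒≥ λ four → none (x , xW , four)) {h = a} W⊆ga

-- Upper bound and conclusion.

module UpperBound {N} (F : Graph N) where
  open Wheels F
  open Stars F
  open SparseCase F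
  open DenseCase F
  open MiddleCase F

  module _ {n} (order : suc N ≡ 2 * n) (9≤n : 9 ≤ n) where
    at-maximum : ∀ b → (∀ v → count (f v) ≤ count (f b)) → Sn5 n ⊆ F ⊎ W₈ ⊆ complement F
    -- The larger centre of S_n(5) has degree n - 5: its n - 6 leaves and the other centre.
    at-maximum b b-max with 6 + count (f b) ≤? n
    ... | yes sparse = inj₂ (sparse⇒wheel order (λ v → ≤-trans (+-monoʳ-≤ 6 (b-max v)) sparse) b)
    ... | no not-sparse = by-star (any? λ a → (f b a ≟ᵇ true) ×-dec (5 ≤? count (f a)) ×-dec (n ≤? count (λ x → f a x ∨ f b x)))
      where
      by-star : Dec (∃[ a ] (a ∈ f b × 5 ≤ count (f a) × n ≤ count (λ x → f a x ∨ f b x))) → Sn5 n ⊆ F ⊎ W₈ ⊆ complement F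
      by-star (yes (a , ab , high , large)) = inj₁ (double-star (≤-trans (m≤n+m 6 3) 9≤n) (trans (f-sym a b) ab) high
        (≤-pred (≰⇒> not-sparse)) large)
      by-star (no none) = by-degree (n ≤? 1 + count (f b))
        where
        no-star : ∀ a → a ∈ f b → 5 ≤ count (f a) → count (λ x → f a x ∨ f b x) < n
        no-star a ab high = ≰⇒> λ large → none (a , ab , high , large)
        by-degree : Dec (n ≤ 1 + count (f b)) → Sn5 n ⊆ F ⊎ W₈ ⊆ complement F
        by-degree (yes dense) = inj₂ (dense⇒wheel order 9≤n b-max no-star dense)
        by-degree (no not-dense) = by-few (any? λ v → (f b v ≟ᵇ true) ×-dec (suc q ≤? count (λ x → g b x ∧ f v x)))
          where
          q : ℕ
          q = n ∸ (2 + count (f b))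
          q≤3 : q ≤ 3
          q≤3 = m≤n+o⇒m∸n≤o n (2 + count (f b)) (≤-trans (≤-pred (≰⇒> not-sparse)) (≤-reflexive (+-comm 3 (2 + count (f b)))))
          degree-b : 2 + q + count (f b) ≡ n
          degree-b = trans (cong (2 +_) (+-comm q (count (f b)))) (m+[n∸m]≡n (≰⇒> not-dense))
          by-few : Dec (∃[ v ] (v ∈ f b × q < count (λ x → g b x ∧ f v x))) → Sn5 n ⊆ F ⊎ W₈ ⊆ complement F
          by-few (yes (v , bv , many)) = inj₂ (low-hub order 9≤n b-max no-star q≤3 degree-b v bv many)
          by-few (no never) = by-q q≤3 degree-b few sizes
            where
            few : ∀ v → v ∈ f b → count (λ x → g b x ∧ f v x) ≤ q
            few v bv = ≮⇒≥ λ many → never (v , bv , many)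
            sizes : n + q ≤ count (g b) × count (g b) ≤ n + q
            sizes = M-size≥ order 9≤n b-max no-star q≤3 degree-b , M-size≤ order 9≤n b-max no-star q≤3 degree-b
            by-q : ∀ {q} → q ≤ 3 → 2 + q + count (f b) ≡ n → (∀ v → v ∈ f b → count (λ x → g b x ∧ f v x) ≤ q) →
                   n + q ≤ count (g b) × count (g b) ≤ n + q → Sn5 n ⊆ F ⊎ W₈ ⊆ complement F
            by-q {0} le deg few (lo , hi) = q≡0⇒ 9≤n le b-max deg lo hi few refl
            by-q {1} le deg few (lo , hi) = q≡1⇒ 9≤n le b-max deg lo hi few refl
            by-q {2} le deg few (lo , hi) = q≡2⇒ 9≤n le b-max deg lo hi few refl
            by-q {3} le deg few (lo , hi) = inj₂ (q≡3⇒ 9≤n le b-max deg lo hi few refl)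
            by-q {suc (suc (suc (suc q)))} (s≤s (s≤s (s≤s ()))) _ _ _

    upper-bound : Sn5 n ⊆ F ⊎ W₈ ⊆ complement F
    upper-bound = let b , _ , b-max = maximal {P = λ _ → true} (λ v → count (f v)) nonempty in at-maximum b λ v → b-max v refl
      where
      nonempty : 1 ≤ count {N} (λ _ → true)
      nonempty = ≤-trans (≤-pred (≤-trans (≤-trans (m≤n+m 2 16) (*-monoʳ-≤ 2 9≤n)) (≤-reflexive (sym order))))
        (≤-reflexive (sym (count-all N)))

theorem19 : (n : ℕ) → 9 ≤ n → IsRamseyNumber (Sn5 n) W₈ (2 * n ∸ 1)
theorem19 n 9≤n = (λ F → UpperBound.upper-bound F (suc-pred-2* n 9≤n) 9≤n) , lower-bound n 9≤n
  where
  suc-pred-2* : ∀ n → 9 ≤ n → suc (2 * n ∸ 1) ≡ 2 * n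
  suc-pred-2* (suc n) _ = refl
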